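{- There is no multiset of $15$ lines in $\mathrm{PG}(9,2)$ such that no more than $6$ of those lines (counted with multiplicity) are contained in a hyperplane of $\mathrm{PG}(9,2)$.
   Context: $\mathrm{PG}(9,2)$ is the projective space of dimension $9$ over $\mathbb{F}_2$, i.e. the geometry of subspaces of $\mathbb{F}_2^{10}$; lines are $2$-dimensional vector subspaces and hyperplanes are $9$-dimensional vector subspaces. -}

module Defs where

open import Data.Bool using (Bool; true; false; _xor_; _∧_)
open import Data.Nat using (ℕ; _≤_)
open import Data.Fin using (Fin)
open import Data.Fin.Subset using (Subset; _∈_; ∣_∣)
open import Data.Vec using (Vec; replicate; zipWith; foldr′)
open import Relation.Binary.PropositionalEquality using (_≡_; _≢_)
open import Data.Sum using (_⊎_)

F₂^ : ℕ → Set
F₂^ n = Vec Bool n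

0v : ∀ {n} → F₂^ n
0v = replicate _ false

_⊕_ : ∀ {n} → F₂^ n → F₂^ n → F₂^ n
_⊕_ = zipWith _xor_

dot : ∀ {n} → F₂^ n → F₂^ n → Bool
dot a x = foldr′ _xor_ false (zipWith _∧_ a x)

-- PG(9,2): subspaces of F₂^10.
N : ℕ
N = 10

-- A line of PG(9,2) = a 2-dimensional subspace of F₂^10, given by a basis
-- (u , v): over F₂, u and v are linearly independent iff u ≠ 0, v ≠ 0, u ≠ v.
record Line : Set where
  constructor mkLine
  field
    u v  : F₂^ N
    u≢0  : u ≢ 0v
    v≢0  : v ≢ 0v
    u≢v  : u ≢ v

_∈Line_ : F₂^ N → Line → Set
x ∈Line L = x ≡ 0v ⊎ x ≡ Line.u L ⊎ x ≡ Line.v L ⊎ x ≡ (Line.u L ⊕ Line.v L)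

-- A hyperplane of PG(9,2) = a 9-dimensional subspace of F₂^10, i.e. the kernel
-- of a nonzero linear functional x ↦ a · x.
record Hyperplane : Set where
  constructor mkHyperplane
  field
    a   : F₂^ N
    a≢0 : a ≢ 0v

_∈Hyp_ : F₂^ N → Hyperplane → Set
x ∈Hyp H = dot (Hyperplane.a H) x ≡ false

_⊆Hyp_ : Line → Hyperplane → Set
L ⊆Hyp H = ∀ x → x ∈Line L → x ∈Hyp H

-- A multiset of m lines: an m-tuple of lines (order irrelevant, repetitions allowed).
-- "At most k of the lines, counted with multiplicity, lie in every hyperplane":
-- every set S of indices whose lines all lie in H has |S| ≤ k.
AtMostInEveryHyperplane : ∀ {m} → ℕ → Vec Line m → Set
AtMostInEveryHyperplane {m} k Ls =
  ∀ (H : Hyperplane) (S : Subset m) →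
    (∀ i → i ∈ S → Data.Vec.lookup Ls i ⊆Hyp H) → ∣ S ∣ ≤ k

{-# OPTIONS --safe #-}
-- Say that a ∈ F₂¹⁰ kills a line if the functional dot a vanishes on it; assume that every a ≠ 0 kills at
-- most six of the fifteen lines. If any four lines had at most four common killers, then summing
-- (c − 2)(c − 3)(c − 5)(c − 6) ≥ 0 over all a, where c counts the lines killed by a, would give
-- 247110 ≤ 246840. So some four lines are killed by a 3-dimensional space U. Each nonzero vector of U kills
-- at most two of the other eleven lines, which leaves five possibilities for the restrictions of these
-- lines to U, up to a change of basis. Recording the restrictions of a to the eleven lines turns a into a
-- row of eleven elements of F₂², in such a way that the rows of U are known. By counting, there are
-- vectors x₁, …, x₄ outside U, each killing all but one of the four lines, and for any two of these four
-- lines a vector outside ⟨U, xᵢ, xⱼ⟩ killing both of the other lines; all the cosets of U that they span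
-- obey upper bounds on the number of zeros of their rows. An exhaustive search, carried out by evaluation,
-- shows that such rows do not exist. In the search the eight vectors u of U get distinct primes p, and
-- "u ⊞ a has at most k zeros for each u" is tested as divisibility of ∏ pᵏ by the product of the p over
-- all zeros, so that one remainder serves all eight bounds; the symmetries of U cut down the first row.
module Submission where

open import Defs
open import Data.Vec using (Vec)
open import Relation.Nullary using (¬_)
open import Data.Product using (∃)
open import Agda.Builtin.Nat using (mod-helper; div-helper)
open import Data.Bool using (Bool; true; false; _∧_; _∨_; not; if_then_else_; T; _xor_)
open import Data.Bool.Properties using (_≟_; ∧-assoc; ∨-zeroʳ)
open import Data.Empty using (⊥; ⊥-elim)
open import Data.Fin.Subset using (Subset; ∣_∣)
open import Data.List using (List; []; _∷_; _++_; map; concatMap; length; replicate)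
open import Data.List.Membership.Propositional using () renaming (_∈_ to _∈ᴸ_)
open import Data.List.Membership.Propositional.Properties using (∈-++⁺ˡ; ∈-++⁺ʳ; ∈-map⁺; ∈-map⁻)
import Data.List.Membership.DecPropositional as Membership
open import Data.List.Properties using (length-map; length-++; map-cong; map-cong-local; map-∘; map-++)
open import Data.List.Relation.Binary.Permutation.Propositional as Perm using (_↭_; ↭-trans; ↭-refl; prep)
open import Data.List.Relation.Binary.Permutation.Propositional.Properties using (++⁺ˡ; ↭-length; All-resp-↭) renaming (shift to ↭-shift)
open import Data.List.Relation.Unary.All as All using (All; []; _∷_)
open import Data.List.Relation.Unary.All.Properties using (++⁺; map⁺; concat⁺)
open import Data.List.Relation.Unary.Any using (here; there)
open import Data.Nat using (ℕ; zero; suc; _+_; _*_; _^_; _∸_; _≡ᵇ_; _≤ᵇ_; _<ᵇ_; _%_; _/_; _≤_; _<_; z≤n; s≤s)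
open import Data.Nat.Divisibility
open import Data.Nat.ListAction using (sum)
open import Data.Nat.Properties hiding (_≟_)
open import Data.Product using (_×_; _,_; proj₁; proj₂; ∃-syntax)
open import Data.Sum using (_⊎_; inj₁; inj₂)
open import Data.Unit using (⊤; tt)
open import Data.Vec as Vec using ([]; _∷_; toList)
open import Data.Vec.Properties using (≡-dec; lookup-map; []=⇒lookup; length-toList)
open import Function using (_∘_)
open import Relation.Binary.PropositionalEquality
open import Relation.Nullary using (Dec; yes; no; ¬?)
open import Relation.Nullary.Decidable using (_×-dec_; decidable-stable)

-- The search

-- Four independent lines have 2^10 / 4^4 = 4 common killers, the least possible number. If no four
-- lines had more, the sums over a of the binomials C(c, k) with k ≤ 4 would be C(15, k) · 2^(10 -
-- 2k), and the zero vector, which kills all fifteen lines, would contribute more to the sum of the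
-- quartic than the whole sum. The quartic is nonnegative at integers because its roots form two
-- pairs of neighbours.
--
-- On U the bound two is 6 - 4. Restricted to U, a line becomes a linear map from F₂³ to F₂², with
-- 1, 3 or 7 nonzero zeros. Eleven such numbers with sum at most 7 · 2 = 14 are all 1, or one is 3
-- and the others are 1. In the first case the seven counts fall short of two by three altogether,
-- which makes three patterns under GL(3,2); in the second they fall short by one, at a point on the
-- plane of the exceptional line or off it.
--
-- All bounds of the search have one source: a vector outside U that kills at least 4 - m of the
-- four lines has at most 6 - (4 - m) = 2 + m zeros in its row, and so has every vector of its coset
-- modulo U.

data F : Set where
  e₀ e₁ e₂ e₃ : F

infixl 6 _⊹_
_⊹_ : F → F → F
e₀ ⊹ y = y
e₁ ⊹ e₀ = e₁
e₁ ⊹ e₁ = e₀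
e₁ ⊹ e₂ = e₃
e₁ ⊹ e₃ = e₂
e₂ ⊹ e₀ = e₂
e₂ ⊹ e₁ = e₃
e₂ ⊹ e₂ = e₀
e₂ ⊹ e₃ = e₁
e₃ ⊹ e₀ = e₃
e₃ ⊹ e₁ = e₂
e₃ ⊹ e₂ = e₁
e₃ ⊹ e₃ = e₀

isZ : F → Bool
isZ e₀ = true
isZ _ = false

_==_ : F → F → Bool
e₀ == e₀ = true
e₁ == e₁ = true
e₂ == e₂ = true
e₃ == e₃ = true
_ == _ = false

Row : Set
Row = List F

infixl 6 _⊞_
_⊞_ : Row → Row → Row
(x ∷ xs) ⊞ (y ∷ ys) = (x ⊹ y) ∷ (xs ⊞ ys)
_ ⊞ _ = []

_==ʳ_ : Row → Row → Bool
[] ==ʳ [] = true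
(x ∷ xs) ==ʳ (y ∷ ys) = (x == y) ∧ (xs ==ʳ ys)
_ ==ʳ _ = false

data Quad : Set where
  quad : (w x y z : ℕ) → Quad

pick : F → Quad → ℕ
pick e₀ (quad w x y z) = w
pick e₁ (quad w x y z) = x
pick e₂ (quad w x y z) = y
pick e₃ (quad w x y z) = z

-- One quad per column, giving the factor that each of the four possible entries contributes. The
-- weight of a row is a product over its columns, so whether it divides a bound can be decided
-- column by column, and a bad beginning cuts off all its continuations.
Table : Set
Table = List Quad

shift : F → Quad → Quad
shift e₀ q = q
shift e₁ (quad w x y z) = quad x w z y
shift e₂ (quad w x y z) = quad y z w x
shift e₃ (quad w x y z) = quad z y x w

_*ᵠ_ : Quad → Quad → Quad
quad w x y z *ᵠ quad w' x' y' z' = quad (w * w') (x * x') (y * y') (z * z')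

offset : Row → Table → Table
offset (x ∷ xs) (q ∷ qs) = shift x q ∷ offset xs qs
offset _ _ = []

_*ᵗ_ : Table → Table → Table
(q ∷ qs) *ᵗ (r ∷ rs) = (q *ᵠ r) ∷ (qs *ᵗ rs)
_ *ᵗ _ = []

point : ℕ → F → Quad
point p e₀ = quad p 1 1 1
point p e₁ = quad 1 p 1 1
point p e₂ = quad 1 1 p 1
point p e₃ = quad 1 1 1 p

single : ℕ → Row → Table
single p [] = []
single p (u ∷ us) = point p u ∷ single p us

table : List ℕ → List Row → Table
table (p ∷ []) (u ∷ us) = single p u
table (p ∷ ps) (u ∷ us) = single p u *ᵗ table ps us
table _ _ = []

bound : ℕ → List ℕ → ℕ
bound k [] = 1
bound k (p ∷ ps) = p ^ k * bound k ps

data Trie (A : Set) : Set where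
  end  : Trie A
  leaf : A → Trie A
  node : (w x y z : Trie A) → Trie A

Rows : Set
Rows = Trie ⊤

isEnd : Rows → Bool
isEnd end = true
isEnd _ = false

branch : Rows → Rows → Rows → Rows → Rows
branch end end end end = end
branch w x y z = node w x y z

-- On the way down the bound `N` is divided by the factor of each entry, and a branch ends when a
-- division is not exact. `mod-helper 0 a N a` and `div-helper 0 a N a` are what `N % suc a` and
-- `N / suc a` stand for; `sieveIf` matches on the remainder before it touches the quotient.
sieve : Table → Rows → ℕ → Rows
sieveChild : Rows → ℕ → Table → ℕ → Rows
sieveBy : ℕ → Table → Rows → ℕ → Rows
sieveIf : ℕ → ℕ → Table → Rows → ℕ → Rows
sieve [] t N = t
sieve (quad a b c d ∷ qs) (node w x y z) N =
  branch (sieveChild w a qs N) (sieveChild x b qs N) (sieveChild y c qs N) (sieveChild z d qs N)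
sieve (_ ∷ _) _ N = end
sieveChild end a qs N = end
sieveChild t a qs N = sieveBy a qs t N
sieveBy zero qs t N = sieve qs t N
sieveBy (suc a) qs t N = sieveIf (mod-helper 0 a N a) a qs t N
sieveIf zero a qs t N = sieve qs t (div-helper 0 a N a)
sieveIf (suc _) a qs t N = end

grow : Table → ℕ → Rows
growBy : ℕ → Table → ℕ → Rows
growIf : ℕ → ℕ → Table → ℕ → Rows
grow [] N = leaf tt
grow (quad a b c d ∷ qs) N = branch (growBy a qs N) (growBy b qs N) (growBy c qs N) (growBy d qs N)
growBy zero qs N = grow qs N
growBy (suc a) qs N = growIf (mod-helper 0 a N a) a qs N
growIf zero a qs N = grow qs (div-helper 0 a N a)
growIf (suc _) a qs N = end

barren : Table → ℕ → Bool
barrenBy : ℕ → Table → ℕ → Bool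
barrenIf : ℕ → ℕ → Table → ℕ → Bool
barren [] N = false
barren (quad a b c d ∷ qs) N = barrenBy a qs N ∧ barrenBy b qs N ∧ barrenBy c qs N ∧ barrenBy d qs N
barrenBy zero qs N = barren qs N
barrenBy (suc a) qs N = barrenIf (mod-helper 0 a N a) a qs N
barrenIf zero a qs N = barren qs (div-helper 0 a N a)
barrenIf (suc _) a qs N = true

leaves : Rows → (Row → Row) → List Row → List Row
leaves end k r = r
leaves (leaf _) k r = k [] ∷ r
leaves (node w x y z) k r =
  leaves w (k ∘ (e₀ ∷_)) (leaves x (k ∘ (e₁ ∷_)) (leaves y (k ∘ (e₂ ∷_)) (leaves z (k ∘ (e₃ ∷_)) r)))

rows : Rows → List Row
rows t = leaves t (λ z → z) []

delete : Row → Rows → Rows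
delete [] (leaf _) = end
delete (e₀ ∷ p) (node w x y z) = branch (delete p w) x y z
delete (e₁ ∷ p) (node w x y z) = branch w (delete p x) y z
delete (e₂ ∷ p) (node w x y z) = branch w x (delete p y) z
delete (e₃ ∷ p) (node w x y z) = branch w x y (delete p z)
delete _ t = t

deletes : List Row → Rows → Rows
deletes [] t = t
deletes (p ∷ ps) t = deletes ps (delete p t)

-- `kill e t` is to certify that `e` is in no clique whose other members have translates in `t`. The
-- images of `e` are then removed, so that later rows face a smaller trie; emptiness at the end
-- certifies that the list of rows was complete.
loop : (Row → Rows → Bool) → (Row → List Row) → List Row → Rows → Bool
loop kill dels [] t = isEnd t
loop kill dels (e ∷ es) t = kill e t ∧ loop kill dels es (deletes (dels e) t)

Pivot : Set
Pivot = ℕ × Bool × Row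

bit : Bool → F → Bool
bit false e₀ = false
bit false e₁ = true
bit false e₂ = false
bit false e₃ = true
bit true e₀ = false
bit true e₁ = false
bit true e₂ = true
bit true e₃ = true

bitAt : ℕ → Bool → Row → Bool
bitAt l b [] = false
bitAt zero b (x ∷ xs) = bit b x
bitAt (suc l) b (x ∷ xs) = bitAt l b xs

firstBit : ℕ → Row → ℕ × Bool
firstBit l [] = l , false
firstBit l (e₀ ∷ xs) = firstBit (suc l) xs
firstBit l (e₂ ∷ xs) = l , true
firstBit l (_ ∷ xs) = l , false

-- Gaussian elimination over F₂, each column counting as two bits. It yields combinations of the
-- given rows; that they form a triangular system is left to the evaluated test `triangular`.
eliminate : ℕ → List Row → List Pivot
reduce : ℕ → ℕ × Bool → Row → List Row → List Pivot
eliminate (suc n) (w ∷ ws) = reduce n (firstBit 0 w) w ws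
eliminate _ _ = []
reduce n (l , b) w ws = (l , b , w) ∷ eliminate n (map (λ v → if bitAt l b v then v ⊞ w else v) ws)

clearOf : ℕ → Bool → List Pivot → Bool
clearOf l b [] = true
clearOf l b ((_ , _ , w) ∷ ps) = not (bitAt l b w) ∧ clearOf l b ps

triangular : List Pivot → Bool
triangular [] = true
triangular ((l , b , w) ∷ ps) = bitAt l b w ∧ clearOf l b ps ∧ triangular ps

forbidBit : Bool → ℕ → Quad → Quad
forbidBit false M (quad w x y z) = quad w M y M
forbidBit true M (quad w x y z) = quad w x M M

forbid : ℕ → Bool → ℕ → Table → Table
forbid l b M [] = []
forbid zero b M (q ∷ qs) = forbidBit b M q ∷ qs
forbid (suc l) b M (q ∷ qs) = q ∷ forbid l b M qs

-- `M` is taken as the successor of the bound, so it divides neither the bound nor any quotient met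
-- on the way. Entries with a pivot bit set are thereby excluded, and each coset modulo the pivot
-- rows is represented by its member with all pivot bits zero.
restrict : List Pivot → ℕ → Table → Table
restrict [] M t = t
restrict ((l , b , w) ∷ ps) M t = forbid l b M (restrict ps M t)

data GL : Set where
  gl : (x y : F) → GL

act : GL → F → F
act (gl x y) e₀ = e₀
act (gl x y) e₁ = x
act (gl x y) e₂ = y
act (gl x y) e₃ = x ⊹ y

insert : {A : Set} → ℕ → A → List A → List A
insert zero x ys = x ∷ ys
insert (suc k) x [] = x ∷ []
insert (suc k) x (y ∷ ys) = y ∷ insert k x ys

permute : {A : Set} → List ℕ → List A → List A
permute (k ∷ ks) (x ∷ xs) = insert k x (permute ks xs)
permute _ xs = xs

actRow : List GL → Row → Row
actRow (m ∷ ms) (x ∷ xs) = act m x ∷ actRow ms xs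
actRow _ xs = xs

Sym : Set
Sym = List ℕ × List GL

_·_ : Sym → Row → Row
(ks , ms) · r = actRow ms (permute ks r)

-- `γ` is meant as the inverse of `δ`. Testing that it brings the image back to `p` replaces a proof
-- of that: if the image belonged to a clique, then so would `p`, by the symmetry `γ` alone.
image : Row → Sym × Sym → List Row
image p (δ , γ) = if (γ · (δ · p)) ==ʳ p then (δ · p) ∷ [] else []

orbit : List (List (Sym × Sym)) → List Row → List Row
orbit [] rs = rs
orbit (st ∷ sts) rs = orbit sts (rs ++ concatMap (λ p → concatMap (image p) st) rs)

zeroRow : Row → Row
zeroRow = map (λ _ → e₀)

double : Row → List Row → List Row
double e rs = rs ++ map (e ⊞_) rs

sums : Row → List Row → List Row
sums z [] = z ∷ []
sums z (e ∷ es) = double e (sums z es)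

-- `tabs` holds sixteen tables of `U` over disjoint sets of eight primes, so that bounds on sixteen
-- cosets combine into one divisibility; `t₀` and `t₁` are the first two. The numbers are the
-- matching bounds, `nG` being the one for all sixteen tables.
record Ctx : Set where
  constructor ctx
  field
    basis : List Row
    U : List Row
    tabs : List Table
    t₀ t₁ : Table
    a₂ a₃ a₄ a₅ a₆ a₄₅ nG : ℕ
    syms : List (List (Sym × Sym))
open Ctx

product : List Row → List Table → Table
product (x ∷ []) (t ∷ _) = offset x t
product (x ∷ xs) (t ∷ ts) = offset x t *ᵗ product xs ts
product _ _ = []

-- An extension for `a`, `b` kills the two lines that `c` and `d` fail to kill. Adding `a`, `b` or a
-- row of `U` to it preserves the set of its bounds, so it is sought in normal form modulo these
-- five rows. With the sums of `c`, `d`, `a`, `b` it gives sixteen cosets, tested by a single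
-- divisibility.
noExt : Ctx → Row → Row → Row → Row → Bool
noExt′ : Ctx → List Pivot → List Row → Row → Bool
noExt C a b c d = noExt′ C (eliminate 5 (a ∷ b ∷ basis C)) (sums (zeroRow a) (c ∷ d ∷ a ∷ b ∷ [])) a
noExt′ C ps ss a = triangular ps ∧ barren (restrict ps (suc (nG C)) (product ss (tabs C))) (nG C)

noExts : Ctx → Row → Row → Row → Row → Bool
noExts C a b c d = noExt C a b c d ∨ noExt C a c b d ∨ noExt C a d b c ∨ noExt C b c a d ∨ noExt C b d a c ∨ noExt C c d a b

fits : Table → Row → ℕ → Bool
weight : Table → Row → ℕ
weight (q ∷ qs) (v ∷ vs) = pick v q * weight qs vs
weight _ _ = 1
dividesᵇ : ℕ → ℕ → Bool
dividesᵇ zero N = true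
dividesᵇ (suc a) N = mod-helper 0 a N a ≡ᵇ 0
fits t r N = dividesᵇ (weight t r) N

-- A trie in which the branches with a single member are marked with that member, so that it can be
-- tested at one stroke.
data Packed : Set where
  vacant : Packed
  alone : Row → Rows → Packed
  split : (w x y z : Packed) → Packed

lone : Rows → List Row
lone end = []
lone (leaf _) = [] ∷ []
lone (node w x y z) =
  if isEnd x ∧ isEnd y ∧ isEnd z then map (e₀ ∷_) (lone w) else
  if isEnd w ∧ isEnd y ∧ isEnd z then map (e₁ ∷_) (lone x) else
  if isEnd w ∧ isEnd x ∧ isEnd z then map (e₂ ∷_) (lone y) else
  if isEnd w ∧ isEnd x ∧ isEnd y then map (e₃ ∷_) (lone z) else []

pack : Rows → Packed
packAs : List Row → Rows → Packed
pack t = packAs (lone t) t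
packAs (s ∷ _) t = alone s t
packAs [] (node w x y z) = split (pack w) (pack x) (pack y) (pack z)
packAs [] _ = vacant

-- Triples are looked for in increasing order only. A branch marked with a single row is kept even
-- if that row comes earlier: the result may be too large, but never too small.
beyond : Row → Packed → Packed
beyond _ (alone s t) = alone s t
beyond (e₀ ∷ p) (split w x y z) = split (beyond p w) x y z
beyond (e₁ ∷ p) (split w x y z) = split vacant (beyond p x) y z
beyond (e₂ ∷ p) (split w x y z) = split vacant vacant (beyond p y) z
beyond (e₃ ∷ p) (split w x y z) = split vacant vacant vacant (beyond p z)
beyond _ _ = vacant

keep : Bool → Rows → Rows
keep true t = t
keep false t = end

winnow : Table → Packed → ℕ → Rows
winnowBy : ℕ → Table → Packed → ℕ → Rows
winnowIf : ℕ → ℕ → Table → Packed → ℕ → Rows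
winnow qs vacant N = end
winnow qs (alone s t) N = keep (fits qs s N) t
winnow [] (split _ _ _ _) N = end
winnow (quad a b c d ∷ qs) (split w x y z) N = branch (winnowBy a qs w N) (winnowBy b qs x N) (winnowBy c qs y N) (winnowBy d qs z N)
winnowBy a qs vacant N = end
winnowBy zero qs t N = winnow qs t N
winnowBy (suc a) qs t N = winnowIf (mod-helper 0 a N a) a qs t N
winnowIf zero a qs t N = winnow qs t (div-helper 0 a N a)
winnowIf (suc _) a qs t N = end

meet : Rows → Rows → Rows
meet (leaf _) (leaf _) = leaf tt
meet (node w x y z) (node w′ x′ y′ z′) = branch (meet w w′) (meet x x′) (meet y y′) (meet z z′)
meet _ _ = end

Graph : Set
Graph = Trie Rows

graph : (Row → Rows) → (Row → Row) → Rows → Graph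
graph f k end = end
graph f k (leaf _) = leaf (f (k []))
graph f k (node w x y z) = node (graph f (k ∘ (e₀ ∷_)) w) (graph f (k ∘ (e₁ ∷_)) x) (graph f (k ∘ (e₂ ∷_)) y) (graph f (k ∘ (e₃ ∷_)) z)

neighbours : Row → Graph → Rows
neighbours [] (leaf t) = t
neighbours (e₀ ∷ p) (node w x y z) = neighbours p w
neighbours (e₁ ∷ p) (node w x y z) = neighbours p x
neighbours (e₂ ∷ p) (node w x y z) = neighbours p y
neighbours (e₃ ∷ p) (node w x y z) = neighbours p z
neighbours _ _ = end

-- The sums of two rows, and of three rows including `r`, have been tested by `kill₁` and `later`.
-- What remains is the sum of `b`, `c`, `d`, the sum of all four rows, and the extensions.
dead : Ctx → Row → Row → Row → Row → Bool
dead C r b c d = not (fits (offset (b ⊞ c) (t₀ C)) d (a₅ C)) ∨ not (fits (offset (r ⊞ (b ⊞ c)) (t₀ C)) d (a₆ C)) ∨ noExts C r b c d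

every : (Row → Bool) → List Row → Bool
every f [] = true
every f (r ∷ rs) = f r ∧ every f rs

scan₃ : Ctx → Row → Row → Row → Rows → Bool
scan₃ C r b c t = every (dead C r b c) (rows t)

scan₂ : Ctx → Graph → Row → Row → Rows → Bool
scan₂ C G r b t = every (λ c → scan₃ C r b c (meet t (neighbours c G))) (rows t)

scan₁ : Ctx → Graph → Row → Rows → Bool
scan₁ C G r t = every (λ b → scan₂ C G r b (neighbours b G)) (rows t)

later : Ctx → Row → Packed → Row → Rows
later C r t b = winnow (offset b (t₀ C) *ᵗ offset (r ⊞ b) (t₁ C)) (beyond b t) (a₄₅ C)

kill₁ kill₂ : Ctx → Row → Rows → Bool
kill₃ : Ctx → Row → Rows → Packed → Bool
kill₁ C r t = kill₂ C r (sieve (offset r (t₀ C)) t (a₄ C))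
kill₂ C r t = kill₃ C r t (pack t)
kill₃ C r t u = scan₁ C (graph (later C r u) (λ p → p) t) r t

orbitU : Ctx → Row → List Row
orbitU C r = concatMap (λ p → map (p ⊞_) (U C)) (orbit (syms C) (r ∷ []))

run : Ctx → List Row → Rows → Bool
run C rs t = loop (kill₁ C) (orbitU C) rs t

searchFrom : Ctx → List Row → List Pivot → Bool
search : Ctx → List Row → Bool
search C rs = searchFrom C rs (eliminate 3 (basis C))
searchFrom C rs ps = triangular ps ∧ run C rs (grow (restrict ps (suc (a₃ C)) (t₀ C)) (a₃ C))

chunks : List ℕ → ℕ → List (List ℕ)
chunks (p₁ ∷ p₂ ∷ p₃ ∷ p₄ ∷ p₅ ∷ p₆ ∷ p₇ ∷ p₈ ∷ ps) (suc n) = (p₁ ∷ p₂ ∷ p₃ ∷ p₄ ∷ p₅ ∷ p₆ ∷ p₇ ∷ p₈ ∷ []) ∷ chunks ps n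
chunks _ _ = []

bounds : List ℕ → List (List ℕ) → ℕ
bounds (k ∷ ks) (ps ∷ pss) = bound k ps * bounds ks pss
bounds _ _ = 1

-- In the order of `sums` over `c`, `d`, `a`, `b`. The base value is 2 + 2, since an extension may
-- miss the lines of `a` and `b` whether or not these rows are added; each of `c` and `d` adds one.
caps : List ℕ
caps = 4 ∷ 4 ∷ 4 ∷ 4 ∷ 5 ∷ 5 ∷ 5 ∷ 5 ∷ 5 ∷ 5 ∷ 5 ∷ 5 ∷ 6 ∷ 6 ∷ 6 ∷ 6 ∷ []

context : List (List ℕ) → Row → Row → Row → List (List (Sym × Sym)) → Ctx
context pss@(ps₀ ∷ ps₁ ∷ _) u v w sy = ctx
  (u ∷ v ∷ w ∷ []) us (map (λ ps → table ps us) pss) (table ps₀ us) (table ps₁ us)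
  (bound 2 ps₀) (bound 3 ps₀) (bound 4 ps₀) (bound 5 ps₀) (bound 6 ps₀) (bound 4 ps₀ * bound 5 ps₁) (bounds caps pss)
  sy
  where us = sums (zeroRow u) (u ∷ v ∷ w ∷ [])
context _ u v w sy = ctx [] [] [] [] [] 0 0 0 0 0 0 0 []

decode : ℕ → ℕ → Row
decode zero c = []
decode (suc n) c = undigit (c % 4) ∷ decode n (c / 4)
  where
  undigit : ℕ → F
  undigit 0 = e₀
  undigit 1 = e₁
  undigit 2 = e₂
  undigit _ = e₃

decodes : List ℕ → List Row
decodes = map (decode 11)

-- Soundness of the data structures

∧-splitˡ : ∀ {x y} → x ∧ y ≡ true → x ≡ true
∧-splitˡ {true} _ = refl

∧-splitʳ : ∀ {x y} → x ∧ y ≡ true → y ≡ true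
∧-splitʳ {true} e = e

allF : (F → Bool) → Bool
allF p = p e₀ ∧ p e₁ ∧ p e₂ ∧ p e₃

allF-sound : ∀ p → allF p ≡ true → ∀ x → p x ≡ true
allF-sound p h e₀ = ∧-splitˡ h
allF-sound p h e₁ = ∧-splitˡ (∧-splitʳ {p e₀} h)
allF-sound p h e₂ = ∧-splitˡ (∧-splitʳ {p e₁} (∧-splitʳ {p e₀} h))
allF-sound p h e₃ = ∧-splitʳ {p e₂} (∧-splitʳ {p e₁} (∧-splitʳ {p e₀} h))

==-sound : ∀ x y → x == y ≡ true → x ≡ y
==-sound e₀ e₀ _ = refl
==-sound e₁ e₁ _ = refl
==-sound e₂ e₂ _ = refl
==-sound e₃ e₃ _ = refl

allF₃ : (p q : F → F → F → F) →
        allF (λ x → allF λ y → allF λ z → p x y z == q x y z) ≡ true →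
        ∀ x y z → p x y z ≡ q x y z
allF₃ p q h x y z = ==-sound _ _
  (allF-sound (λ z → p x y z == q x y z)
    (allF-sound (λ y → allF λ z → p x y z == q x y z)
      (allF-sound (λ x → allF λ y → allF λ z → p x y z == q x y z) h x) y) z)

⊹-assoc : ∀ x y z → (x ⊹ y) ⊹ z ≡ x ⊹ (y ⊹ z)
⊹-assoc = allF₃ (λ x y z → (x ⊹ y) ⊹ z) (λ x y z → x ⊹ (y ⊹ z)) refl

⊹-comm : ∀ x y → x ⊹ y ≡ y ⊹ x
⊹-comm x y = allF₃ (λ x y _ → x ⊹ y) (λ x y _ → y ⊹ x) refl x y e₀

⊹-identityʳ : ∀ x → x ⊹ e₀ ≡ x
⊹-identityʳ x = ⊹-comm x e₀

⊹-self : ∀ x → x ⊹ x ≡ e₀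
⊹-self x = allF₃ (λ x _ _ → x ⊹ x) (λ _ _ _ → e₀) refl x e₀ e₀

⊞-assoc : ∀ a b c → (a ⊞ b) ⊞ c ≡ a ⊞ (b ⊞ c)
⊞-assoc [] b c = refl
⊞-assoc (x ∷ a) [] c = refl
⊞-assoc (x ∷ a) (y ∷ b) [] = refl
⊞-assoc (x ∷ a) (y ∷ b) (z ∷ c) = cong₂ _∷_ (⊹-assoc x y z) (⊞-assoc a b c)

⊞-comm : ∀ a b → a ⊞ b ≡ b ⊞ a
⊞-comm [] [] = refl
⊞-comm [] (x ∷ b) = refl
⊞-comm (x ∷ a) [] = refl
⊞-comm (x ∷ a) (y ∷ b) = cong₂ _∷_ (⊹-comm x y) (⊞-comm a b)

⊞-swap : ∀ a b c → a ⊞ (b ⊞ c) ≡ b ⊞ (a ⊞ c)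
⊞-swap a b c = trans (sym (⊞-assoc a b c)) (trans (cong (_⊞ c) (⊞-comm a b)) (⊞-assoc b a c))

length-⊞ : ∀ {n} a b → length a ≡ n → length b ≡ n → length (a ⊞ b) ≡ n
length-⊞ [] [] refl q = refl
length-⊞ (x ∷ a) (y ∷ b) refl q = cong suc (length-⊞ a b refl (suc-injective q))

⊞-cancel : ∀ a b → length a ≡ length b → a ⊞ (a ⊞ b) ≡ b
⊞-cancel [] [] _ = refl
⊞-cancel (x ∷ a) (y ∷ b) h = cong₂ _∷_
  (trans (sym (⊹-assoc x x y)) (cong (_⊹ y) (⊹-self x))) (⊞-cancel a b (suc-injective h))

zeroRow-⊞ : ∀ a b → length a ≡ length b → zeroRow a ⊞ b ≡ b
zeroRow-⊞ [] [] _ = refl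
zeroRow-⊞ (x ∷ a) (y ∷ b) h = cong (y ∷_) (zeroRow-⊞ a b (suc-injective h))

⊞-self : ∀ a → a ⊞ a ≡ zeroRow a
⊞-self [] = refl
⊞-self (x ∷ a) = cong₂ _∷_ (⊹-self x) (⊞-self a)

zeroRow-cong : ∀ a b → length a ≡ length b → zeroRow a ≡ zeroRow b
zeroRow-cong [] [] _ = refl
zeroRow-cong (x ∷ a) (y ∷ b) h = cong (e₀ ∷_) (zeroRow-cong a b (suc-injective h))

==ʳ-sound : ∀ a b → (a ==ʳ b) ≡ true → a ≡ b
==ʳ-sound [] [] _ = refl
==ʳ-sound (x ∷ a) (y ∷ b) h = cong₂ _∷_ (==-sound x y (∧-splitˡ h)) (==ʳ-sound a b (∧-splitʳ {x == y} h))

vanish : F → ℕ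
vanish e₀ = 1
vanish _ = 0

zeros : Row → ℕ
zeros [] = 0
zeros (x ∷ a) = vanish x + zeros a

-- Membership in tries

infix 4 _∈_
-- The soundness lemmas run in one direction: an operation may keep too many rows, which costs time,
-- but may not lose a row that passes its test.
_∈_ : Row → Rows → Set
[] ∈ leaf _ = ⊤
(e₀ ∷ p) ∈ node w x y z = p ∈ w
(e₁ ∷ p) ∈ node w x y z = p ∈ x
(e₂ ∷ p) ∈ node w x y z = p ∈ y
(e₃ ∷ p) ∈ node w x y z = p ∈ z
_ ∈ _ = ⊥

∉end : ∀ p → ¬ p ∈ end
∉end [] ()
∉end (e₀ ∷ p) ()
∉end (e₁ ∷ p) ()
∉end (e₂ ∷ p) ()
∉end (e₃ ∷ p) ()

isEnd-sound : ∀ t → isEnd t ≡ true → ∀ p → ¬ p ∈ t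
isEnd-sound end _ = ∉end

∈-branch : ∀ w x y z p → p ∈ node w x y z → p ∈ branch w x y z
∈-branch (leaf _) x y z p h = h
∈-branch (node _ _ _ _) x y z p h = h
∈-branch end (leaf _) y z p h = h
∈-branch end (node _ _ _ _) y z p h = h
∈-branch end end (leaf _) z p h = h
∈-branch end end (node _ _ _ _) z p h = h
∈-branch end end end (leaf _) p h = h
∈-branch end end end (node _ _ _ _) p h = h
∈-branch end end end end (e₀ ∷ p) h = ⊥-elim (∉end p h)
∈-branch end end end end (e₁ ∷ p) h = ⊥-elim (∉end p h)
∈-branch end end end end (e₂ ∷ p) h = ⊥-elim (∉end p h)
∈-branch end end end end (e₃ ∷ p) h = ⊥-elim (∉end p h)

-- Factors 0 are passed over without a division, which is safe: `0 * m ∣ N` forces `N` to be 0, and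
-- everything divides 0.
zero-divisor : ∀ m N → 0 * m ∣ N → m ∣ N
zero-divisor m N h = subst (m ∣_) (sym (0∣⇒≡0 h)) (m ∣0)

divides-step : ∀ a m N → suc a * m ∣ N → N % suc a ≡ 0 × m ∣ N / suc a
divides-step a m N h = n∣m⇒m%n≡0 N (suc a) (m*n∣⇒m∣ (suc a) m h) , m*n∣o⇒n∣o/m (suc a) m h

sieve-sound : ∀ qs t N p → length p ≡ length qs → p ∈ t → weight qs p ∣ N → p ∈ sieve qs t N
sieveChild-sound : ∀ t a qs N p → length p ≡ length qs → p ∈ t → a * weight qs p ∣ N → p ∈ sieveChild t a qs N
sieveBy-sound : ∀ a qs t N p → length p ≡ length qs → p ∈ t → a * weight qs p ∣ N → p ∈ sieveBy a qs t N
sieve-sound [] t N p l h d = h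
sieve-sound (quad a b c e ∷ qs) (node w x y z) N (e₀ ∷ p) l h d =
  ∈-branch (sieveChild w a qs N) (sieveChild x b qs N) (sieveChild y c qs N) (sieveChild z e qs N) (e₀ ∷ p) (sieveChild-sound w a qs N p (suc-injective l) h d)
sieve-sound (quad a b c e ∷ qs) (node w x y z) N (e₁ ∷ p) l h d =
  ∈-branch (sieveChild w a qs N) (sieveChild x b qs N) (sieveChild y c qs N) (sieveChild z e qs N) (e₁ ∷ p) (sieveChild-sound x b qs N p (suc-injective l) h d)
sieve-sound (quad a b c e ∷ qs) (node w x y z) N (e₂ ∷ p) l h d =
  ∈-branch (sieveChild w a qs N) (sieveChild x b qs N) (sieveChild y c qs N) (sieveChild z e qs N) (e₂ ∷ p) (sieveChild-sound y c qs N p (suc-injective l) h d)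
sieve-sound (quad a b c e ∷ qs) (node w x y z) N (e₃ ∷ p) l h d =
  ∈-branch (sieveChild w a qs N) (sieveChild x b qs N) (sieveChild y c qs N) (sieveChild z e qs N) (e₃ ∷ p) (sieveChild-sound z e qs N p (suc-injective l) h d)
sieveChild-sound end a qs N p l h d = ⊥-elim (∉end p h)
sieveChild-sound (leaf x) a qs N p l h d = sieveBy-sound a qs (leaf x) N p l h d
sieveChild-sound (node w x y z) a qs N p l h d = sieveBy-sound a qs (node w x y z) N p l h d
sieveBy-sound zero qs t N p l h d = sieve-sound qs t N p l h (zero-divisor _ N d)
sieveBy-sound (suc a) qs t N p l h d with divides-step a _ N d
... | r , d′ = subst (λ r → p ∈ sieveIf r a qs t N) (sym r) (sieve-sound qs t _ p l h d′)

grow-sound : ∀ qs N p → length p ≡ length qs → weight qs p ∣ N → p ∈ grow qs N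
growBy-sound : ∀ a qs N p → length p ≡ length qs → a * weight qs p ∣ N → p ∈ growBy a qs N
grow-sound [] N [] l d = tt
grow-sound (quad a b c e ∷ qs) N (e₀ ∷ p) l d = ∈-branch (growBy a qs N) (growBy b qs N) (growBy c qs N) (growBy e qs N) (e₀ ∷ p) (growBy-sound a qs N p (suc-injective l) d)
grow-sound (quad a b c e ∷ qs) N (e₁ ∷ p) l d = ∈-branch (growBy a qs N) (growBy b qs N) (growBy c qs N) (growBy e qs N) (e₁ ∷ p) (growBy-sound b qs N p (suc-injective l) d)
grow-sound (quad a b c e ∷ qs) N (e₂ ∷ p) l d = ∈-branch (growBy a qs N) (growBy b qs N) (growBy c qs N) (growBy e qs N) (e₂ ∷ p) (growBy-sound c qs N p (suc-injective l) d)
grow-sound (quad a b c e ∷ qs) N (e₃ ∷ p) l d = ∈-branch (growBy a qs N) (growBy b qs N) (growBy c qs N) (growBy e qs N) (e₃ ∷ p) (growBy-sound e qs N p (suc-injective l) d)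
growBy-sound zero qs N p l d = grow-sound qs N p l (zero-divisor _ N d)
growBy-sound (suc a) qs N p l d with divides-step a _ N d
... | r , d′ = subst (λ r → p ∈ growIf r a qs N) (sym r) (grow-sound qs _ p l d′)

barren-sound : ∀ qs N → barren qs N ≡ true → ∀ p → length p ≡ length qs → ¬ weight qs p ∣ N
barrenBy-sound : ∀ a qs N → barrenBy a qs N ≡ true → ∀ p → length p ≡ length qs → ¬ a * weight qs p ∣ N
barren-sound (quad a b c e ∷ qs) N h (e₀ ∷ p) l d = barrenBy-sound a qs N (∧-splitˡ h) p (suc-injective l) d
barren-sound (quad a b c e ∷ qs) N h (e₁ ∷ p) l d =
  barrenBy-sound b qs N (∧-splitˡ (∧-splitʳ {barrenBy a qs N} h)) p (suc-injective l) d
barren-sound (quad a b c e ∷ qs) N h (e₂ ∷ p) l d =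
  barrenBy-sound c qs N (∧-splitˡ (∧-splitʳ {barrenBy b qs N} (∧-splitʳ {barrenBy a qs N} h))) p (suc-injective l) d
barren-sound (quad a b c e ∷ qs) N h (e₃ ∷ p) l d =
  barrenBy-sound e qs N (∧-splitʳ {barrenBy c qs N} (∧-splitʳ {barrenBy b qs N} (∧-splitʳ {barrenBy a qs N} h))) p (suc-injective l) d
barrenBy-sound zero qs N h p l d = barren-sound qs N h p l (zero-divisor _ N d)
barrenBy-sound (suc a) qs N h p l d with divides-step a _ N d
... | r , d′ = barren-sound qs _ (subst (λ r → barrenIf r a qs N ≡ true) r h) p l d′

leaves-rest : ∀ t k r {q} → q ∈ᴸ r → q ∈ᴸ leaves t k r
leaves-rest end k r h = h
leaves-rest (leaf x) k r h = there h
leaves-rest (node w x y z) k r h =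
  leaves-rest w _ _ (leaves-rest x _ _ (leaves-rest y _ _ (leaves-rest z _ _ h)))

leaves-sound : ∀ t k r p → p ∈ t → k p ∈ᴸ leaves t k r
leaves-sound (leaf x) k r [] h = here refl
leaves-sound (node w x y z) k r (e₀ ∷ p) h = leaves-sound w _ _ p h
leaves-sound (node w x y z) k r (e₁ ∷ p) h = leaves-rest w _ _ (leaves-sound x _ _ p h)
leaves-sound (node w x y z) k r (e₂ ∷ p) h = leaves-rest w _ _ (leaves-rest x _ _ (leaves-sound y _ _ p h))
leaves-sound (node w x y z) k r (e₃ ∷ p) h =
  leaves-rest w _ _ (leaves-rest x _ _ (leaves-rest y _ _ (leaves-sound z _ _ p h)))

rows-sound : ∀ t p → p ∈ t → p ∈ᴸ rows t
rows-sound t p h = leaves-sound t (λ z → z) [] p h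

delete-sound : ∀ p t q → q ∈ t → q ≢ p → q ∈ delete p t
delete-sound [] end q h ne = h
delete-sound [] (leaf x) [] h ne = ⊥-elim (ne refl)
delete-sound [] (leaf x) (e₀ ∷ q) ()
delete-sound [] (leaf x) (e₁ ∷ q) ()
delete-sound [] (leaf x) (e₂ ∷ q) ()
delete-sound [] (leaf x) (e₃ ∷ q) ()
delete-sound [] (node w x y z) q h ne = h
delete-sound (e₀ ∷ p) end q h ne = h
delete-sound (e₁ ∷ p) end q h ne = h
delete-sound (e₂ ∷ p) end q h ne = h
delete-sound (e₃ ∷ p) end q h ne = h
delete-sound (e₀ ∷ p) (leaf x) q h ne = h
delete-sound (e₁ ∷ p) (leaf x) q h ne = h
delete-sound (e₂ ∷ p) (leaf x) q h ne = h
delete-sound (e₃ ∷ p) (leaf x) q h ne = h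
delete-sound (e₀ ∷ p) (node w x y z) (e₀ ∷ q) h ne = ∈-branch (delete p w) x y z (e₀ ∷ q) (delete-sound p w q h (ne ∘ cong (e₀ ∷_)))
delete-sound (e₀ ∷ p) (node w x y z) (e₁ ∷ q) h ne = ∈-branch (delete p w) x y z (e₁ ∷ q) h
delete-sound (e₀ ∷ p) (node w x y z) (e₂ ∷ q) h ne = ∈-branch (delete p w) x y z (e₂ ∷ q) h
delete-sound (e₀ ∷ p) (node w x y z) (e₃ ∷ q) h ne = ∈-branch (delete p w) x y z (e₃ ∷ q) h
delete-sound (e₁ ∷ p) (node w x y z) (e₀ ∷ q) h ne = ∈-branch w (delete p x) y z (e₀ ∷ q) h
delete-sound (e₁ ∷ p) (node w x y z) (e₁ ∷ q) h ne = ∈-branch w (delete p x) y z (e₁ ∷ q) (delete-sound p x q h (ne ∘ cong (e₁ ∷_)))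
delete-sound (e₁ ∷ p) (node w x y z) (e₂ ∷ q) h ne = ∈-branch w (delete p x) y z (e₂ ∷ q) h
delete-sound (e₁ ∷ p) (node w x y z) (e₃ ∷ q) h ne = ∈-branch w (delete p x) y z (e₃ ∷ q) h
delete-sound (e₂ ∷ p) (node w x y z) (e₀ ∷ q) h ne = ∈-branch w x (delete p y) z (e₀ ∷ q) h
delete-sound (e₂ ∷ p) (node w x y z) (e₁ ∷ q) h ne = ∈-branch w x (delete p y) z (e₁ ∷ q) h
delete-sound (e₂ ∷ p) (node w x y z) (e₂ ∷ q) h ne = ∈-branch w x (delete p y) z (e₂ ∷ q) (delete-sound p y q h (ne ∘ cong (e₂ ∷_)))
delete-sound (e₂ ∷ p) (node w x y z) (e₃ ∷ q) h ne = ∈-branch w x (delete p y) z (e₃ ∷ q) h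
delete-sound (e₃ ∷ p) (node w x y z) (e₀ ∷ q) h ne = ∈-branch w x y (delete p z) (e₀ ∷ q) h
delete-sound (e₃ ∷ p) (node w x y z) (e₁ ∷ q) h ne = ∈-branch w x y (delete p z) (e₁ ∷ q) h
delete-sound (e₃ ∷ p) (node w x y z) (e₂ ∷ q) h ne = ∈-branch w x y (delete p z) (e₂ ∷ q) h
delete-sound (e₃ ∷ p) (node w x y z) (e₃ ∷ q) h ne = ∈-branch w x y (delete p z) (e₃ ∷ q) (delete-sound p z q h (ne ∘ cong (e₃ ∷_)))

deletes-sound : ∀ ps t q → q ∈ t → (∀ p → p ∈ᴸ ps → q ≢ p) → q ∈ deletes ps t
deletes-sound [] t q h ne = h
deletes-sound (p ∷ ps) t q h ne =
  deletes-sound ps (delete p t) q (delete-sound p t q h (ne p (here refl))) (λ r i → ne r (there i))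

data _<ᶠ_ : F → F → Set where
  0<1 : e₀ <ᶠ e₁
  0<2 : e₀ <ᶠ e₂
  0<3 : e₀ <ᶠ e₃
  1<2 : e₁ <ᶠ e₂
  1<3 : e₁ <ᶠ e₃
  2<3 : e₂ <ᶠ e₃

<ᶠ-trans : ∀ {x y z} → x <ᶠ y → y <ᶠ z → x <ᶠ z
<ᶠ-trans 0<1 1<2 = 0<2
<ᶠ-trans 0<1 1<3 = 0<3
<ᶠ-trans 0<2 2<3 = 0<3
<ᶠ-trans 1<2 2<3 = 1<3

<ᶠ-compare : ∀ x y → x <ᶠ y ⊎ x ≡ y ⊎ y <ᶠ x
<ᶠ-compare e₀ e₀ = inj₂ (inj₁ refl)
<ᶠ-compare e₀ e₁ = inj₁ 0<1
<ᶠ-compare e₀ e₂ = inj₁ 0<2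
<ᶠ-compare e₀ e₃ = inj₁ 0<3
<ᶠ-compare e₁ e₀ = inj₂ (inj₂ 0<1)
<ᶠ-compare e₁ e₁ = inj₂ (inj₁ refl)
<ᶠ-compare e₁ e₂ = inj₁ 1<2
<ᶠ-compare e₁ e₃ = inj₁ 1<3
<ᶠ-compare e₂ e₀ = inj₂ (inj₂ 0<2)
<ᶠ-compare e₂ e₁ = inj₂ (inj₂ 1<2)
<ᶠ-compare e₂ e₂ = inj₂ (inj₁ refl)
<ᶠ-compare e₂ e₃ = inj₁ 2<3
<ᶠ-compare e₃ e₀ = inj₂ (inj₂ 0<3)
<ᶠ-compare e₃ e₁ = inj₂ (inj₂ 1<3)
<ᶠ-compare e₃ e₂ = inj₂ (inj₂ 2<3)
<ᶠ-compare e₃ e₃ = inj₂ (inj₁ refl)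

data _≺_ : Row → Row → Set where
  head : ∀ {x y p q} → x <ᶠ y → (x ∷ p) ≺ (y ∷ q)
  tail : ∀ {x p q} → p ≺ q → (x ∷ p) ≺ (x ∷ q)

≺-trans : ∀ {p q r} → p ≺ q → q ≺ r → p ≺ r
≺-trans (head h) (head k) = head (<ᶠ-trans h k)
≺-trans (head h) (tail k) = head h
≺-trans (tail h) (head k) = head k
≺-trans (tail h) (tail k) = tail (≺-trans h k)

≺-compare : ∀ p q → length p ≡ length q → p ≺ q ⊎ p ≡ q ⊎ q ≺ p
≺-compare [] [] _ = inj₂ (inj₁ refl)
≺-compare (x ∷ p) (y ∷ q) l with <ᶠ-compare x y
... | inj₁ h = inj₁ (head h)
... | inj₂ (inj₂ h) = inj₂ (inj₂ (head h))
... | inj₂ (inj₁ refl) with ≺-compare p q (suc-injective l)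
... | inj₁ h = inj₁ (tail h)
... | inj₂ (inj₁ refl) = inj₂ (inj₁ refl)
... | inj₂ (inj₂ h) = inj₂ (inj₂ (tail h))

∈-map-∷ : ∀ {e s ss} (rs : List Row) → map (e ∷_) rs ≡ s ∷ ss → ∃[ s′ ] ∃[ ss′ ] rs ≡ s′ ∷ ss′ × e ∷ s′ ≡ s
∈-map-∷ (r ∷ rs) refl = r , rs , refl , refl

lone-sound : ∀ t {s ss} → lone t ≡ s ∷ ss → ∀ q → q ∈ t → q ≡ s
lone-sound (leaf _) refl [] h = refl
lone-sound (leaf _) l (e₀ ∷ q) ()
lone-sound (leaf _) l (e₁ ∷ q) ()
lone-sound (leaf _) l (e₂ ∷ q) ()
lone-sound (leaf _) l (e₃ ∷ q) ()
lone-sound (node w x y z) l q h with isEnd x ∧ isEnd y ∧ isEnd z in e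
lone-sound (node w x y z) l (e₁ ∷ q) h | true = ⊥-elim (isEnd-sound x (∧-splitˡ e) q h)
lone-sound (node w x y z) l (e₂ ∷ q) h | true = ⊥-elim (isEnd-sound y (∧-splitˡ (∧-splitʳ {isEnd x} e)) q h)
lone-sound (node w x y z) l (e₃ ∷ q) h | true = ⊥-elim (isEnd-sound z (∧-splitʳ {isEnd y} (∧-splitʳ {isEnd x} e)) q h)
lone-sound (node w x y z) l (e₀ ∷ q) h | true with ∈-map-∷ (lone w) l
... | _ , _ , l′ , refl = cong (e₀ ∷_) (lone-sound w l′ q h)
lone-sound (node w x y z) l q h | false with isEnd w ∧ isEnd y ∧ isEnd z in e
lone-sound (node w x y z) l (e₀ ∷ q) h | false | true = ⊥-elim (isEnd-sound w (∧-splitˡ e) q h)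
lone-sound (node w x y z) l (e₂ ∷ q) h | false | true = ⊥-elim (isEnd-sound y (∧-splitˡ (∧-splitʳ {isEnd w} e)) q h)
lone-sound (node w x y z) l (e₃ ∷ q) h | false | true = ⊥-elim (isEnd-sound z (∧-splitʳ {isEnd y} (∧-splitʳ {isEnd w} e)) q h)
lone-sound (node w x y z) l (e₁ ∷ q) h | false | true with ∈-map-∷ (lone x) l
... | _ , _ , l′ , refl = cong (e₁ ∷_) (lone-sound x l′ q h)
lone-sound (node w x y z) l q h | false | false with isEnd w ∧ isEnd x ∧ isEnd z in e
lone-sound (node w x y z) l (e₀ ∷ q) h | false | false | true = ⊥-elim (isEnd-sound w (∧-splitˡ e) q h)
lone-sound (node w x y z) l (e₁ ∷ q) h | false | false | true = ⊥-elim (isEnd-sound x (∧-splitˡ (∧-splitʳ {isEnd w} e)) q h)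
lone-sound (node w x y z) l (e₃ ∷ q) h | false | false | true = ⊥-elim (isEnd-sound z (∧-splitʳ {isEnd x} (∧-splitʳ {isEnd w} e)) q h)
lone-sound (node w x y z) l (e₂ ∷ q) h | false | false | true with ∈-map-∷ (lone y) l
... | _ , _ , l′ , refl = cong (e₂ ∷_) (lone-sound y l′ q h)
lone-sound (node w x y z) l q h | false | false | false with isEnd w ∧ isEnd x ∧ isEnd y in e
lone-sound (node w x y z) l (e₀ ∷ q) h | false | false | false | true = ⊥-elim (isEnd-sound w (∧-splitˡ e) q h)
lone-sound (node w x y z) l (e₁ ∷ q) h | false | false | false | true = ⊥-elim (isEnd-sound x (∧-splitˡ (∧-splitʳ {isEnd w} e)) q h)
lone-sound (node w x y z) l (e₂ ∷ q) h | false | false | false | true = ⊥-elim (isEnd-sound y (∧-splitʳ {isEnd x} (∧-splitʳ {isEnd w} e)) q h)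
lone-sound (node w x y z) l (e₃ ∷ q) h | false | false | false | true with ∈-map-∷ (lone z) l
... | _ , _ , l′ , refl = cong (e₃ ∷_) (lone-sound z l′ q h)

_∈ᵖ_ : Row → Packed → Set
q ∈ᵖ vacant = ⊥
q ∈ᵖ alone s t = q ≡ s × q ∈ t
[] ∈ᵖ split w x y z = ⊥
(e₀ ∷ q) ∈ᵖ split w x y z = q ∈ᵖ w
(e₁ ∷ q) ∈ᵖ split w x y z = q ∈ᵖ x
(e₂ ∷ q) ∈ᵖ split w x y z = q ∈ᵖ y
(e₃ ∷ q) ∈ᵖ split w x y z = q ∈ᵖ z

pack-sound : ∀ t q → q ∈ t → q ∈ᵖ pack t
packAs-sound : ∀ l t → lone t ≡ l → ∀ q → q ∈ t → q ∈ᵖ packAs l t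
pack-sound t = packAs-sound (lone t) t refl
packAs-sound (s ∷ ss) t e q h = lone-sound t e q h , h
packAs-sound [] end e q h = ∉end q h
packAs-sound [] (node w x y z) e (e₀ ∷ q) h = pack-sound w q h
packAs-sound [] (node w x y z) e (e₁ ∷ q) h = pack-sound x q h
packAs-sound [] (node w x y z) e (e₂ ∷ q) h = pack-sound y q h
packAs-sound [] (node w x y z) e (e₃ ∷ q) h = pack-sound z q h

beyond-sound : ∀ p t q → q ∈ᵖ t → p ≺ q → q ∈ᵖ beyond p t
beyond-sound p (alone s t) q h l = h
beyond-sound (e₀ ∷ p) (split w x y z) (_ ∷ q) h (head 0<1) = h
beyond-sound (e₀ ∷ p) (split w x y z) (_ ∷ q) h (head 0<2) = h
beyond-sound (e₀ ∷ p) (split w x y z) (_ ∷ q) h (head 0<3) = h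
beyond-sound (e₁ ∷ p) (split w x y z) (_ ∷ q) h (head 1<2) = h
beyond-sound (e₁ ∷ p) (split w x y z) (_ ∷ q) h (head 1<3) = h
beyond-sound (e₂ ∷ p) (split w x y z) (_ ∷ q) h (head 2<3) = h
beyond-sound (e₀ ∷ p) (split w x y z) (_ ∷ q) h (tail l) = beyond-sound p w q h l
beyond-sound (e₁ ∷ p) (split w x y z) (_ ∷ q) h (tail l) = beyond-sound p x q h l
beyond-sound (e₂ ∷ p) (split w x y z) (_ ∷ q) h (tail l) = beyond-sound p y q h l
beyond-sound (e₃ ∷ p) (split w x y z) (_ ∷ q) h (tail l) = beyond-sound p z q h l

fits-sound : ∀ t a N → weight t a ∣ N → fits t a N ≡ true
fits-sound t a N h with weight t a
... | zero = refl
... | suc w rewrite n∣m⇒m%n≡0 N (suc w) h = refl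

winnow-sound : ∀ qs t N p → length p ≡ length qs → p ∈ᵖ t → weight qs p ∣ N → p ∈ winnow qs t N
winnowBy-sound : ∀ a qs t N p → length p ≡ length qs → p ∈ᵖ t → a * weight qs p ∣ N → p ∈ winnowBy a qs t N
winnowSuc-sound : ∀ a qs t N p → length p ≡ length qs → p ∈ᵖ t → suc a * weight qs p ∣ N → p ∈ winnowIf (mod-helper 0 a N a) a qs t N
winnow-sound qs (alone s t) N p l (refl , h) d rewrite fits-sound qs p N d = h
winnow-sound (quad a b c e ∷ qs) (split w x y z) N (e₀ ∷ p) l h d =
  ∈-branch (winnowBy a qs w N) (winnowBy b qs x N) (winnowBy c qs y N) (winnowBy e qs z N) (e₀ ∷ p) (winnowBy-sound a qs w N p (suc-injective l) h d)
winnow-sound (quad a b c e ∷ qs) (split w x y z) N (e₁ ∷ p) l h d =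
  ∈-branch (winnowBy a qs w N) (winnowBy b qs x N) (winnowBy c qs y N) (winnowBy e qs z N) (e₁ ∷ p) (winnowBy-sound b qs x N p (suc-injective l) h d)
winnow-sound (quad a b c e ∷ qs) (split w x y z) N (e₂ ∷ p) l h d =
  ∈-branch (winnowBy a qs w N) (winnowBy b qs x N) (winnowBy c qs y N) (winnowBy e qs z N) (e₂ ∷ p) (winnowBy-sound c qs y N p (suc-injective l) h d)
winnow-sound (quad a b c e ∷ qs) (split w x y z) N (e₃ ∷ p) l h d =
  ∈-branch (winnowBy a qs w N) (winnowBy b qs x N) (winnowBy c qs y N) (winnowBy e qs z N) (e₃ ∷ p) (winnowBy-sound e qs z N p (suc-injective l) h d)
winnowBy-sound zero qs t@(alone _ _) N p l h d = winnow-sound qs t N p l h (zero-divisor _ N d)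
winnowBy-sound zero qs t@(split _ _ _ _) N p l h d = winnow-sound qs t N p l h (zero-divisor _ N d)
winnowBy-sound (suc a) qs t@(alone _ _) N p l h d = winnowSuc-sound a qs t N p l h d
winnowBy-sound (suc a) qs t@(split _ _ _ _) N p l h d = winnowSuc-sound a qs t N p l h d
winnowSuc-sound a qs t N p l h d with divides-step a _ N d
... | r , d′ = subst (λ r → p ∈ winnowIf r a qs t N) (sym r) (winnow-sound qs t _ p l h d′)

meet-sound : ∀ s t p → p ∈ s → p ∈ t → p ∈ meet s t
meet-sound (leaf _) (leaf _) [] h k = tt
meet-sound (node w x y z) (node w′ x′ y′ z′) (e₀ ∷ p) h k =
  ∈-branch (meet w w′) (meet x x′) (meet y y′) (meet z z′) (e₀ ∷ p) (meet-sound w w′ p h k)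
meet-sound (node w x y z) (node w′ x′ y′ z′) (e₁ ∷ p) h k =
  ∈-branch (meet w w′) (meet x x′) (meet y y′) (meet z z′) (e₁ ∷ p) (meet-sound x x′ p h k)
meet-sound (node w x y z) (node w′ x′ y′ z′) (e₂ ∷ p) h k =
  ∈-branch (meet w w′) (meet x x′) (meet y y′) (meet z z′) (e₂ ∷ p) (meet-sound y y′ p h k)
meet-sound (node w x y z) (node w′ x′ y′ z′) (e₃ ∷ p) h k =
  ∈-branch (meet w w′) (meet x x′) (meet y y′) (meet z z′) (e₃ ∷ p) (meet-sound z z′ p h k)

neighbours-graph : ∀ f k t p → p ∈ t → neighbours p (graph f k t) ≡ f (k p)
neighbours-graph f k (leaf x) [] h = refl
neighbours-graph f k (node w x y z) (e₀ ∷ p) h = neighbours-graph f _ w p h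
neighbours-graph f k (node w x y z) (e₁ ∷ p) h = neighbours-graph f _ x p h
neighbours-graph f k (node w x y z) (e₂ ∷ p) h = neighbours-graph f _ y p h
neighbours-graph f k (node w x y z) (e₃ ∷ p) h = neighbours-graph f _ z p h

every-sound : ∀ f rs → every f rs ≡ true → ∀ {r} → r ∈ᴸ rs → f r ≡ true
every-sound f (r ∷ rs) h (here refl) = ∧-splitˡ h
every-sound f (r ∷ rs) h (there i) = every-sound f rs (∧-splitʳ {f r} h) i

-- Weights as products of prime powers

length-single : ∀ p u → length (single p u) ≡ length u
length-single p [] = refl
length-single p (x ∷ u) = cong suc (length-single p u)

length-*ᵗ : ∀ {n} s t → length s ≡ n → length t ≡ n → length (s *ᵗ t) ≡ n
length-*ᵗ [] [] refl _ = refl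
length-*ᵗ (q ∷ s) (r ∷ t) refl k = cong suc (length-*ᵗ s t refl (suc-injective k))

length-offset : ∀ {n} x t → length x ≡ n → length t ≡ n → length (offset x t) ≡ n
length-offset [] [] refl _ = refl
length-offset (v ∷ x) (q ∷ t) refl k = cong suc (length-offset x t refl (suc-injective k))

pick-shift : ∀ x v q → pick v (shift x q) ≡ pick (x ⊹ v) q
pick-shift e₀ v (quad a b c d) = refl
pick-shift e₁ e₀ (quad a b c d) = refl
pick-shift e₁ e₁ (quad a b c d) = refl
pick-shift e₁ e₂ (quad a b c d) = refl
pick-shift e₁ e₃ (quad a b c d) = refl
pick-shift e₂ e₀ (quad a b c d) = refl
pick-shift e₂ e₁ (quad a b c d) = refl
pick-shift e₂ e₂ (quad a b c d) = refl
pick-shift e₂ e₃ (quad a b c d) = refl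
pick-shift e₃ e₀ (quad a b c d) = refl
pick-shift e₃ e₁ (quad a b c d) = refl
pick-shift e₃ e₂ (quad a b c d) = refl
pick-shift e₃ e₃ (quad a b c d) = refl

pick-* : ∀ v q r → pick v (q *ᵠ r) ≡ pick v q * pick v r
pick-* e₀ (quad a b c d) (quad a′ b′ c′ d′) = refl
pick-* e₁ (quad a b c d) (quad a′ b′ c′ d′) = refl
pick-* e₂ (quad a b c d) (quad a′ b′ c′ d′) = refl
pick-* e₃ (quad a b c d) (quad a′ b′ c′ d′) = refl

weight-offset : ∀ x t a → length x ≡ length t → weight (offset x t) a ≡ weight t (x ⊞ a)
weight-offset [] [] [] _ = refl
weight-offset [] [] (v ∷ a) _ = refl
weight-offset (y ∷ x) (q ∷ t) [] h = refl
weight-offset (y ∷ x) (q ∷ t) (v ∷ a) h = cong₂ _*_ (pick-shift y v q) (weight-offset x t a (suc-injective h))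

*-interchange : ∀ a b c d → (a * b) * (c * d) ≡ (a * c) * (b * d)
*-interchange a b c d = trans (*-assoc a b (c * d)) (trans (cong (a *_) (trans (sym (*-assoc b c d))
  (trans (cong (_* d) (*-comm b c)) (*-assoc c b d)))) (sym (*-assoc a c (b * d))))

weight-* : ∀ s t a → length s ≡ length t → weight (s *ᵗ t) a ≡ weight s a * weight t a
weight-* [] [] a _ = refl
weight-* (q ∷ s) (r ∷ t) [] _ = refl
weight-* (q ∷ s) (r ∷ t) (v ∷ a) h = trans (cong₂ _*_ (pick-* v q r) (weight-* s t a (suc-injective h)))
  (*-interchange (pick v q) (pick v r) (weight s a) (weight t a))

pick-point : ∀ p u v → pick v (point p u) ≡ p ^ vanish (u ⊹ v)
pick-point p e₀ e₀ = sym (*-identityʳ p)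
pick-point p e₀ e₁ = refl
pick-point p e₀ e₂ = refl
pick-point p e₀ e₃ = refl
pick-point p e₁ e₀ = refl
pick-point p e₁ e₁ = sym (*-identityʳ p)
pick-point p e₁ e₂ = refl
pick-point p e₁ e₃ = refl
pick-point p e₂ e₀ = refl
pick-point p e₂ e₁ = refl
pick-point p e₂ e₂ = sym (*-identityʳ p)
pick-point p e₂ e₃ = refl
pick-point p e₃ e₀ = refl
pick-point p e₃ e₁ = refl
pick-point p e₃ e₂ = refl
pick-point p e₃ e₃ = sym (*-identityʳ p)

weight-single : ∀ p u a → weight (single p u) a ≡ p ^ zeros (u ⊞ a)
weight-single p [] a = refl
weight-single p (x ∷ u) [] = refl
weight-single p (x ∷ u) (v ∷ a) = trans (cong₂ _*_ (pick-point p x v) (weight-single p u a))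
  (sym (^-distribˡ-+-* p (vanish (x ⊹ v)) (zeros (u ⊞ a))))

^-monoʳ-∣ : ∀ p {m n} → m ≤ n → p ^ m ∣ p ^ n
^-monoʳ-∣ p {m} {n} h = subst (λ k → p ^ m ∣ p ^ k) (m+[n∸m]≡n h)
  (subst (p ^ m ∣_) (sym (^-distribˡ-+-* p m (n ∸ m))) (m∣m*n (p ^ (n ∸ m))))

-- weight (table ps U) a is the product over the rows u of U of the prime of u to the number of
-- columns in which u ⊞ a vanishes, so bounding these numbers amounts to a divisibility.
Cap : List Row → ℕ → Row → Set
Cap us k a = All (λ u → zeros (u ⊞ a) ≤ k) us

length-table : ∀ {n} p ps u us → length ps ≡ length us → All (λ u → length u ≡ n) (u ∷ us) →
               length (table (p ∷ ps) (u ∷ us)) ≡ n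
length-table p [] u [] h (l ∷ []) = trans (length-single p u) l
length-table p (p′ ∷ ps) u (u′ ∷ us) h (l ∷ ls) =
  length-*ᵗ (single p u) (table (p′ ∷ ps) (u′ ∷ us)) (trans (length-single p u) l) (length-table p′ ps u′ us (suc-injective h) ls)

table-sound : ∀ {n} k p ps u us a → length ps ≡ length us → All (λ u → length u ≡ n) (u ∷ us) →
              Cap (u ∷ us) k a → weight (table (p ∷ ps) (u ∷ us)) a ∣ bound k (p ∷ ps)
table-sound k p [] u [] a h ls (c ∷ []) =
  subst₂ _∣_ (sym (weight-single p u a)) (sym (*-identityʳ (p ^ k))) (^-monoʳ-∣ p c)
table-sound k p (p′ ∷ ps) u (u′ ∷ us) a h (l ∷ ls) (c ∷ cs) =
  subst (_∣ bound k (p ∷ p′ ∷ ps))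
    (sym (weight-* (single p u) (table (p′ ∷ ps) (u′ ∷ us)) a
      (trans (trans (length-single p u) l) (sym (length-table p′ ps u′ us (suc-injective h) ls)))))
    (*-pres-∣ (subst (_∣ p ^ k) (sym (weight-single p u a)) (^-monoʳ-∣ p c))
              (table-sound k p′ ps u′ us a (suc-injective h) ls cs))

-- Normal forms modulo a span of rows

xnor-sound : ∀ p q → not (p xor q) ≡ true → p ≡ q
xnor-sound false false _ = refl
xnor-sound true true _ = refl

bit-⊹ : ∀ b x y → bit b (x ⊹ y) ≡ bit b x xor bit b y
bit-⊹ b x y = xnor-sound _ _ (allF-sound (λ y → same x y) (allF-sound (λ x → allF (same x)) (all b) x) y)
  where
  same : F → F → Bool
  same x y = not (bit b (x ⊹ y) xor (bit b x xor bit b y))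
  all : ∀ b → allF (λ x → allF λ y → not (bit b (x ⊹ y) xor (bit b x xor bit b y))) ≡ true
  all false = refl
  all true = refl

bitAt-⊞ : ∀ l b x y → length x ≡ length y → bitAt l b (x ⊞ y) ≡ bitAt l b x xor bitAt l b y
bitAt-⊞ l b [] [] _ = refl
bitAt-⊞ zero b (x ∷ xs) (y ∷ ys) _ = bit-⊹ b x y
bitAt-⊞ (suc l) b (x ∷ xs) (y ∷ ys) h = bitAt-⊞ l b xs ys (suc-injective h)

Cleared : Row → Pivot → Set
Cleared g (l , b , w) = bitAt l b g ≡ false

clearOf-sound : ∀ l b ps → clearOf l b ps ≡ true → All (λ (_ , _ , w) → bitAt l b w ≡ false) ps
clearOf-sound l b [] h = []
clearOf-sound l b ((_ , _ , w) ∷ ps) h = not-true _ (∧-splitˡ h) ∷ clearOf-sound l b ps (∧-splitʳ {not (bitAt l b w)} h)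
  where
  not-true : ∀ x → not x ≡ true → x ≡ false
  not-true false _ = refl

-- Pivots are cleared from the front. By triangularity the later pivot rows are zero at the bit just
-- cleared, so its vanishing can join the invariant `P` before the recursion.
normalise : ∀ n (P : Row → Set) → (∀ g → P g → length g ≡ n) → ∀ ps → triangular ps ≡ true →
            All (λ (_ , _ , w) → length w ≡ n × (∀ g → P g → P (w ⊞ g))) ps →
            ∀ g → P g → ∃[ g′ ] P g′ × All (Cleared g′) ps
normalise n P len [] tri cl g pg = g , pg , []
normalise n P len ((l , b , w) ∷ ps) tri ((lw , cl) ∷ cls) g pg =
  let g₁ , pg₁ , z = clear in
  let g′ , (pg′ , z′) , zs = normalise n (λ g → P g × bitAt l b g ≡ false) (λ g → len g ∘ proj₁) ps
                               (∧-splitʳ {clearOf l b ps} (∧-splitʳ {bitAt l b w} tri)) closed g₁ (pg₁ , z) in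
  g′ , pg′ , z′ ∷ zs
  where
  clear : ∃[ g₁ ] P g₁ × bitAt l b g₁ ≡ false
  clear with bitAt l b g in eq
  ... | false = g , pg , eq
  ... | true = w ⊞ g , cl g pg ,
    trans (bitAt-⊞ l b w g (trans lw (sym (len g pg)))) (cong₂ _xor_ (∧-splitˡ {bitAt l b w} {clearOf l b ps ∧ triangular ps} tri) eq)
  closed : All (λ (_ , _ , w) → length w ≡ n × (∀ g → P g × bitAt l b g ≡ false → P (w ⊞ g) × bitAt l b (w ⊞ g) ≡ false)) ps
  closed = All.zipWith
    (λ { {_ , _ , v} ((lv , c) , z) → lv , λ g (p , e) → c g p ,
         trans (bitAt-⊞ l b v g (trans lv (sym (len g p)))) (cong₂ _xor_ z e) })
    (cls , clearOf-sound l b ps (∧-splitˡ (∧-splitʳ {bitAt l b w} tri)))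

pick-forbidBit : ∀ b M q v → bit b v ≡ false → pick v (forbidBit b M q) ≡ pick v q
pick-forbidBit false M (quad w x y z) e₀ _ = refl
pick-forbidBit false M (quad w x y z) e₂ _ = refl
pick-forbidBit true M (quad w x y z) e₀ _ = refl
pick-forbidBit true M (quad w x y z) e₁ _ = refl

weight-forbid : ∀ l b M t g → bitAt l b g ≡ false → weight (forbid l b M t) g ≡ weight t g
weight-forbid l b M [] g h = refl
weight-forbid zero b M (q ∷ qs) [] h = refl
weight-forbid zero b M (q ∷ qs) (v ∷ g) h = cong (_* weight qs g) (pick-forbidBit b M q v h)
weight-forbid (suc l) b M (q ∷ qs) [] h = refl
weight-forbid (suc l) b M (q ∷ qs) (v ∷ g) h = cong (pick v q *_) (weight-forbid l b M qs g h)

weight-restrict : ∀ ps M t g → All (Cleared g) ps → weight (restrict ps M t) g ≡ weight t g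
weight-restrict [] M t g _ = refl
weight-restrict ((l , b , w) ∷ ps) M t g (h ∷ hs) =
  trans (weight-forbid l b M (restrict ps M t) g h) (weight-restrict ps M t g hs)

length-forbid : ∀ l b M t → length (forbid l b M t) ≡ length t
length-forbid l b M [] = refl
length-forbid zero b M (q ∷ qs) = refl
length-forbid (suc l) b M (q ∷ qs) = cong suc (length-forbid l b M qs)

length-restrict : ∀ ps M t → length (restrict ps M t) ≡ length t
length-restrict [] M t = refl
length-restrict ((l , b , w) ∷ ps) M t = trans (length-forbid l b M (restrict ps M t)) (length-restrict ps M t)

module _ (Q : Row → Set) (Q-⊞ : ∀ v w → Q v → Q w → Q (v ⊞ w)) where
  -- `Q` will be membership in `U`, or the property of a row that adding it to an admissible
  -- extension leaves it admissible.
  eliminate-closed : ∀ n ws → All Q ws → All (λ (_ , _ , w) → Q w) (eliminate n ws)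
  eliminate-closed zero [] qs = []
  eliminate-closed zero (w ∷ ws) qs = []
  eliminate-closed (suc n) [] qs = []
  eliminate-closed (suc n) (w ∷ ws) (q ∷ qs) = q ∷ eliminate-closed n _ (reduced ws qs)
    where
    l = proj₁ (firstBit 0 w)
    b = proj₂ (firstBit 0 w)
    choose : ∀ v → Q v → ∀ x → Q (if x then v ⊞ w else v)
    choose v p true = Q-⊞ v w p q
    choose v p false = p
    reduced : ∀ ws → All Q ws → All Q (map (λ v → if bitAt l b v then v ⊞ w else v) ws)
    reduced [] [] = []
    reduced (v ∷ vs) (p ∷ ps) = choose v p (bitAt l b v) ∷ reduced vs ps

# : Bool → ℕ
# false = 0
# true = 1

addIf : Bool → Row → Row → Row
addIf true a r = a ⊞ r
addIf false a r = r

+-swap : ∀ x y z → x + (y + z) ≡ y + (x + z)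
+-swap x y z = trans (sym (+-assoc x y z)) (trans (cong (_+ z) (+-comm x y)) (+-assoc y x z))

addIf-swap : ∀ α β a b r → addIf α a (addIf β b r) ≡ addIf β b (addIf α a r)
addIf-swap false β a b r = refl
addIf-swap true false a b r = refl
addIf-swap true true a b r = ⊞-swap a b r

zeros-replicate : ∀ n → zeros (replicate n e₀) ≡ n
zeros-replicate zero = refl
zeros-replicate (suc n) = cong suc (zeros-replicate n)

zeroRow-replicate : ∀ {n} a → length a ≡ n → zeroRow a ≡ replicate n e₀
zeroRow-replicate [] refl = refl
zeroRow-replicate (x ∷ a) refl = cong (e₀ ∷_) (zeroRow-replicate a refl)

-- This hides the primes from the proof about the search: of a table it keeps the length and the
-- passage from a cap to a divisibility.
IsTable : List Row → ℕ → Table → (ℕ → ℕ) → Set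
IsTable us n t bd = length t ≡ n × (∀ k a → Cap us k a → weight t a ∣ bd k)

data Tables (us : List Row) (n : ℕ) : List Table → List ℕ → ℕ → Set where
  [_] : ∀ {t k bd} → IsTable us n t bd → Tables us n (t ∷ []) (k ∷ []) (bd k * 1)
  _∷_ : ∀ {t t′ ts k k′ ks bd N} → IsTable us n t bd → Tables us n (t′ ∷ ts) (k′ ∷ ks) N →
        Tables us n (t ∷ t′ ∷ ts) (k ∷ k′ ∷ ks) (bd k * N)

data Caps (us : List Row) (n : ℕ) (g : Row) : List Row → List ℕ → Set where
  [] : Caps us n g [] []
  _∷_ : ∀ {s ss k ks} → length s ≡ n × Cap us k (s ⊞ g) → Caps us n g ss ks → Caps us n g (s ∷ ss) (k ∷ ks)

length-product : ∀ {us n g ss ts ks N} → Tables us n ts ks N → Caps us n g ss ks → length (product ss ts) ≡ n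
length-product {ss = s ∷ []} [ l , _ ] ((ls , _) ∷ []) = length-offset s _ ls l
length-product {ss = s ∷ s′ ∷ ss} ((l , _) ∷ ts) ((ls , _) ∷ cs) = length-*ᵗ (offset s _) _ (length-offset s _ ls l) (length-product ts cs)

product-sound : ∀ {us n g ss ts ks N} → Tables us n ts ks N → Caps us n g ss ks → weight (product ss ts) g ∣ N
product-sound {g = g} {ss = s ∷ []} [ l , snd ] ((ls , c) ∷ []) =
  ∣m⇒∣m*n 1 (subst (_∣ _) (sym (weight-offset s _ g (trans ls (sym l)))) (snd _ _ c))
product-sound {g = g} {ss = s ∷ s′ ∷ ss} {ts = t ∷ ts} ((l , snd) ∷ tbs) ((ls , c) ∷ cs) =
  subst (_∣ _) (sym (trans (weight-* (offset s t) (product (s′ ∷ ss) ts) g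
                              (trans (length-offset s t ls l) (sym (length-product tbs cs))))
                           (cong (_* weight (product (s′ ∷ ss) ts) g) (weight-offset s t g (trans ls (sym l))))))
    (*-pres-∣ (snd _ _ c) (product-sound tbs cs))

record IsSym (us : List Row) (n : ℕ) (γ : Sym) : Set where
  field
    ·-length : ∀ a → length (γ · a) ≡ length a
    ·-⊞ : ∀ a b → length a ≡ n → length b ≡ n → γ · (a ⊞ b) ≡ (γ · a) ⊞ (γ · b)
    ·-zeros : ∀ a → zeros (γ · a) ≡ zeros a
    ·-onto : ∀ {u} → u ∈ᴸ us → ∃[ v ] v ∈ᴸ us × γ · v ≡ u

-- `thin` says that no row keeps to two zeros throughout its coset; it forces every common killer of
-- the four lines into `U`. By `4<n` the zero row violates the bound 4, which keeps the members of a
-- clique distinct.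
record Valid (C : Ctx) (n : ℕ) : Set where
  field
    4<n : 4 < n
    lenU : ∀ {u} → u ∈ᴸ U C → length u ≡ n
    0∈U : replicate n e₀ ∈ᴸ U C
    U-⊞ : ∀ {u v} → u ∈ᴸ U C → v ∈ᴸ U C → u ⊞ v ∈ᴸ U C
    basis⊆U : All (_∈ᴸ U C) (basis C)
    b₀ b₁ : ℕ → ℕ
    tab₀ : IsTable (U C) n (t₀ C) b₀
    tab₁ : IsTable (U C) n (t₁ C) b₁
    a₂≡ : a₂ C ≡ b₀ 2
    a₃≡ : a₃ C ≡ b₀ 3
    a₄≡ : a₄ C ≡ b₀ 4
    a₅≡ : a₅ C ≡ b₀ 5
    a₆≡ : a₆ C ≡ b₀ 6
    a₄₅≡ : a₄₅ C ≡ b₀ 4 * b₁ 5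
    thin : barren (t₀ C) (a₂ C) ≡ true
    extTabs : Tables (U C) n (tabs C) caps (nG C)
    symsOK : All (All (IsSym (U C) n ∘ proj₂)) (syms C)

module Search (C : Ctx) (n : ℕ) (V : Valid C n) where
  open Valid V

  us : List Row
  us = U C

  -- `Cap` speaks of a whole coset of `U`, so the choice of its representative is immaterial.
  cap-translate : ∀ {k a u} → u ∈ᴸ us → Cap us k a → Cap us k (u ⊞ a)
  cap-translate {k} {a} {u} iu c = All.tabulate λ {v} iv →
    subst (λ r → zeros r ≤ k) (⊞-assoc v u a) (All.lookup c (U-⊞ iv iu))

  cap-sym : ∀ {k a γ} → IsSym us n γ → length a ≡ n → Cap us k a → Cap us k (γ · a)
  cap-sym {k} {a} {γ} S la c = All.tabulate go
    where
    open IsSym S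
    go : ∀ {v} → v ∈ᴸ us → zeros (v ⊞ (γ · a)) ≤ k
    go iv with ·-onto iv
    ... | v′ , iv′ , refl = subst (_≤ k)
      (trans (sym (·-zeros (v′ ⊞ a))) (cong zeros (·-⊞ v′ a (lenU iv′) la))) (All.lookup c iv′)

  𝟎 : Row
  𝟎 = replicate n e₀

  𝟎-length : length 𝟎 ≡ n
  𝟎-length = lenU 0∈U

  ⊞-𝟎 : ∀ a → length a ≡ n → a ⊞ 𝟎 ≡ a
  ⊞-𝟎 a la = trans (⊞-comm a 𝟎) (trans (cong (_⊞ a) (sym (zeroRow-replicate a la))) (zeroRow-⊞ a a refl))

  sym-𝟎 : ∀ {γ} → IsSym us n γ → γ · 𝟎 ≡ 𝟎
  sym-𝟎 {γ} S = trans (cong (γ ·_) (sym (⊞-𝟎 𝟎 𝟎-length))) (trans (·-⊞ 𝟎 𝟎 𝟎-length 𝟎-length)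
    (trans (⊞-self (γ · 𝟎)) (zeroRow-replicate (γ · 𝟎) (trans (·-length 𝟎) 𝟎-length))))
    where open IsSym S

  comb : (α β γ δ : Bool) (a b c d : Row) → Row
  comb α β γ δ a b c d = addIf α a (addIf β b (addIf γ c (addIf δ d 𝟎)))

  count : (α β γ δ : Bool) → ℕ
  count α β γ δ = # α + (# β + (# γ + # δ))

  -- The four rows play the roles of vectors vanishing on all but one of the four chosen lines;
  -- an extension for a pair of them is a vector vanishing on the other two lines.
  record Clique (a b c d : Row) : Set where
    field
      la : length a ≡ n
      lb : length b ≡ n
      lc : length c ≡ n
      ld : length d ≡ n
      cap : ∀ α β γ δ → 1 ≤ count α β γ δ → Cap us (2 + count α β γ δ) (comb α β γ δ a b c d)
      ext : ∀ s t u v → count s t u v ≡ 2 → ∃[ g ] length g ≡ n ×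
            (∀ α β γ δ → Cap us (2 + count (s ∨ α) (t ∨ β) (u ∨ γ) (v ∨ δ)) (comb α β γ δ a b c d ⊞ g))

  swap₁₂ : ∀ {a b c d} → Clique a b c d → Clique b a c d
  swap₁₂ {a} {b} {c} {d} K = record
    { la = lb ; lb = la ; lc = lc ; ld = ld
    ; cap = λ α β γ δ h → subst₂ (Cap us) (cong (2 +_) (+-swap (# β) (# α) _)) (addIf-swap β α a b _)
              (cap β α γ δ (subst (1 ≤_) (+-swap (# α) (# β) _) h))
    ; ext = λ s t u v h → let g , lg , e = ext t s u v (trans (+-swap (# t) (# s) _) h) in
        g , lg , λ α β γ δ → subst₂ (Cap us) (cong (2 +_) (+-swap (# (t ∨ β)) (# (s ∨ α)) _))
          (cong (_⊞ g) (addIf-swap β α a b _)) (e β α γ δ) }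
    where open Clique K

  swap₂₃ : ∀ {a b c d} → Clique a b c d → Clique a c b d
  swap₂₃ {a} {b} {c} {d} K = record
    { la = la ; lb = lc ; lc = lb ; ld = ld
    ; cap = λ α β γ δ h → subst₂ (Cap us) (cong (λ m → 2 + (# α + m)) (+-swap (# γ) (# β) _))
              (cong (addIf α a) (addIf-swap γ β b c _))
              (cap α γ β δ (subst (1 ≤_) (cong (# α +_) (+-swap (# β) (# γ) _)) h))
    ; ext = λ s t u v h → let g , lg , e = ext s u t v (trans (cong (# s +_) (+-swap (# u) (# t) _)) h) in
        g , lg , λ α β γ δ → subst₂ (Cap us) (cong (λ m → 2 + (# (s ∨ α) + m)) (+-swap (# (u ∨ γ)) (# (t ∨ β)) _))
          (cong (λ r → addIf α a r ⊞ g) (addIf-swap γ β b c _)) (e α γ β δ) }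
    where open Clique K

  swap₃₄ : ∀ {a b c d} → Clique a b c d → Clique a b d c
  swap₃₄ {a} {b} {c} {d} K = record
    { la = la ; lb = lb ; lc = ld ; ld = lc
    ; cap = λ α β γ δ h → subst₂ (Cap us) (cong (λ m → 2 + (# α + (# β + m))) (+-comm (# δ) (# γ)))
              (cong (λ r → addIf α a (addIf β b r)) (addIf-swap δ γ c d 𝟎))
              (cap α β δ γ (subst (1 ≤_) (cong (λ m → # α + (# β + m)) (+-comm (# γ) (# δ))) h))
    ; ext = λ s t u v h → let g , lg , e = ext s t v u (trans (cong (λ m → # s + (# t + m)) (+-comm (# v) (# u))) h) in
        g , lg , λ α β γ δ → subst₂ (Cap us) (cong (λ m → 2 + (# (s ∨ α) + (# (t ∨ β) + m))) (+-comm (# (v ∨ δ)) (# (u ∨ γ))))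
          (cong (λ r → addIf α a (addIf β b r) ⊞ g) (addIf-swap δ γ c d 𝟎)) (e α β δ γ) }
    where open Clique K

  comb-translate : ∀ α β γ δ u a b c d → comb α β γ δ (u ⊞ a) b c d ≡ addIf α u (comb α β γ δ a b c d)
  comb-translate false β γ δ u a b c d = refl
  comb-translate true β γ δ u a b c d = ⊞-assoc u a _

  addIf-⊞ : ∀ α u r g → addIf α u r ⊞ g ≡ addIf α u (r ⊞ g)
  addIf-⊞ false u r g = refl
  addIf-⊞ true u r g = ⊞-assoc u r g

  cap-addIf : ∀ {k} α {u a} → u ∈ᴸ us → Cap us k a → Cap us k (addIf α u a)
  cap-addIf false iu c = c
  cap-addIf true iu c = cap-translate iu c

  translate : ∀ {a b c d u} → u ∈ᴸ us → Clique a b c d → Clique (u ⊞ a) b c d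
  translate {a} {b} {c} {d} {u} iu K = record
    { la = length-⊞ u a (lenU iu) la ; lb = lb ; lc = lc ; ld = ld
    ; cap = λ α β γ δ h → subst (Cap us _) (sym (comb-translate α β γ δ u a b c d)) (cap-addIf α iu (cap α β γ δ h))
    ; ext = λ s t u′ v h → let g , lg , e = ext s t u′ v h in
        g , lg , λ α β γ δ → subst (Cap us _)
          (sym (trans (cong (_⊞ g) (comb-translate α β γ δ u a b c d)) (addIf-⊞ α u _ g))) (cap-addIf α iu (e α β γ δ)) }
    where open Clique K

  addIf-length : ∀ α a r → length a ≡ n → length r ≡ n → length (addIf α a r) ≡ n
  addIf-length false a r la lr = lr
  addIf-length true a r la lr = length-⊞ a r la lr

  module _ {a b c d : Row} (K : Clique a b c d) where
    open Clique K

    comb-length : ∀ α β γ δ → length (comb α β γ δ a b c d) ≡ n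
    comb-length α β γ δ = addIf-length α a _ la (addIf-length β b _ lb (addIf-length γ c _ lc (addIf-length δ d _ ld 𝟎-length)))

    comb-sym : ∀ {σ} → IsSym us n σ → ∀ α β γ δ →
               comb α β γ δ (σ · a) (σ · b) (σ · c) (σ · d) ≡ σ · comb α β γ δ a b c d
    comb-sym {σ} S α β γ δ = step α a la _ _ l₃ (step β b lb _ _ l₂ (step γ c lc _ _ l₁ (step δ d ld _ _ 𝟎-length (sym (sym-𝟎 S)))))
      where
      l₁ = addIf-length δ d 𝟎 ld 𝟎-length
      l₂ = addIf-length γ c _ lc l₁
      l₃ = addIf-length β b _ lb l₂
      step : ∀ α a → length a ≡ n → ∀ r r′ → length r ≡ n → r′ ≡ σ · r → addIf α (σ · a) r′ ≡ σ · addIf α a r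
      step false a l r r′ lr h = h
      step true a l r r′ lr h = trans (cong ((σ · a) ⊞_) h) (sym (IsSym.·-⊞ S a r l lr))

    transform : ∀ {σ} → IsSym us n σ → Clique (σ · a) (σ · b) (σ · c) (σ · d)
    transform {σ} S = record
      { la = trans (·-length a) la ; lb = trans (·-length b) lb ; lc = trans (·-length c) lc ; ld = trans (·-length d) ld
      ; cap = λ α β γ δ h → subst (Cap us _) (sym (comb-sym S α β γ δ)) (cap-sym S (comb-length α β γ δ) (cap α β γ δ h))
      ; ext = λ s t u v h → let g , lg , e = ext s t u v h in
          σ · g , trans (·-length g) lg , λ α β γ δ → subst (Cap us _)
            (trans (·-⊞ (comb α β γ δ a b c d) g (comb-length α β γ δ) lg) (cong (_⊞ (σ · g)) (sym (comb-sym S α β γ δ))))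
            (cap-sym S (length-⊞ (comb α β γ δ a b c d) g (comb-length α β γ δ) lg) (e α β γ δ)) }
      where open IsSym S

-- Soundness of the search

∨-split : ∀ x {y} → x ∨ y ≡ true → x ≡ true ⊎ y ≡ true
∨-split true h = inj₁ refl
∨-split false h = inj₂ h

length-decode : ∀ n c → length (decode n c) ≡ n
length-decode zero c = refl
length-decode (suc n) c = cong suc (length-decode n (c / 4))

module Kill (C : Ctx) (n : ℕ) (V : Valid C n) where
  open Valid V
  open Search C n V

  adds : (α β γ δ : Bool) (a b c d g : Row) → Row
  adds α β γ δ a b c d g = addIf α a (addIf β b (addIf γ c (addIf δ d g)))

  comb-⊞ : ∀ α β γ δ a b c d g → length g ≡ n → comb α β γ δ a b c d ⊞ g ≡ adds α β γ δ a b c d g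
  comb-⊞ α β γ δ a b c d g lg = trans (addIf-⊞ α a _ g) (cong (addIf α a) (trans (addIf-⊞ β b _ g) (cong (addIf β b)
    (trans (addIf-⊞ γ c _ g) (cong (addIf γ c) (trans (addIf-⊞ δ d _ g) (cong (addIf δ d)
      (trans (⊞-comm 𝟎 g) (⊞-𝟎 g lg)))))))))

  toggle : ∀ α a r → length a ≡ n → length r ≡ n → addIf α a (a ⊞ r) ≡ addIf (not α) a r
  toggle false a r la lr = refl
  toggle true a r la lr = ⊞-cancel a r (trans la (sym lr))

  -- The set `P` of admissible extensions is stable under `a`, `b` and `U`: adding `a` or `b`
  -- permutes the sixteen conditions, and a row of `U` stays within each coset. So the extension may
  -- be normalised, and its caps then yield the divisibility that `barren` excludes.
  noExt-sound : ∀ {a b c d} → Clique c d a b → noExt C a b c d ≡ true → ⊥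
  noExt-sound {a} {b} {c} {d} K h = refute (ext false false true true refl)
    where
    open Clique K renaming (la to lc; lb to ld; lc to la; ld to lb)
    P : Row → Set
    P g = length g ≡ n × (∀ α β γ δ → Cap us (2 + (# α + (# β + 2))) (adds α β γ δ c d a b g))
    Q : Row → Set
    Q w = length w ≡ n × (∀ g → P g → P (w ⊞ g))
    Q-⊞ : ∀ v w → Q v → Q w → Q (v ⊞ w)
    Q-⊞ v w (lv , cv) (lw , cw) = length-⊞ v w lv lw , λ g p → subst P (sym (⊞-assoc v w g)) (cv (w ⊞ g) (cw g p))
    Q-a : Q a
    Q-a = la , λ g (lg , p) → length-⊞ a g la lg , λ α β γ δ → subst (Cap us _)
      (cong (λ r → addIf α c (addIf β d r)) (sym (trans (cong (addIf γ a) (addIf-swap δ true b a g))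
        (toggle γ a _ la (addIf-length δ b g lb lg))))) (p α β (not γ) δ)
    Q-b : Q b
    Q-b = lb , λ g (lg , p) → length-⊞ b g lb lg , λ α β γ δ → subst (Cap us _)
      (cong (λ r → addIf α c (addIf β d (addIf γ a r))) (sym (toggle δ b g lb lg))) (p α β γ (not δ))
    Q-u : ∀ {u} → u ∈ᴸ us → Q u
    Q-u {u} iu = lenU iu , λ g (lg , p) → length-⊞ u g (lenU iu) lg , λ α β γ δ → subst (Cap us _)
      (sym (trans (cong (λ r → addIf α c (addIf β d (addIf γ a r))) (addIf-swap δ true b u g))
        (trans (cong (λ r → addIf α c (addIf β d r)) (addIf-swap γ true a u _))
          (trans (cong (addIf α c) (addIf-swap β true d u _)) (addIf-swap α true c u _)))))
      (cap-translate iu (p α β γ δ))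
    ps = eliminate 5 (a ∷ b ∷ basis C)
    ss = sums 𝟎 (c ∷ d ∷ a ∷ b ∷ [])
    refute : ∃[ g ] length g ≡ n × (∀ α β γ δ → Cap us (2 + count (false ∨ α) (false ∨ β) (true ∨ γ) (true ∨ δ)) (comb α β γ δ c d a b ⊞ g)) → ⊥
    refute (g , lg , e) = barren-sound (restrict ps (suc (nG C)) (product ss (tabs C))) (nG C)
      (subst (λ z → barren (restrict ps (suc (nG C)) (product (sums z (c ∷ d ∷ a ∷ b ∷ [])) (tabs C))) (nG C) ≡ true)
        (zeroRow-replicate a la) (∧-splitʳ {triangular ps} h))
      g′ (trans (proj₁ pg′) (sym (trans (length-restrict ps _ (product ss (tabs C))) (length-product extTabs capped))))
      (subst (_∣ nG C) (sym (weight-restrict ps _ (product ss (tabs C)) g′ cl)) (product-sound extTabs capped))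
      where
      normal = normalise n P (λ _ → proj₁) ps (∧-splitˡ h)
        (eliminate-closed Q Q-⊞ 5 (a ∷ b ∷ basis C) (Q-a ∷ Q-b ∷ All.map Q-u basis⊆U))
        g (lg , λ α β γ δ → subst (Cap us _) (comb-⊞ α β γ δ c d a b g lg) (e α β γ δ))
      g′ = proj₁ normal
      pg′ = proj₁ (proj₂ normal)
      cl = proj₂ (proj₂ normal)
      entry : ∀ α β γ δ → length (comb α β γ δ c d a b) ≡ n × Cap us (2 + (# α + (# β + 2))) (comb α β γ δ c d a b ⊞ g′)
      entry α β γ δ = comb-length K α β γ δ ,
        subst (Cap us _) (sym (comb-⊞ α β γ δ c d a b g′ (proj₁ pg′))) (proj₂ pg′ α β γ δ)
      capped : Caps us n g′ ss caps
      capped =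
        entry false false false false ∷ entry false false false true ∷ entry false false true false ∷ entry false false true true ∷
        entry false true false false ∷ entry false true false true ∷ entry false true true false ∷ entry false true true true ∷
        entry true false false false ∷ entry true false false true ∷ entry true false true false ∷ entry true false true true ∷
        entry true true false false ∷ entry true true false true ∷ entry true true true false ∷ entry true true true true ∷ []

  noExts-sound : ∀ {a b c d} → Clique a b c d → noExts C a b c d ≡ true → ⊥
  noExts-sound {a} {b} {c} {d} K h with ∨-split (noExt C a b c d) h
  ... | inj₁ e = noExt-sound (swap₂₃ (swap₁₂ (swap₃₄ (swap₂₃ K)))) e
  ... | inj₂ h with ∨-split (noExt C a c b d) h
  ... | inj₁ e = noExt-sound (swap₂₃ (swap₁₂ (swap₃₄ K))) e
  ... | inj₂ h with ∨-split (noExt C a d b c) h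
  ... | inj₁ e = noExt-sound (swap₂₃ (swap₁₂ K)) e
  ... | inj₂ h with ∨-split (noExt C b c a d) h
  ... | inj₁ e = noExt-sound (swap₂₃ (swap₃₄ K)) e
  ... | inj₂ h with ∨-split (noExt C b d a c) h
  ... | inj₁ e = noExt-sound (swap₂₃ K) e
  ... | inj₂ e = noExt-sound K e

  divides₀ : ∀ k x y → length x ≡ n → Cap us k (x ⊞ y) → weight (offset x (t₀ C)) y ∣ b₀ k
  divides₀ k x y lx c = subst (_∣ b₀ k) (sym (weight-offset x (t₀ C) y (trans lx (sym (proj₁ tab₀))))) (proj₂ tab₀ k _ c)

  divides₁ : ∀ k x y → length x ≡ n → Cap us k (x ⊞ y) → weight (offset x (t₁ C)) y ∣ b₁ k
  divides₁ k x y lx c = subst (_∣ b₁ k) (sym (weight-offset x (t₁ C) y (trans lx (sym (proj₁ tab₁))))) (proj₂ tab₁ k _ c)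

  module _ {r b c d : Row} (K : Clique r b c d) where
    open Clique K

    cap₁₂ : Cap us 4 (r ⊞ b)
    cap₁₂ = subst (λ x → Cap us 4 (r ⊞ x)) (⊞-𝟎 b lb) (cap true true false false (s≤s z≤n))

    cap₂₃ : Cap us 4 (b ⊞ c)
    cap₂₃ = subst (λ x → Cap us 4 (b ⊞ x)) (⊞-𝟎 c lc) (cap false true true false (s≤s z≤n))

    cap₁₂₃ : Cap us 5 (r ⊞ b ⊞ c)
    cap₁₂₃ = subst (Cap us 5) (trans (cong (λ x → r ⊞ (b ⊞ x)) (⊞-𝟎 c lc)) (sym (⊞-assoc r b c))) (cap true true true false (s≤s z≤n))

    -- Equal rows would have the zero row as their sum, whose n zeros exceed the bound 4.
    distinct : b ≢ c
    distinct refl = <⇒≱ 4<n (subst (_≤ 4) (trans (cong zeros (trans (⊞-𝟎 (b ⊞ b) (length-⊞ b b lb lb) ) (trans (⊞-self b) (zeroRow-replicate b lb)))) (zeros-replicate n))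
      (All.lookup cap₂₃′ 0∈U))
      where
      cap₂₃′ : All (λ u → zeros (b ⊞ b ⊞ u) ≤ 4) us
      cap₂₃′ = All.map (λ {u} → subst (λ x → zeros x ≤ 4) (⊞-comm u (b ⊞ b))) cap₂₃

    dead-sound : dead C r b c d ≡ true → ⊥
    dead-sound h with ∨-split (not (fits (offset (b ⊞ c) (t₀ C)) d (a₅ C))) h
    ... | inj₁ e rewrite fits-sound (offset (b ⊞ c) (t₀ C)) d (a₅ C)
            (subst (weight (offset (b ⊞ c) (t₀ C)) d ∣_) (sym a₅≡) (divides₀ 5 (b ⊞ c) d (length-⊞ b c lb lc)
              (subst (Cap us 5) (trans (cong (λ x → b ⊞ (c ⊞ x)) (⊞-𝟎 d ld)) (sym (⊞-assoc b c d))) (cap false true true true (s≤s z≤n))))) with () ← e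
    ... | inj₂ h with ∨-split (not (fits (offset (r ⊞ (b ⊞ c)) (t₀ C)) d (a₆ C))) h
    ... | inj₁ e rewrite fits-sound (offset (r ⊞ (b ⊞ c)) (t₀ C)) d (a₆ C)
            (subst (weight (offset (r ⊞ (b ⊞ c)) (t₀ C)) d ∣_) (sym a₆≡) (divides₀ 6 (r ⊞ (b ⊞ c)) d (length-⊞ r _ la (length-⊞ b c lb lc))
              (subst (Cap us 6) (trans (cong (λ x → r ⊞ (b ⊞ (c ⊞ x))) (⊞-𝟎 d ld))
                (sym (trans (⊞-assoc r (b ⊞ c) d) (cong (r ⊞_) (⊞-assoc b c d))))) (cap true true true true (s≤s z≤n))))) with () ← e
    ... | inj₂ e = noExts-sound K e

    later-sound : ∀ t → c ∈ t → b ≺ c → c ∈ later C r (pack t) b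
    later-sound t i l = winnow-sound (offset b (t₀ C) *ᵗ s) (beyond b (pack t)) (a₄₅ C) c
      (trans lc (sym (length-*ᵗ (offset b (t₀ C)) s (length-offset b (t₀ C) lb (proj₁ tab₀)) l₁)))
      (beyond-sound b (pack t) c (pack-sound t c i) l)
      (subst₂ _∣_ (sym (weight-* (offset b (t₀ C)) s c (trans (length-offset b (t₀ C) lb (proj₁ tab₀)) (sym l₁)))) (sym a₄₅≡)
        (*-pres-∣ (divides₀ 4 b c lb cap₂₃) (divides₁ 5 (r ⊞ b) c (length-⊞ r b la lb) cap₁₂₃)))
      where
      s = offset (r ⊞ b) (t₁ C)
      l₁ = length-offset (r ⊞ b) (t₁ C) (length-⊞ r b la lb) (proj₁ tab₁)

    first-sound : ∀ t → b ∈ t → b ∈ sieve (offset r (t₀ C)) t (a₄ C)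
    first-sound t i = sieve-sound (offset r (t₀ C)) t (a₄ C) b (trans lb (sym (length-offset r (t₀ C) la (proj₁ tab₀)))) i
      (subst (weight (offset r (t₀ C)) b ∣_) (sym a₄≡) (divides₀ 4 r b la cap₁₂))

  kill₂-sound : ∀ {r b c d} t → kill₂ C r t ≡ true → Clique r b c d → b ∈ t → c ∈ t → d ∈ t → b ≺ c → c ≺ d → ⊥
  kill₂-sound {r} {b} {c} {d} t h K ib ic id b<c c<d = dead-sound K
    (every-sound (dead C r b c) (rows (meet (neighbours b G) (neighbours c G)))
      (every-sound (λ c → scan₃ C r b c (meet (neighbours b G) (neighbours c G))) (rows (neighbours b G))
        (every-sound (λ b → scan₂ C G r b (neighbours b G)) (rows t) h (rows-sound t b ib))
        (rows-sound (neighbours b G) c (near b c ib (later-sound K t ic b<c))))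
      (rows-sound _ d (meet-sound (neighbours b G) (neighbours c G) d
        (near b d ib (later-sound (swap₃₄ K) t id (≺-trans b<c c<d)))
        (near c d ic (later-sound (swap₃₄ (swap₂₃ K)) t id c<d)))))
    where
    G = graph (later C r (pack t)) (λ p → p) t
    near : ∀ p q → p ∈ t → q ∈ later C r (pack t) p → q ∈ neighbours p G
    near p q i = subst (q ∈_) (sym (neighbours-graph (later C r (pack t)) (λ p → p) t p i))

  -- The members of a clique are distinct and interchangeable, so `b`, `c`, `d` can be sorted into
  -- the increasing order in which `kill₂` examines them.
  kill₁-sound : ∀ {r b c d} t → kill₁ C r t ≡ true → Clique r b c d → b ∈ t → c ∈ t → d ∈ t → ⊥
  kill₁-sound {r} t h K ib ic id = first K (first-sound K t ib) (first-sound (swap₂₃ K) t ic) (first-sound (swap₂₃ (swap₃₄ K)) t id)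
    where
    s = sieve (offset r (t₀ C)) t (a₄ C)
    second : ∀ {b c d} → Clique r b c d → b ∈ s → c ∈ s → d ∈ s → b ≺ c → ⊥
    second {b} {c} {d} K ib ic id b<c with ≺-compare c d (trans (Clique.lc K) (sym (Clique.ld K)))
    ... | inj₁ c<d = kill₂-sound s h K ib ic id b<c c<d
    ... | inj₂ (inj₁ c≡d) = distinct (swap₃₄ (swap₂₃ K)) c≡d
    ... | inj₂ (inj₂ d<c) with ≺-compare b d (trans (Clique.lb K) (sym (Clique.ld K)))
    ... | inj₁ b<d = kill₂-sound s h (swap₃₄ K) ib id ic b<d d<c
    ... | inj₂ (inj₁ b≡d) = distinct (swap₃₄ K) b≡d
    ... | inj₂ (inj₂ d<b) = kill₂-sound s h (swap₂₃ (swap₃₄ K)) id ib ic d<b b<c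
    first : ∀ {b c d} → Clique r b c d → b ∈ s → c ∈ s → d ∈ s → ⊥
    first {b} {c} {d} K ib ic id with ≺-compare b c (trans (Clique.lb K) (sym (Clique.lc K)))
    ... | inj₁ b<c = second K ib ic id b<c
    ... | inj₂ (inj₁ b≡c) = distinct K b≡c
    ... | inj₂ (inj₂ c<b) = second (swap₂₃ K) ic ib id c<b

  Hits : Rows → Row → Set
  Hits t a = ∃[ u ] u ∈ᴸ us × u ⊞ a ∈ t

  module Loop (X : Row → Set)
    (X-length : ∀ {a} → X a → length a ≡ n)
    (X-cap : ∀ {a} → X a → Cap us 3 a)
    (X-translate : ∀ {u a} → u ∈ᴸ us → X a → X (u ⊞ a))
    (X-sym : ∀ {γ a} → IsSym us n γ → X a → X (γ · a))
    (X-kill : ∀ r t → kill₁ C r t ≡ true → (∀ a → X a → Hits t a) → ¬ X r)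
    where

    Good : Row → Set
    Good p = length p ≡ n × ¬ X p

    image-good : ∀ p st → IsSym us n (proj₂ st) → Good p → All Good (image p st)
    image-good p (δ , γ) S (lp , ¬x) with (γ · (δ · p)) ==ʳ p in eq
    ... | false = []
    ... | true = (trans (sym (·-length (δ · p))) (trans (cong length back) lp) , λ x → ¬x (subst X back (X-sym S x))) ∷ []
      where
      open IsSym S
      back = ==ʳ-sound _ _ eq

    orbit-good : ∀ sts rs → All (All (IsSym us n ∘ proj₂)) sts → All Good rs → All Good (orbit sts rs)
    orbit-good [] rs _ gs = gs
    orbit-good (st ∷ sts) rs (S ∷ Ss) gs = orbit-good sts _ Ss
      (++⁺ gs (concat⁺ (map⁺ (All.map (λ {p} g → concat⁺ (map⁺ (All.map (λ {st} S → image-good p st S g) S))) gs))))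

    orbitU-good : ∀ r → Good r → All Good (orbitU C r)
    orbitU-good r g = concat⁺ (map⁺ (All.map (λ {p} (lp , ¬x) → map⁺ (All.tabulate λ {u} iu →
      length-⊞ p u lp (lenU iu) , λ x → ¬x (subst X
        (trans (cong (u ⊞_) (⊞-comm p u)) (⊞-cancel u p (trans (lenU iu) (sym lp)))) (X-translate iu x))))
      (orbit-good (syms C) (r ∷ []) symsOK (g ∷ []))))

    -- The invariant is that each row satisfying `X` has a translate in `t`. It survives the
    -- deletions because no deleted row satisfies `X`, and `X` is constant on cosets of `U`.
    loop-sound : ∀ rs t → loop (kill₁ C) (orbitU C) rs t ≡ true → All (λ r → length r ≡ n) rs →
                 (∀ a → X a → Hits t a) → ∀ a → ¬ X a
    loop-sound [] t h _ hits a x = let u , _ , i = hits a x in isEnd-sound t h (u ⊞ a) i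
    loop-sound (r ∷ rs) t h (l ∷ ls) hits = loop-sound rs (deletes (orbitU C r) t) (∧-splitʳ {kill₁ C r t} h) ls
      λ a x → let u , iu , i = hits a x in u , iu , deletes-sound (orbitU C r) t (u ⊞ a) i
          λ { p ip refl → proj₂ (All.lookup (orbitU-good r (l , X-kill r t (∧-splitˡ h) hits)) ip) (X-translate iu x) }

    search-sound : ∀ rs → search C rs ≡ true → All (λ r → length r ≡ n) rs → ∀ a → ¬ X a
    search-sound rs h ls = loop-sound rs _ (∧-splitʳ {triangular ps} h) ls hits
      where
      ps = eliminate 3 (basis C)
      hits : ∀ a → X a → Hits (grow (restrict ps (suc (a₃ C)) (t₀ C)) (a₃ C)) a
      -- The coset of `a` has a member with zero pivot bits, and `grow` retains all such rows that
      -- obey the cap 3.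
      hits a x = from (normalise n P (λ g (x , _) → X-length x) ps (∧-splitˡ h)
        (All.map (λ iw → lenU iw , λ g (x , u , iu , e) → X-translate iw x , _ , U-⊞ iw iu , trans (⊞-assoc _ u a) (cong (_ ⊞_) e))
          (eliminate-closed (_∈ᴸ us) (λ _ _ → U-⊞) 3 (basis C) basis⊆U))
        a (x , 𝟎 , 0∈U , trans (⊞-comm 𝟎 a) (⊞-𝟎 a (X-length x))))
        where
        P : Row → Set
        P g = X g × ∃[ u ] u ∈ᴸ us × u ⊞ a ≡ g
        from : ∃[ g ] P g × All (Cleared g) ps → Hits (grow (restrict ps (suc (a₃ C)) (t₀ C)) (a₃ C)) a
        from (g , (x , u , iu , refl) , cl) = u , iu ,
          grow-sound (restrict ps (suc (a₃ C)) (t₀ C)) (a₃ C) g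
            (trans (X-length x) (sym (trans (length-restrict ps (suc (a₃ C)) (t₀ C)) (proj₁ tab₀))))
            (subst₂ _∣_ (sym (weight-restrict ps (suc (a₃ C)) (t₀ C) g cl)) (sym a₃≡) (proj₂ tab₀ 3 g (X-cap x)))

  thin-sound : ∀ {a} → length a ≡ n → ¬ Cap us 2 a
  thin-sound {a} la c = barren-sound (t₀ C) (a₂ C) thin a (trans la (sym (proj₁ tab₀)))
    (subst (weight (t₀ C) a ∣_) (sym a₂≡) (proj₂ tab₀ 2 a c))

  Extensible : Row → Set
  Extensible a = ∃[ b ] ∃[ c ] ∃[ d ] Clique a b c d

  extensible-cap : ∀ {a} → Extensible a → Cap us 3 a
  extensible-cap {a} (_ , _ , _ , K) = subst (Cap us 3) (⊞-𝟎 a (Clique.la K)) (Clique.cap K true false false false (s≤s z≤n))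

  extensible-length : ∀ {a} → Extensible a → length a ≡ n
  extensible-length (_ , _ , _ , K) = Clique.la K

  extensible-translate : ∀ {u a} → u ∈ᴸ us → Extensible a → Extensible (u ⊞ a)
  extensible-translate iu (b , c , d , K) = b , c , d , translate iu K

  extensible-sym : ∀ {γ a} → IsSym us n γ → Extensible a → Extensible (γ · a)
  extensible-sym {γ} S (b , c , d , K) = γ · b , γ · c , γ · d , transform K S

  -- By symmetry each of `b`, `c`, `d` can head the clique, so each has a translate in `t`. Moving
  -- all three there leaves a clique with `r`.
  extensible-kill : ∀ r t → kill₁ C r t ≡ true → (∀ a → Extensible a → Hits t a) → ¬ Extensible r
  extensible-kill r t h hits (b , c , d , K) =
    let u , iu , i = hits b (r , c , d , swap₁₂ K)
        v , iv , j = hits c (r , b , d , swap₁₂ (swap₂₃ K))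
        w , iw , k = hits d (r , b , c , swap₁₂ (swap₂₃ (swap₃₄ K)))
        K₁ = swap₁₂ (translate iu (swap₁₂ K))
        K₂ = swap₂₃ (swap₁₂ (translate iv (swap₁₂ (swap₂₃ K₁))))
        K₃ = swap₃₄ (swap₂₃ (swap₁₂ (translate iw (swap₁₂ (swap₂₃ (swap₃₄ K₂))))))
    in kill₁-sound t h K₃ i j k

  no-clique : ∀ rs → search C rs ≡ true → All (λ r → length r ≡ n) rs → ∀ a b c d → ¬ Clique a b c d
  no-clique rs h ls a b c d K = search-sound rs h ls a (b , c , d , K)
    where open Loop Extensible extensible-length extensible-cap extensible-translate extensible-sym extensible-kill

-- The five configurations

elem : Row → List Row → Bool
elem a [] = false
elem a (b ∷ bs) = (a ==ʳ b) ∨ elem a bs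

elem-sound : ∀ a bs → elem a bs ≡ true → a ∈ᴸ bs
elem-sound a (b ∷ bs) h with ∨-split (a ==ʳ b) h
... | inj₁ e = here (==ʳ-sound a b e)
... | inj₂ e = there (elem-sound a bs e)

everyᴸ : {A : Set} → (A → Bool) → List A → Bool
everyᴸ f [] = true
everyᴸ f (x ∷ xs) = f x ∧ everyᴸ f xs

everyᴸ-sound : {A : Set} {P : A → Set} (f : A → Bool) → (∀ x → f x ≡ true → P x) → ∀ xs → everyᴸ f xs ≡ true → All P xs
everyᴸ-sound f s [] h = []
everyᴸ-sound f s (x ∷ xs) h = s x (∧-splitˡ h) ∷ everyᴸ-sound f s xs (∧-splitʳ {f x} h)

invertible : GL → Bool
invertible (gl x y) = not (isZ x) ∧ not (isZ y) ∧ not (x == y)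

act-⊹ : ∀ m x y → act m (x ⊹ y) ≡ act m x ⊹ act m y
act-⊹ (gl p q) x y = ==-sound _ _ (allF-sound (λ y → same p q x y) (allF-sound (λ x → allF (same p q x))
  (allF-sound (λ q → allF λ x → allF (same p q x)) (allF-sound (λ p → allF λ q → allF λ x → allF (same p q x)) refl p) q) x) y)
  where
  same : F → F → F → F → Bool
  same p q x y = act (gl p q) (x ⊹ y) == (act (gl p q) x ⊹ act (gl p q) y)

vanish-act : ∀ m → invertible m ≡ true → ∀ x → vanish (act m x) ≡ vanish x
vanish-act (gl p q) h e₀ = refl
vanish-act (gl e₁ q) h e₁ = refl
vanish-act (gl e₂ q) h e₁ = refl
vanish-act (gl e₃ q) h e₁ = refl
vanish-act (gl e₁ e₂) h e₂ = refl
vanish-act (gl e₁ e₃) h e₂ = refl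
vanish-act (gl e₂ e₁) h e₂ = refl
vanish-act (gl e₂ e₃) h e₂ = refl
vanish-act (gl e₃ e₁) h e₂ = refl
vanish-act (gl e₃ e₂) h e₂ = refl
vanish-act (gl e₁ e₂) h e₃ = refl
vanish-act (gl e₁ e₃) h e₃ = refl
vanish-act (gl e₂ e₁) h e₃ = refl
vanish-act (gl e₂ e₃) h e₃ = refl
vanish-act (gl e₃ e₁) h e₃ = refl
vanish-act (gl e₃ e₂) h e₃ = refl

length-insert : ∀ k (x : F) xs → length (insert k x xs) ≡ suc (length xs)
length-insert zero x xs = refl
length-insert (suc k) x [] = refl
length-insert (suc k) x (y ∷ xs) = cong suc (length-insert k x xs)

length-permute : ∀ ks (a : Row) → length (permute ks a) ≡ length a
length-permute [] a = refl
length-permute (k ∷ ks) [] = refl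
length-permute (k ∷ ks) (x ∷ a) = trans (length-insert k x _) (cong suc (length-permute ks a))

length-actRow : ∀ ms a → length (actRow ms a) ≡ length a
length-actRow [] a = refl
length-actRow (m ∷ ms) [] = refl
length-actRow (m ∷ ms) (x ∷ a) = cong suc (length-actRow ms a)

insert-⊞ : ∀ k x y a b → length a ≡ length b → insert k (x ⊹ y) (a ⊞ b) ≡ insert k x a ⊞ insert k y b
insert-⊞ zero x y a b h = refl
insert-⊞ (suc k) x y [] [] h = refl
insert-⊞ (suc k) x y (z ∷ a) (w ∷ b) h = cong (z ⊹ w ∷_) (insert-⊞ k x y a b (suc-injective h))

permute-⊞ : ∀ ks a b → length a ≡ length b → permute ks (a ⊞ b) ≡ permute ks a ⊞ permute ks b
permute-⊞ [] a b h = refl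
permute-⊞ (k ∷ ks) [] [] h = refl
permute-⊞ (k ∷ ks) (x ∷ a) (y ∷ b) h = trans (cong (insert k (x ⊹ y)) (permute-⊞ ks a b (suc-injective h)))
  (insert-⊞ k x y (permute ks a) (permute ks b)
    (trans (length-permute ks a) (trans (suc-injective h) (sym (length-permute ks b)))))

actRow-⊞ : ∀ ms a b → length a ≡ length b → actRow ms (a ⊞ b) ≡ actRow ms a ⊞ actRow ms b
actRow-⊞ [] a b h = refl
actRow-⊞ (m ∷ ms) [] [] h = refl
actRow-⊞ (m ∷ ms) (x ∷ a) (y ∷ b) h = cong₂ _∷_ (act-⊹ m x y) (actRow-⊞ ms a b (suc-injective h))

zeros-insert : ∀ k x a → zeros (insert k x a) ≡ vanish x + zeros a
zeros-insert zero x a = refl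
zeros-insert (suc k) x [] = refl
zeros-insert (suc k) x (y ∷ a) = trans (cong (vanish y +_) (zeros-insert k x a)) (+-swap (vanish y) (vanish x) (zeros a))

zeros-permute : ∀ ks a → zeros (permute ks a) ≡ zeros a
zeros-permute [] a = refl
zeros-permute (k ∷ ks) [] = refl
zeros-permute (k ∷ ks) (x ∷ a) = trans (zeros-insert k x (permute ks a)) (cong (vanish x +_) (zeros-permute ks a))

zeros-actRow : ∀ ms → everyᴸ invertible ms ≡ true → ∀ a → zeros (actRow ms a) ≡ zeros a
zeros-actRow [] h a = refl
zeros-actRow (m ∷ ms) h [] = refl
zeros-actRow (m ∷ ms) h (x ∷ a) = cong₂ _+_ (vanish-act m (∧-splitˡ h) x) (zeros-actRow ms (∧-splitʳ {invertible m} h) a)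

isSymᵇ : List Row → Sym → Bool
isSymᵇ us γ = everyᴸ invertible (proj₂ γ) ∧ every (λ u → elem u (map (γ ·_) us)) us

isSym-sound : ∀ us n γ → isSymᵇ us γ ≡ true → IsSym us n γ
isSym-sound us n γ@(ks , ms) h = record
  { ·-length = λ a → trans (length-actRow ms (permute ks a)) (length-permute ks a)
  ; ·-⊞ = λ a b la lb → trans (cong (actRow ms) (permute-⊞ ks a b (trans la (sym lb))))
      (actRow-⊞ ms (permute ks a) (permute ks b)
        (trans (length-permute ks a) (trans (trans la (sym lb)) (sym (length-permute ks b)))))
  ; ·-zeros = λ a → trans (zeros-actRow ms (∧-splitˡ h) (permute ks a)) (zeros-permute ks a)
  ; ·-onto = onto
  }
  where
  onto : ∀ {u} → u ∈ᴸ us → ∃[ v ] v ∈ᴸ us × γ · v ≡ u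
  onto {u} iu =
    let v , iv , e = ∈-map⁻ (γ ·_) (elem-sound u (map (γ ·_) us) (every-sound (λ u → elem u (map (γ ·_) us)) us (∧-splitʳ {everyᴸ invertible ms} h) iu))
    in v , iv , sym e

length-chunks : ∀ ps n → All (λ qs → length qs ≡ 8) (chunks ps n)
length-chunks (p₁ ∷ p₂ ∷ p₃ ∷ p₄ ∷ p₅ ∷ p₆ ∷ p₇ ∷ p₈ ∷ ps) (suc n) = refl ∷ length-chunks ps n
length-chunks (p₁ ∷ p₂ ∷ p₃ ∷ p₄ ∷ p₅ ∷ p₆ ∷ p₇ ∷ p₈ ∷ ps) zero = []
length-chunks [] n = []
length-chunks (_ ∷ []) n = []
length-chunks (_ ∷ _ ∷ []) n = []
length-chunks (_ ∷ _ ∷ _ ∷ []) n = []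
length-chunks (_ ∷ _ ∷ _ ∷ _ ∷ []) n = []
length-chunks (_ ∷ _ ∷ _ ∷ _ ∷ _ ∷ []) n = []
length-chunks (_ ∷ _ ∷ _ ∷ _ ∷ _ ∷ _ ∷ []) n = []
length-chunks (_ ∷ _ ∷ _ ∷ _ ∷ _ ∷ _ ∷ _ ∷ []) n = []

table-isTable : ∀ n ps u us → length ps ≡ length (u ∷ us) → All (λ u → length u ≡ n) (u ∷ us) →
                IsTable (u ∷ us) n (table ps (u ∷ us)) (λ k → bound k ps)
table-isTable n (p ∷ ps) u us h ls = length-table p ps u us (suc-injective h) ls ,
  λ k a c → table-sound k p ps u us a (suc-injective h) ls c

tables-sound : ∀ n u us k ks ps pss → All (λ u → length u ≡ n) (u ∷ us) →
               All (λ ps → length ps ≡ length (u ∷ us)) (ps ∷ pss) → length pss ≡ length ks →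
               Tables (u ∷ us) n (map (λ ps → table ps (u ∷ us)) (ps ∷ pss)) (k ∷ ks) (bounds (k ∷ ks) (ps ∷ pss))
tables-sound n u us k [] ps [] ls (h ∷ []) e = [ table-isTable n ps u us h ls ]
tables-sound n u us k (k′ ∷ ks) ps (ps′ ∷ pss) ls (h ∷ hs) e =
  table-isTable n ps u us h ls ∷ tables-sound n u us k′ ks ps′ pss ls hs (suc-injective e)

validᵇ : ℕ → Row → Row → Row → List (List (Sym × Sym)) → List Row → Bool
validᵇ n u v w sy us = everyᴸ (λ a → length a ≡ᵇ n) us ∧ every (λ a → every (λ b → elem (a ⊞ b) us) us) us ∧
  everyᴸ (λ a → elem a us) (u ∷ v ∷ w ∷ []) ∧ everyᴸ (everyᴸ (isSymᵇ us ∘ proj₂)) sy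

valid : ∀ n pss u v w sy → All (λ ps → length ps ≡ 8) pss → length pss ≡ 16 → 4 < n → length u ≡ n →
        barren (t₀ (context pss u v w sy)) (a₂ (context pss u v w sy)) ≡ true →
        validᵇ n u v w sy (sums (zeroRow u) (u ∷ v ∷ w ∷ [])) ≡ true → Valid (context pss u v w sy) n
valid n pss@(ps₀ ∷ ps₁ ∷ pss′) u v w sy hs@(h₀ ∷ h₁ ∷ _) hl 4<n lu th h = record
  { 4<n = 4<n
  ; lenU = All.lookup ls
  ; 0∈U = here (sym (zeroRow-replicate u lu))
  ; U-⊞ = λ {a} {b} ia ib → elem-sound (a ⊞ b) us
      (every-sound (λ b → elem (a ⊞ b) us) us (every-sound (λ a → every (λ b → elem (a ⊞ b) us) us) us (∧-splitˡ h₂) ia) ib)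
  ; basis⊆U = everyᴸ-sound (λ a → elem a us) (λ a → elem-sound a us) (u ∷ v ∷ w ∷ []) (∧-splitˡ h₃)
  ; b₀ = λ k → bound k ps₀ ; b₁ = λ k → bound k ps₁
  ; tab₀ = table-isTable n ps₀ _ _ h₀ ls
  ; tab₁ = table-isTable n ps₁ _ _ h₁ ls
  ; a₂≡ = refl ; a₃≡ = refl ; a₄≡ = refl ; a₅≡ = refl ; a₆≡ = refl ; a₄₅≡ = refl
  ; thin = th
  ; extTabs = tables-sound n _ _ _ _ ps₀ (ps₁ ∷ pss′) ls hs (suc-injective hl)
  ; symsOK = everyᴸ-sound _ (everyᴸ-sound _ (λ x → isSym-sound us n (proj₂ x))) sy (∧-splitʳ {everyᴸ (λ a → elem a us) (u ∷ v ∷ w ∷ [])} h₃)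
  }
  where
  us = sums (zeroRow u) (u ∷ v ∷ w ∷ [])
  ls : All (λ u → length u ≡ n) us
  ls = everyᴸ-sound (λ a → length a ≡ᵇ n) (λ a e → ≡ᵇ⇒≡ (length a) n (subst T (sym e) tt)) us (∧-splitˡ h)
  h₂ = ∧-splitʳ {everyᴸ (λ a → length a ≡ᵇ n) us} h
  h₃ = ∧-splitʳ {every (λ a → every (λ b → elem (a ⊞ b) us) us) us} h₂

-- Certificates for the five searches

digits : ℕ → ℕ → ℕ → List ℕ
digits zero b c = []
digits (suc n) b c = c % suc b ∷ digits n b (c / suc b)

toGL : ℕ → GL
toGL 0 = gl e₁ e₂
toGL 1 = gl e₁ e₃
toGL 2 = gl e₂ e₁
toGL 3 = gl e₂ e₃
toGL 4 = gl e₃ e₁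
toGL _ = gl e₃ e₂

-- A permutation of the eleven columns, coded in base 11 by its insertion positions, and an element
-- of GL(2,2) for each column, coded in base 6.
toSym : ℕ → ℕ → Sym
toSym p m = digits 11 10 p , map toGL (digits 11 5 m)

primes : List ℕ
primes = 2 ∷ 3 ∷ 5 ∷ 7 ∷ 11 ∷ 13 ∷ 17 ∷ 19 ∷ 23 ∷ 29 ∷ 31 ∷ 37 ∷ 41 ∷ 43 ∷ 47 ∷ 53 ∷ 59 ∷ 61 ∷ 67 ∷ 71 ∷ 73 ∷ 79 ∷ 83 ∷ 89 ∷ 97 ∷ 101 ∷ 103 ∷ 107 ∷
  109 ∷ 113 ∷ 127 ∷ 131 ∷ 137 ∷ 139 ∷ 149 ∷ 151 ∷ 157 ∷ 163 ∷ 167 ∷ 173 ∷ 179 ∷ 181 ∷ 191 ∷ 193 ∷ 197 ∷ 199 ∷ 211 ∷ 223 ∷ 227 ∷ 229 ∷ 233 ∷ 239 ∷ 241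
  ∷ 251 ∷ 257 ∷ 263 ∷ 269 ∷ 271 ∷ 277 ∷ 281 ∷ 283 ∷ 293 ∷ 307 ∷ 311 ∷ 313 ∷ 317 ∷ 331 ∷ 337 ∷ 347 ∷ 349 ∷ 353 ∷ 359 ∷ 367 ∷ 373 ∷ 379 ∷ 383 ∷ 389 ∷
  397 ∷ 401 ∷ 409 ∷ 419 ∷ 421 ∷ 431 ∷ 433 ∷ 439 ∷ 443 ∷ 449 ∷ 457 ∷ 461 ∷ 463 ∷ 467 ∷ 479 ∷ 487 ∷ 491 ∷ 499 ∷ 503 ∷ 509 ∷ 521 ∷ 523 ∷ 541 ∷ 547 ∷ 557
  ∷ 563 ∷ 569 ∷ 571 ∷ 577 ∷ 587 ∷ 593 ∷ 599 ∷ 601 ∷ 607 ∷ 613 ∷ 617 ∷ 619 ∷ 631 ∷ 641 ∷ 643 ∷ 647 ∷ 653 ∷ 659 ∷ 661 ∷ 673 ∷ 677 ∷ 683 ∷ 691 ∷ 701 ∷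
  709 ∷ 719 ∷ []

-- The first four stages exchange two columns of equal kind, which fixes every row of `U`. The last
-- one lists the symmetries that move points of `U`: the stabiliser of a line in GL(3,2) has order
-- 24, leaving 23 besides the identity. The other configurations follow the same plan, with
-- stabilisers of order 6, 4, 8 and 6.
syms-coll : List (List (Sym × Sym))
syms-coll = ((toSym 1331 0 , toSym 1331 0) ∷ []) ∷ ((toSym 161051 0 , toSym 161051 0) ∷ []) ∷ ((toSym 19487171 0 , toSym 19487171 0) ∷ []) ∷ ((toSym
  2357947691 0 , toSym 2357947691 0) ∷ []) ∷ ((toSym 467724048 288166074 , toSym 467724048 288166074) ∷ (toSym 7794336 70598341 , toSym 7794336
  70598341) ∷ (toSym 475518384 286207999 , toSym 475518384 286207999) ∷ (toSym 467692115 362790792 , toSym 467692115 362790792) ∷ (toSym 31955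
  143216682 , toSym 31955 143216682) ∷ (toSym 475486451 213762061 , toSym 7826291 360776815) ∷ (toSym 7826291 360776815 , toSym 475486451 213762061) ∷
  (toSym 3865225 352722384 , toSym 3865225 352722384) ∷ (toSym 7762393 284138106 , toSym 467755993 74626309) ∷ (toSym 467755993 74626309 , toSym
  7762393 284138106) ∷ (toSym 471653161 74573359 , toSym 471653161 74573359) ∷ (toSym 471557340 10074456 , toSym 7730450 352997568) ∷ (toSym 475454508
  147026922 , toSym 467787938 219580207) ∷ (toSym 63900 217572301 , toSym 3897170 284413290) ∷ (toSym 3961068 8060479 , toSym 471621218 219633157) ∷
  (toSym 7730450 352997568 , toSym 471557340 10074456) ∷ (toSym 3897170 284413290 , toSym 63900 217572301) ∷ (toSym 471621218 219633157 , toSym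
  3961068 8060479) ∷ (toSym 467787938 219580207 , toSym 475454508 147026922) ∷ (toSym 475422565 9805320 , toSym 475422565 9805320) ∷ (toSym 471589285
  147187194 , toSym 95845 145229119) ∷ (toSym 3929125 80403661 , toSym 3929125 80403661) ∷ (toSym 95845 145229119 , toSym 471589285 147187194) ∷ []) ∷
  []
ctx-coll : Ctx
ctx-coll = context (chunks primes 16) (e₀ ∷ e₁ ∷ e₁ ∷ e₁ ∷ e₁ ∷ e₂ ∷ e₂ ∷ e₁ ∷ e₁ ∷ e₃ ∷ e₃ ∷ []) (e₁ ∷ e₀ ∷ e₁ ∷ e₂ ∷ e₂ ∷ e₁ ∷ e₁ ∷ e₂ ∷ e₂ ∷ e₁ ∷
  e₁ ∷ []) (e₂ ∷ e₂ ∷ e₂ ∷ e₀ ∷ e₀ ∷ e₂ ∷ e₂ ∷ e₂ ∷ e₂ ∷ e₂ ∷ e₂ ∷ []) syms-coll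
-- Rows in base four, the first column being the lowest digit. That they represent all orbits is
-- checked by the search, whose trie must end up empty.
reps-coll : List ℕ
reps-coll = 281001 ∷ 281306 ∷ 281333 ∷ 39350 ∷ 44446 ∷ 44453 ∷ 44505 ∷ 290009 ∷ 290189 ∷ 39289 ∷ 40282 ∷ 48477 ∷ []

valid-coll : Valid ctx-coll 11
valid-coll = valid 11 (chunks primes 16) _ _ _ syms-coll (length-chunks primes 16) refl (s≤s (s≤s (s≤s (s≤s (s≤s z≤n))))) refl refl refl

syms-tri : List (List (Sym × Sym))
syms-tri = ((toSym 121 0 , toSym 121 0) ∷ []) ∷ ((toSym 161051 0 , toSym 161051 0) ∷ []) ∷ ((toSym 19487171 0 , toSym 19487171 0) ∷ []) ∷ ((toSym
  2357947691 0 , toSym 2357947691 0) ∷ []) ∷ ((toSym 4389 141197114 , toSym 4389 141197114) ∷ (toSym 3865225 352721952 , toSym 3865225 352721952) ∷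
  (toSym 7294 215553828 , toSym 3869584 282284870) ∷ (toSym 3869584 282284870 , toSym 7294 215553828) ∷ (toSym 3872499 74466086 , toSym 3872499
  74466086) ∷ []) ∷ []
ctx-tri : Ctx
ctx-tri = context (chunks primes 16) (e₀ ∷ e₁ ∷ e₁ ∷ e₁ ∷ e₁ ∷ e₂ ∷ e₂ ∷ e₁ ∷ e₁ ∷ e₃ ∷ e₃ ∷ []) (e₁ ∷ e₀ ∷ e₁ ∷ e₁ ∷ e₂ ∷ e₁ ∷ e₁ ∷ e₂ ∷ e₂ ∷ e₁ ∷ e₁
  ∷ []) (e₂ ∷ e₂ ∷ e₂ ∷ e₂ ∷ e₀ ∷ e₂ ∷ e₂ ∷ e₂ ∷ e₂ ∷ e₂ ∷ e₂ ∷ []) syms-tri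
reps-tri : List ℕ
reps-tri = 281269 ∷ 281961 ∷ 282214 ∷ 289973 ∷ 290225 ∷ 298343 ∷ 298854 ∷ 313959 ∷ 44413 ∷ 268725 ∷ 269174 ∷ 269670 ∷ 273773 ∷ 274278 ∷ 281465 ∷
  289341 ∷ 289593 ∷ 289917 ∷ 290089 ∷ 297909 ∷ 305975 ∷ 305981 ∷ 306463 ∷ 306613 ∷ 322663 ∷ 322669 ∷ 323174 ∷ 323180 ∷ 39413 ∷ 40310 ∷ 55673 ∷ 55926 ∷
  60029 ∷ 60281 ∷ 191607 ∷ 273277 ∷ 273333 ∷ 44021 ∷ 273829 ∷ 274270 ∷ 191865 ∷ 175605 ∷ 176116 ∷ []

valid-tri : Valid ctx-tri 11
valid-tri = valid 11 (chunks primes 16) _ _ _ syms-tri (length-chunks primes 16) refl (s≤s (s≤s (s≤s (s≤s (s≤s z≤n))))) refl refl refl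

syms-mixed : List (List (Sym × Sym))
syms-mixed = ((toSym 11 0 , toSym 11 0) ∷ []) ∷ ((toSym 1331 0 , toSym 1331 0) ∷ []) ∷ ((toSym 161051 0 , toSym 161051 0) ∷ []) ∷ ((toSym 19487171 0 ,
  toSym 19487171 0) ∷ []) ∷ ((toSym 2357947691 0 , toSym 2357947691 0) ∷ []) ∷ ((toSym 467724048 288166075 , toSym 467724048 288166075) ∷ (toSym
  7794336 70598346 , toSym 7794336 70598346) ∷ (toSym 475518384 286207993 , toSym 475518384 286207993) ∷ []) ∷ []
ctx-mixed : Ctx
ctx-mixed = context (chunks primes 16) (e₁ ∷ e₁ ∷ e₁ ∷ e₁ ∷ e₁ ∷ e₂ ∷ e₂ ∷ e₁ ∷ e₁ ∷ e₃ ∷ e₃ ∷ []) (e₀ ∷ e₁ ∷ e₁ ∷ e₂ ∷ e₂ ∷ e₁ ∷ e₁ ∷ e₂ ∷ e₂ ∷ e₁ ∷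
  e₁ ∷ []) (e₂ ∷ e₂ ∷ e₂ ∷ e₀ ∷ e₀ ∷ e₂ ∷ e₂ ∷ e₂ ∷ e₂ ∷ e₂ ∷ e₂ ∷ []) syms-mixed
reps-mixed : List ℕ
reps-mixed = 298457 ∷ 298458 ∷ 314073 ∷ 317661 ∷ 317662 ∷ 318553 ∷ 183005 ∷ 183006 ∷ 183705 ∷ 183706 ∷ 191645 ∷ 191647 ∷ 191878 ∷ 191879 ∷ 297709 ∷
  317613 ∷ 322774 ∷ 167389 ∷ 167390 ∷ 183766 ∷ 298409 ∷ 306630 ∷ 306668 ∷ 576214 ∷ 576215 ∷ 579974 ∷ 580012 ∷ 969414 ∷ 969452 ∷ 167341 ∷ 171341 ∷
  171342 ∷ 182957 ∷ 191228 ∷ 166653 ∷ 171133 ∷ 175612 ∷ 175613 ∷ 179526 ∷ 179564 ∷ []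

valid-mixed : Valid ctx-mixed 11
valid-mixed = valid 11 (chunks primes 16) _ _ _ syms-mixed (length-chunks primes 16) refl (s≤s (s≤s (s≤s (s≤s (s≤s z≤n))))) refl refl refl

-- `toSym 0 1` exchanges `e₂` and `e₃` in the first column, that of the line vanishing on a plane:
-- on `U` this column takes only the values `e₀` and `e₁`.
syms-in : List (List (Sym × Sym))
syms-in = ((toSym 1331 0 , toSym 1331 0) ∷ []) ∷ ((toSym 161051 0 , toSym 161051 0) ∷ []) ∷ ((toSym 19487171 0 , toSym 19487171 0) ∷ []) ∷ ((toSym
  2357947691 0 , toSym 2357947691 0) ∷ []) ∷ ((toSym 0 1 , toSym 0 1) ∷ []) ∷ ((toSym 467724048 288166074 , toSym 467724048 288166074) ∷ (toSym
  7794336 70598340 , toSym 7794336 70598340) ∷ (toSym 475518384 286207998 , toSym 475518384 286207998) ∷ (toSym 467692115 362790792 , toSym 467692115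
  362790792) ∷ (toSym 31955 143216682 , toSym 31955 143216682) ∷ (toSym 475486451 213762060 , toSym 7826291 360776814) ∷ (toSym 7826291 360776814 ,
  toSym 475486451 213762060) ∷ []) ∷ []
ctx-in : Ctx
ctx-in = context (chunks primes 16) (e₀ ∷ e₁ ∷ e₁ ∷ e₁ ∷ e₁ ∷ e₂ ∷ e₂ ∷ e₁ ∷ e₁ ∷ e₃ ∷ e₃ ∷ []) (e₀ ∷ e₀ ∷ e₁ ∷ e₂ ∷ e₂ ∷ e₁ ∷ e₁ ∷ e₂ ∷ e₂ ∷ e₁ ∷ e₁
  ∷ []) (e₁ ∷ e₂ ∷ e₂ ∷ e₀ ∷ e₀ ∷ e₂ ∷ e₂ ∷ e₂ ∷ e₂ ∷ e₂ ∷ e₂ ∷ []) syms-in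
reps-in : List ℕ
reps-in = 281002 ∷ 281306 ∷ 281334 ∷ 282022 ∷ 282074 ∷ 289950 ∷ 289958 ∷ 290010 ∷ 290190 ∷ 298454 ∷ 298458 ∷ 298470 ∷ 298474 ∷ 317606 ∷ 39350 ∷ 44446
  ∷ 44454 ∷ 44506 ∷ 44534 ∷ 44758 ∷ 182682 ∷ 182694 ∷ 182746 ∷ 182998 ∷ 183702 ∷ 183706 ∷ 183718 ∷ 183722 ∷ 191882 ∷ 297702 ∷ 297718 ∷ 306634 ∷ 306658
  ∷ 314070 ∷ 314074 ∷ 318550 ∷ 318554 ∷ 39290 ∷ 40282 ∷ 40310 ∷ 43766 ∷ 166326 ∷ 167382 ∷ 182950 ∷ 183002 ∷ 183030 ∷ 183770 ∷ 191886 ∷ 191898 ∷ 298406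
  ∷ 969442 ∷ 48478 ∷ 48486 ∷ 167334 ∷ 167350 ∷ 167386 ∷ 167414 ∷ 171334 ∷ 969418 ∷ 969422 ∷ 166646 ∷ 171126 ∷ 171338 ∷ 171382 ∷ 179530 ∷ 179554 ∷
  179558 ∷ []

valid-in : Valid ctx-in 11
valid-in = valid 11 (chunks primes 16) _ _ _ syms-in (length-chunks primes 16) refl (s≤s (s≤s (s≤s (s≤s (s≤s z≤n))))) refl refl refl

syms-out : List (List (Sym × Sym))
syms-out = ((toSym 161051 0 , toSym 161051 0) ∷ []) ∷ ((toSym 19487171 0 , toSym 19487171 0) ∷ []) ∷ ((toSym 2357947691 0 , toSym 2357947691 0) ∷ [])
  ∷ ((toSym 0 1 , toSym 0 1) ∷ []) ∷ ((toSym 467692225 362790576 , toSym 467692225 362790576) ∷ (toSym 3865235 352721952 , toSym 3865235 352721952) ∷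
  (toSym 471557460 10073808 , toSym 7730470 352996704) ∷ (toSym 7730470 352996704 , toSym 471557460 10073808) ∷ (toSym 475422695 9804240 , toSym
  475422695 9804240) ∷ []) ∷ []
ctx-out : Ctx
ctx-out = context (chunks primes 16) (e₀ ∷ e₀ ∷ e₁ ∷ e₁ ∷ e₁ ∷ e₂ ∷ e₂ ∷ e₁ ∷ e₁ ∷ e₃ ∷ e₃ ∷ []) (e₀ ∷ e₁ ∷ e₀ ∷ e₁ ∷ e₂ ∷ e₁ ∷ e₁ ∷ e₂ ∷ e₂ ∷ e₁ ∷ e₁
  ∷ []) (e₁ ∷ e₂ ∷ e₂ ∷ e₂ ∷ e₀ ∷ e₂ ∷ e₂ ∷ e₂ ∷ e₂ ∷ e₂ ∷ e₂ ∷ []) syms-out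
reps-out : List ℕ
reps-out = 280998 ∷ 281194 ∷ 281238 ∷ 281242 ∷ 281254 ∷ 281302 ∷ 281446 ∷ 281450 ∷ 281558 ∷ 281574 ∷ 281958 ∷ 282006 ∷ 282022 ∷ 289894 ∷ 289910 ∷
  289914 ∷ 289942 ∷ 290006 ∷ 290010 ∷ 290038 ∷ 290086 ∷ 290090 ∷ 290102 ∷ 290182 ∷ 290186 ∷ 290214 ∷ 290246 ∷ 297326 ∷ 297366 ∷ 297374 ∷ 297630 ∷
  297818 ∷ 297822 ∷ 297838 ∷ 297878 ∷ 297942 ∷ 297950 ∷ 297958 ∷ 306270 ∷ 306390 ∷ 306458 ∷ 306462 ∷ 306470 ∷ 306486 ∷ 306582 ∷ 306610 ∷ 313950 ∷
  314006 ∷ 318570 ∷ 319122 ∷ 559478 ∷ 39382 ∷ 39386 ∷ 39398 ∷ 39642 ∷ 40282 ∷ 40298 ∷ 44390 ∷ 44406 ∷ 44410 ∷ 44438 ∷ 44502 ∷ 44506 ∷ 44534 ∷ 44634 ∷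
  44666 ∷ 44694 ∷ 44890 ∷ 44902 ∷ 45018 ∷ 55654 ∷ 55658 ∷ 55898 ∷ 55914 ∷ 60774 ∷ 60778 ∷ 60790 ∷ 60826 ∷ 60838 ∷ 61018 ∷ 61046 ∷ 61050 ∷ 61082 ∷
  61290 ∷ 191582 ∷ 191710 ∷ 191790 ∷ 191818 ∷ 191822 ∷ 191846 ∷ 191854 ∷ 191862 ∷ 318554 ∷ 318558 ∷ 318630 ∷ 564318 ∷ 564538 ∷ 564570 ∷ 43510 ∷ 43734
  ∷ 48474 ∷ 48502 ∷ 59878 ∷ 60006 ∷ 60022 ∷ 60026 ∷ 60054 ∷ 60118 ∷ 60122 ∷ 60150 ∷ 60262 ∷ 60378 ∷ 60390 ∷ 179294 ∷ 179514 ∷ 179546 ∷ []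

valid-out : Valid ctx-out 11
valid-out = valid 11 (chunks primes 16) _ _ _ syms-out (length-chunks primes 16) refl (s≤s (s≤s (s≤s (s≤s (s≤s z≤n))))) refl refl refl

search-coll : search ctx-coll (decodes reps-coll) ≡ true
search-coll = refl

search-tri : search ctx-tri (decodes reps-tri) ≡ true
search-tri = refl

search-mixed : search ctx-mixed (decodes reps-mixed) ≡ true
search-mixed = refl

search-in : search ctx-in (decodes reps-in) ≡ true
search-in = refl

search-out : search ctx-out (decodes reps-out) ≡ true
search-out = refl

-- Counting vectors

sumOver : ∀ {n} → (F₂^ n → ℕ) → ℕ
sumOver {zero} f = f []
sumOver {suc n} f = sumOver (λ a → f (false ∷ a)) + sumOver (λ a → f (true ∷ a))

sumOver-cong : ∀ {n} (f g : F₂^ n → ℕ) → (∀ a → f a ≡ g a) → sumOver f ≡ sumOver g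
sumOver-cong {zero} f g h = h []
sumOver-cong {suc n} f g h = cong₂ _+_ (sumOver-cong _ _ λ a → h (false ∷ a)) (sumOver-cong _ _ λ a → h (true ∷ a))

sumOver-mono : ∀ {n} (f g : F₂^ n → ℕ) → (∀ a → f a ≤ g a) → sumOver f ≤ sumOver g
sumOver-mono {zero} f g h = h []
sumOver-mono {suc n} f g h = +-mono-≤ (sumOver-mono _ _ λ a → h (false ∷ a)) (sumOver-mono _ _ λ a → h (true ∷ a))

+-interchange : ∀ a b c d → (a + b) + (c + d) ≡ (a + c) + (b + d)
+-interchange a b c d = trans (+-assoc a b (c + d)) (trans (cong (a +_) (+-swap b c d)) (sym (+-assoc a c (b + d))))

sumOver-+ : ∀ {n} (f g : F₂^ n → ℕ) → sumOver (λ a → f a + g a) ≡ sumOver f + sumOver g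
sumOver-+ {zero} f g = refl
sumOver-+ {suc n} f g = trans (cong₂ _+_ (sumOver-+ (f ∘ (false ∷_)) (g ∘ (false ∷_))) (sumOver-+ (f ∘ (true ∷_)) (g ∘ (true ∷_))))
  (+-interchange (sumOver (f ∘ (false ∷_))) _ _ _)

sumOver-* : ∀ {n} k (f : F₂^ n → ℕ) → sumOver (λ a → k * f a) ≡ k * sumOver f
sumOver-* {zero} k f = refl
sumOver-* {suc n} k f = trans (cong₂ _+_ (sumOver-* k (f ∘ (false ∷_))) (sumOver-* k (f ∘ (true ∷_))))
  (sym (*-distribˡ-+ k (sumOver (f ∘ (false ∷_))) _))

sumOver-const : ∀ n k → sumOver {n} (λ _ → k) ≡ k * 2 ^ n
sumOver-const zero k = sym (*-identityʳ k)
sumOver-const (suc n) k = trans (cong₂ _+_ (sumOver-const n k) (sumOver-const n k))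
  (trans (sym (*-distribˡ-+ k (2 ^ n) (2 ^ n))) (cong (λ m → k * (2 ^ n + m)) (sym (+-identityʳ (2 ^ n)))))

sumOver-shift : ∀ {n} b (f : F₂^ n → ℕ) → sumOver (λ a → f (b ⊕ a)) ≡ sumOver f
sumOver-shift [] f = refl
sumOver-shift (false ∷ b) f = cong₂ _+_ (sumOver-shift b (f ∘ (false ∷_))) (sumOver-shift b (f ∘ (true ∷_)))
sumOver-shift (true ∷ b) f = trans (cong₂ _+_ (sumOver-shift b (f ∘ (true ∷_))) (sumOver-shift b (f ∘ (false ∷_))))
  (+-comm (sumOver (f ∘ (true ∷_))) _)

eqV : ∀ {n} → F₂^ n → F₂^ n → Bool
eqV [] [] = true
eqV (x ∷ a) (y ∷ b) = not (x xor y) ∧ eqV a b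

eqV-sound : ∀ {n} (a b : F₂^ n) → eqV a b ≡ true → a ≡ b
eqV-sound [] [] _ = refl
eqV-sound (x ∷ a) (y ∷ b) h = cong₂ _∷_ (xnor-sound x y (∧-splitˡ h)) (eqV-sound a b (∧-splitʳ {not (x xor y)} h))

eqV-refl : ∀ {n} (a : F₂^ n) → eqV a a ≡ true
eqV-refl [] = refl
eqV-refl (false ∷ a) = eqV-refl a
eqV-refl (true ∷ a) = eqV-refl a

sumOver-eqV : ∀ {n} (x : F₂^ n) → sumOver (λ a → # (eqV x a)) ≡ 1
sumOver-eqV [] = refl
sumOver-eqV {suc n} (false ∷ x) = cong₂ _+_ (sumOver-eqV x) (sumOver-const n 0)
sumOver-eqV {suc n} (true ∷ x) = cong₂ _+_ (sumOver-const n 0) (sumOver-eqV x)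

count : ∀ {n} → (F₂^ n → Bool) → ℕ
count P = sumOver (# ∘ P)

find : ∀ {n} {P : F₂^ n → Set} → (∀ a → Dec (P a)) → ∃ P ⊎ (∀ a → ¬ P a)
find {zero} P? with P? []
... | yes p = inj₁ ([] , p)
... | no ¬p = inj₂ λ { [] → ¬p }
find {suc n} P? with find (P? ∘ (false ∷_)) | find (P? ∘ (true ∷_))
... | inj₁ (a , p) | _ = inj₁ (false ∷ a , p)
... | inj₂ _ | inj₁ (a , p) = inj₁ (true ∷ a , p)
... | inj₂ f | inj₂ t = inj₂ λ { (false ∷ a) → f a ; (true ∷ a) → t a }

hits : ∀ {n} → List (F₂^ n) → F₂^ n → ℕ
hits [] a = 0
hits (x ∷ xs) a = # (eqV x a) + hits xs a

sumOver-hits : ∀ {n} (xs : List (F₂^ n)) → sumOver (hits xs) ≡ length xs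
sumOver-hits {n} [] = sumOver-const n 0
sumOver-hits (x ∷ xs) = trans (sumOver-+ _ (hits xs)) (cong₂ _+_ (sumOver-eqV x) (sumOver-hits xs))

∈-hits : ∀ {n} {a : F₂^ n} xs → a ∈ᴸ xs → 1 ≤ hits xs a
∈-hits {a = a} (_ ∷ xs) (here refl) rewrite eqV-refl a = s≤s z≤n
∈-hits (x ∷ xs) (there i) = ≤-trans (∈-hits xs i) (m≤n+m _ _)

escape : ∀ {n} (P : F₂^ n → Bool) xs → length xs < count P → ∃[ a ] P a ≡ true × ¬ a ∈ᴸ xs
escape P xs h with find (λ a → (P a ≟ true) ×-dec ¬? (Membership._∈?_ (≡-dec _≟_) a xs))
... | inj₁ r = r
... | inj₂ none = ⊥-elim (<⇒≱ h (subst (count P ≤_) (sumOver-hits xs) (sumOver-mono _ _ bounded)))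
  where
  bounded : ∀ a → # (P a) ≤ hits xs a
  bounded a with P a in e
  ... | false = z≤n
  ... | true = ∈-hits xs (decidable-stable (Membership._∈?_ (≡-dec _≟_) a xs) λ a∉ → none a (e , a∉))

xor-interchange : ∀ a b c d → (a xor b) xor (c xor d) ≡ (a xor c) xor (b xor d)
xor-interchange false false c d = refl
xor-interchange false true false d = refl
xor-interchange false true true false = refl
xor-interchange false true true true = refl
xor-interchange true false false d = refl
xor-interchange true false true false = refl
xor-interchange true false true true = refl
xor-interchange true true false false = refl
xor-interchange true true false true = refl
xor-interchange true true true false = refl
xor-interchange true true true true = refl

∧-xorˡ : ∀ a b x → (a xor b) ∧ x ≡ (a ∧ x) xor (b ∧ x)
∧-xorˡ false b x = refl
∧-xorˡ true false false = refl
∧-xorˡ true false true = refl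
∧-xorˡ true true false = refl
∧-xorˡ true true true = refl

∧-xorʳ : ∀ a x y → a ∧ (x xor y) ≡ (a ∧ x) xor (a ∧ y)
∧-xorʳ false x y = refl
∧-xorʳ true x y = refl

dot-⊕ˡ : ∀ {n} (a b x : F₂^ n) → dot (a ⊕ b) x ≡ dot a x xor dot b x
dot-⊕ˡ [] [] [] = refl
dot-⊕ˡ (p ∷ a) (q ∷ b) (y ∷ x) = trans (cong₂ _xor_ (∧-xorˡ p q y) (dot-⊕ˡ a b x)) (xor-interchange (p ∧ y) (q ∧ y) _ _)

dot-⊕ʳ : ∀ {n} (a x y : F₂^ n) → dot a (x ⊕ y) ≡ dot a x xor dot a y
dot-⊕ʳ [] [] [] = refl
dot-⊕ʳ (p ∷ a) (x ∷ xs) (y ∷ ys) = trans (cong₂ _xor_ (∧-xorʳ p x y) (dot-⊕ʳ a xs ys)) (xor-interchange (p ∧ x) (p ∧ y) _ _)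

dot-0ʳ : ∀ {n} (a : F₂^ n) → dot a 0v ≡ false
dot-0ʳ [] = refl
dot-0ʳ (false ∷ a) = dot-0ʳ a
dot-0ʳ (true ∷ a) = dot-0ʳ a

⊕-assoc : ∀ {n} (a b c : F₂^ n) → (a ⊕ b) ⊕ c ≡ a ⊕ (b ⊕ c)
⊕-assoc [] [] [] = refl
⊕-assoc (false ∷ a) (y ∷ b) (z ∷ c) = cong (_ ∷_) (⊕-assoc a b c)
⊕-assoc (true ∷ a) (false ∷ b) (z ∷ c) = cong (_ ∷_) (⊕-assoc a b c)
⊕-assoc (true ∷ a) (true ∷ b) (false ∷ c) = cong (_ ∷_) (⊕-assoc a b c)
⊕-assoc (true ∷ a) (true ∷ b) (true ∷ c) = cong (_ ∷_) (⊕-assoc a b c)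

⊕-identityˡ : ∀ {n} (a : F₂^ n) → 0v ⊕ a ≡ a
⊕-identityˡ [] = refl
⊕-identityˡ (x ∷ a) = cong (x ∷_) (⊕-identityˡ a)

⊕-identityʳ : ∀ {n} (a : F₂^ n) → a ⊕ 0v ≡ a
⊕-identityʳ [] = refl
⊕-identityʳ (false ∷ a) = cong (false ∷_) (⊕-identityʳ a)
⊕-identityʳ (true ∷ a) = cong (true ∷_) (⊕-identityʳ a)

⊕-self : ∀ {n} (a : F₂^ n) → a ⊕ a ≡ 0v
⊕-self [] = refl
⊕-self (false ∷ a) = cong (false ∷_) (⊕-self a)
⊕-self (true ∷ a) = cong (false ∷_) (⊕-self a)

⊕-cancel : ∀ {n} (a b : F₂^ n) → a ⊕ (a ⊕ b) ≡ b
⊕-cancel a b = trans (sym (⊕-assoc a a b)) (trans (cong (_⊕ b) (⊕-self a)) (⊕-identityˡ b))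

⊕-solve : ∀ {n} (a b : F₂^ n) → a ⊕ b ≡ 0v → b ≡ a
⊕-solve a b h = trans (sym (⊕-cancel a b)) (trans (cong (a ⊕_) h) (⊕-identityʳ a))

#-∧ : ∀ x y → # (x ∧ y) ≡ # x * # y
#-∧ false y = refl
#-∧ true y = sym (+-identityʳ (# y))

-- The indicator of a subspace, or of the empty set, in the form in which translations will use it.
Saturated : ∀ {n} → (F₂^ n → Bool) → Set
Saturated P = ∀ b a → P b ≡ true → P (b ⊕ a) ≡ P a

Additive : ∀ {n} → (F₂^ n → Bool) → Set
Additive χ = ∀ b a → χ (b ⊕ a) ≡ χ b xor χ a

cut : ∀ {n} → (χ P : F₂^ n → Bool) → F₂^ n → Bool
cut χ P a = not (χ a) ∧ P a

not-false : ∀ x → not x ≡ true → x ≡ false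
not-false false _ = refl

cut-saturated : ∀ {n} (χ P : F₂^ n → Bool) → Additive χ → Saturated P → Saturated (cut χ P)
cut-saturated χ P add sat b a h = cong₂ _∧_
  (cong not (trans (add b a) (cong (_xor χ a) (not-false (χ b) (∧-splitˡ {not (χ b)} h))))) (sat b a (∧-splitʳ {not (χ b)} h))

-- If some `b` in `P` has `χ b` true, translation by `b` exchanges the two halves of `P`; otherwise
-- the cut is all of `P`.
halve : ∀ {n} (χ P : F₂^ n → Bool) → Additive χ → Saturated P → count P ≤ 2 * count (cut χ P)
halve χ P add sat with find (λ b → (χ b ∧ P b) ≟ true)
... | inj₂ none = ≤-trans (sumOver-mono _ _ small) (m≤m+n (count (cut χ P)) _)
  where
  small : ∀ a → # (P a) ≤ # (cut χ P a)
  small a with χ a in e | P a in e′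
  ... | false | x = ≤-refl
  ... | true | false = z≤n
  ... | true | true = ⊥-elim (none a (cong₂ _∧_ e e′))
... | inj₁ (b , h) = ≤-reflexive (trans (trans (sumOver-cong _ _ (λ a → halves (χ a) (P a)))
    (sumOver-+ (# ∘ cut χ P) (λ a → # (χ a ∧ P a))))
    (cong (count (cut χ P) +_) (trans (sym (sumOver-shift b (λ a → # (χ a ∧ P a))))
      (trans (sumOver-cong _ _ λ a → cong # (cong₂ _∧_
          (trans (add b a) (cong (_xor χ a) (∧-splitˡ {χ b} h))) (sat b a (∧-splitʳ {χ b} h))))
        (sym (+-identityʳ _))))))
  where
  halves : ∀ x y → # y ≡ # (not x ∧ y) + # (x ∧ y)
  halves false y = sym (+-identityʳ (# y))
  halves true y = refl

-- The elementary symmetric polynomial in the indicators of the zeros. It equals a binomial of their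
-- number, but its recursion lets a sum over `a` be split line by line.
esym : ℕ → Row → ℕ
esym zero r = 1
esym (suc k) [] = 0
esym (suc k) (x ∷ r) = vanish x * esym k r + esym (suc k) r

pascal : ℕ → ℕ → ℕ
pascal n zero = 1
pascal zero (suc k) = 0
pascal (suc n) (suc k) = pascal n k + pascal n (suc k)

esym-pascal : ∀ k r → esym k r ≡ pascal (zeros r) k
esym-pascal zero r = refl
esym-pascal (suc k) [] = refl
esym-pascal (suc k) (e₀ ∷ r) = cong₂ _+_ (trans (+-identityʳ _) (esym-pascal k r)) (esym-pascal (suc k) r)
esym-pascal (suc k) (e₁ ∷ r) = esym-pascal (suc k) r
esym-pascal (suc k) (e₂ ∷ r) = esym-pascal (suc k) r
esym-pascal (suc k) (e₃ ∷ r) = esym-pascal (suc k) r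

fromBits : Bool → Bool → F
fromBits false false = e₀
fromBits true false = e₁
fromBits false true = e₂
fromBits true true = e₃

fromBits-xor : ∀ a b c d → fromBits (a xor c) (b xor d) ≡ fromBits a b ⊹ fromBits c d
fromBits-xor false false c d = refl
fromBits-xor false true false false = refl
fromBits-xor false true false true = refl
fromBits-xor false true true false = refl
fromBits-xor false true true true = refl
fromBits-xor true false false false = refl
fromBits-xor true false false true = refl
fromBits-xor true false true false = refl
fromBits-xor true false true true = refl
fromBits-xor true true false false = refl
fromBits-xor true true false true = refl
fromBits-xor true true true false = refl
fromBits-xor true true true true = refl

isZ-fromBits : ∀ a b → isZ (fromBits a b) ≡ not a ∧ not b
isZ-fromBits false false = refl
isZ-fromBits false true = refl
isZ-fromBits true false = refl
isZ-fromBits true true = refl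

vanish-isZ : ∀ x → vanish x ≡ # (isZ x)
vanish-isZ e₀ = refl
vanish-isZ e₁ = refl
vanish-isZ e₂ = refl
vanish-isZ e₃ = refl

isZ-sound : ∀ x → isZ x ≡ true → x ≡ e₀
isZ-sound e₀ _ = refl

-- A line is given by two spanning points; ev l a is the restriction to l of the functional dot a.
Pair : ℕ → Set
Pair n = F₂^ n × F₂^ n

ev : ∀ {n} → Pair n → F₂^ n → F
ev (p , q) a = fromBits (dot a p) (dot a q)

ev-⊕ : ∀ {n} (l : Pair n) a b → ev l (a ⊕ b) ≡ ev l a ⊹ ev l b
ev-⊕ (p , q) a b = trans (cong₂ fromBits (dot-⊕ˡ a b p) (dot-⊕ˡ a b q)) (fromBits-xor (dot a p) _ _ _)

evs : ∀ {n} → List (Pair n) → F₂^ n → Row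
evs ls a = map (λ l → ev l a) ls

kills : ∀ {n} → List (Pair n) → F₂^ n → Bool
kills [] a = true
kills (l ∷ ls) a = isZ (ev l a) ∧ kills ls a

kills-saturated : ∀ {n} (ls : List (Pair n)) → Saturated (kills ls)
kills-saturated [] b a h = refl
kills-saturated (l ∷ ls) b a h = cong₂ _∧_
  (cong isZ (trans (ev-⊕ l b a) (cong (_⊹ ev l a) (isZ-sound _ (∧-splitˡ h)))))
  (kills-saturated ls b a (∧-splitʳ {isZ (ev l b)} h))

-- Killing a line amounts to two linear conditions, each of which at worst halves the space.
quarter : ∀ {n} (l : Pair n) ls → count (kills ls) ≤ 4 * count (kills (l ∷ ls))
quarter l@(p , q) ls = ≤-trans (halve χ (kills ls) χ-add (kills-saturated ls))
  (≤-trans (*-monoʳ-≤ 2 (halve ψ (cut χ (kills ls)) ψ-add (cut-saturated χ (kills ls) χ-add (kills-saturated ls))))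
    (≤-reflexive (trans (sym (*-assoc 2 2 (count (cut ψ (cut χ (kills ls)))))) (cong (4 *_) (sumOver-cong _ _ λ a → cong #
      (sym (trans (cong (_∧ kills ls a) (isZ-fromBits (dot a p) (dot a q))) (∧-assoc (not (dot a p)) _ _))))))))
  where
  ψ = λ a → dot a p
  χ = λ a → dot a q
  ψ-add : Additive ψ
  ψ-add b a = dot-⊕ˡ b a p
  χ-add : Additive χ
  χ-add b a = dot-⊕ˡ b a q

count-kills : ∀ {n} (ls : List (Pair n)) → 2 ^ n ≤ 4 ^ length ls * count (kills ls)
count-kills {n} [] = ≤-reflexive (sym (trans (+-identityʳ _) (trans (sumOver-const n 1) (+-identityʳ _))))
count-kills (l ∷ ls) = ≤-trans (count-kills ls) (≤-trans (*-monoʳ-≤ (4 ^ length ls) (quarter l ls))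
  (≤-reflexive (trans (sym (*-assoc (4 ^ length ls) 4 _)) (cong (_* count (kills (l ∷ ls))) (*-comm (4 ^ length ls) 4)))))

-- The sum over the k-subsets of ls of the number of vectors killing it and ks.
moment : ∀ {n} → List (Pair n) → ℕ → List (Pair n) → ℕ
moment ks k ls = sumOver (λ a → # (kills ks a) * esym k (evs ls a))

moment-zero : ∀ {n} (ks ls : List (Pair n)) → moment ks 0 ls ≡ count (kills ks)
moment-zero ks ls = sumOver-cong _ _ λ a → *-identityʳ (# (kills ks a))

moment-step : ∀ {n} (ks : List (Pair n)) k l ls → moment ks (suc k) (l ∷ ls) ≡ moment (l ∷ ks) k ls + moment ks (suc k) ls
moment-step ks k l ls = trans (sumOver-cong _ _ pointwise)
  (sumOver-+ (λ a → # (kills (l ∷ ks) a) * esym k (evs ls a)) (λ a → # (kills ks a) * esym (suc k) (evs ls a)))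
  where
  pointwise : ∀ a → # (kills ks a) * (vanish (ev l a) * esym k (evs ls a) + esym (suc k) (evs ls a)) ≡
                    # (kills (l ∷ ks) a) * esym k (evs ls a) + # (kills ks a) * esym (suc k) (evs ls a)
  pointwise a = trans (*-distribˡ-+ (# (kills ks a)) _ _) (cong (_+ # (kills ks a) * esym (suc k) (evs ls a))
    (trans (sym (*-assoc (# (kills ks a)) (vanish (ev l a)) _)) (cong (_* esym k (evs ls a))
      (trans (*-comm (# (kills ks a)) _) (trans (cong (_* # (kills ks a)) (vanish-isZ (ev l a)))
        (sym (#-∧ (isZ (ev l a)) (kills ks a))))))))

-- `ks` holds the lines chosen so far; each of the ways to choose `k` more is estimated by
-- `count-kills`.
moment-lower : ∀ {n} (ls : List (Pair n)) k ks → pascal (length ls) k * 2 ^ n ≤ 4 ^ (k + length ks) * moment ks k ls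
moment-lower {n} ls zero ks = ≤-trans (≤-reflexive (+-identityʳ (2 ^ n)))
  (≤-trans (count-kills ks) (≤-reflexive (cong (4 ^ length ks *_) (sym (moment-zero ks ls)))))
moment-lower [] (suc k) ks = z≤n
moment-lower {n} (l ∷ ls) (suc k) ks = ≤-trans (≤-reflexive (*-distribʳ-+ (2 ^ n) (pascal (length ls) k) _))
  (≤-trans (+-mono-≤
      (subst (λ e → pascal (length ls) k * 2 ^ n ≤ 4 ^ e * moment (l ∷ ks) k ls) (+-suc k (length ks)) (moment-lower ls k (l ∷ ks)))
      (moment-lower ls (suc k) ks))
    (≤-reflexive (trans (sym (*-distribˡ-+ (4 ^ (suc k + length ks)) (moment (l ∷ ks) k ls) _))
      (cong (4 ^ (suc k + length ks) *_) (sym (moment-step ks k l ls))))))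

module _ {n} (all : List (Pair n)) (j M : ℕ)
  (bounded : ∀ ks rest → length ks ≡ j → all ↭ ks ++ rest → count (kills ks) ≤ M) where
  -- The lines passed over are collected in `skipped`, so that a completed choice `ks` comes with
  -- its complement in `all`, as `bounded` requires.
  moment-upper : ∀ ls k ks skipped → k + length ks ≡ j → all ↭ ks ++ (skipped ++ ls) →
                 moment ks k ls ≤ pascal (length ls) k * M
  moment-upper ls zero ks skipped e p = ≤-trans (≤-reflexive (moment-zero ks ls))
    (≤-trans (bounded ks (skipped ++ ls) e p) (≤-reflexive (sym (+-identityʳ M))))
  moment-upper [] (suc k) ks skipped e p = ≤-reflexive (trans
    (sumOver-cong _ (λ _ → 0) λ a → *-zeroʳ (# (kills ks a))) (sumOver-const n 0))
  moment-upper (l ∷ ls) (suc k) ks skipped e p = ≤-trans (≤-reflexive (moment-step ks k l ls))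
    (≤-trans (+-mono-≤ (moment-upper ls k (l ∷ ks) skipped (trans (+-suc k (length ks)) e) (↭-trans q (↭-shift l ks (skipped ++ ls))))
                       (moment-upper ls (suc k) ks (l ∷ skipped) e q))
      (≤-reflexive (sym (*-distribʳ-+ M (pascal (length ls) k) _))))
    where q = ↭-trans p (++⁺ˡ ks (↭-shift l skipped ls))

-- For c ≤ 6 the difference of the two sides is a multiple of (c − 2)(c − 3)(c − 5)(c − 6) ≥ 0.
quartic : ∀ c → c ≤ 6 → 35 * pascal c 1 + 15 * pascal c 3 ≤ 45 + 25 * pascal c 2 + 6 * pascal c 4
quartic 0 h = ≤ᵇ⇒≤ _ _ tt
quartic 1 h = ≤ᵇ⇒≤ _ _ tt
quartic 2 h = ≤ᵇ⇒≤ _ _ tt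
quartic 3 h = ≤ᵇ⇒≤ _ _ tt
quartic 4 h = ≤ᵇ⇒≤ _ _ tt
quartic 5 h = ≤ᵇ⇒≤ _ _ tt
quartic 6 h = ≤ᵇ⇒≤ _ _ tt
quartic (suc (suc (suc (suc (suc (suc (suc c))))))) (s≤s (s≤s (s≤s (s≤s (s≤s (s≤s ()))))))

ev-0 : ∀ {n} (l : Pair n) → ev l 0v ≡ e₀
ev-0 l = trans (cong (ev l) (sym (⊕-self 0v))) (trans (ev-⊕ l 0v 0v) (⊹-self (ev l 0v)))

zeros-evs-0 : ∀ {n} (ls : List (Pair n)) → zeros (evs ls 0v) ≡ length ls
zeros-evs-0 [] = refl
zeros-evs-0 (l ∷ ls) rewrite ev-0 l = cong suc (zeros-evs-0 ls)

module _ {n} (ls : List (Pair n)) (2^n : 2 ^ n ≡ 1024) (15-lines : length ls ≡ 15)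
  (cov : ∀ a → a ≢ 0v → zeros (evs ls a) ≤ 6) (c₀ c₁ c₃ d₀ d₂ d₄ : ℕ)
  (at-zero : c₁ * pascal 15 1 + c₃ * pascal 15 3 + c₀ ≤ d₀ + d₂ * pascal 15 2 + d₄ * pascal 15 4)
  (elsewhere : ∀ c → c ≤ 6 → c₁ * pascal c 1 + c₃ * pascal c 3 ≤ d₀ + d₂ * pascal c 2 + d₄ * pascal c 4)
  (four : ∀ ks rest → length ks ≡ 4 → ls ↭ ks ++ rest → count (kills ks) ≤ 4) where

  moment-inequality : c₁ * 3840 + c₃ * 7280 + c₀ ≤ d₀ * 1024 + d₂ * 6720 + d₄ * 5460
  moment-inequality = begin
    c₁ * 3840 + c₃ * 7280 + c₀
      ≤⟨ +-mono-≤ (+-mono-≤ (*-monoʳ-≤ c₁ (lower 1 3840 refl)) (*-monoʳ-≤ c₃ (lower 3 7280 refl)))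
                  (≤-reflexive (trans (sym (*-identityʳ c₀)) (cong (c₀ *_) (sym (sumOver-eqV {n} 0v))))) ⟩
    c₁ * S 1 + c₃ * S 3 + c₀ * sumOver {n} (λ a → # (eqV 0v a))
      ≡⟨ sym (cong₂ _+_ (trans (sumOver-+ (λ a → c₁ * p 1 a) (λ a → c₃ * p 3 a)) (cong₂ _+_ (sumOver-* c₁ (p 1)) (sumOver-* c₃ (p 3))))
                        (sumOver-* {n} c₀ (λ a → # (eqV 0v a)))) ⟩
    sumOver (λ a → c₁ * p 1 a + c₃ * p 3 a) + sumOver {n} (λ a → c₀ * # (eqV 0v a))
      ≡⟨ sym (sumOver-+ {n} (λ a → c₁ * p 1 a + c₃ * p 3 a) (λ a → c₀ * # (eqV 0v a))) ⟩
    sumOver (λ a → c₁ * p 1 a + c₃ * p 3 a + c₀ * # (eqV 0v a))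
      ≤⟨ sumOver-mono _ _ pointwise ⟩
    sumOver (λ a → d₀ + d₂ * p 2 a + d₄ * p 4 a)
      ≡⟨ trans (sumOver-+ (λ a → d₀ + d₂ * p 2 a) (λ a → d₄ * p 4 a)) (cong₂ _+_ (trans (sumOver-+ (λ _ → d₀) (λ a → d₂ * p 2 a))
          (cong₂ _+_ (trans (sumOver-const n d₀) (cong (d₀ *_) 2^n)) (sumOver-* d₂ (p 2)))) (sumOver-* d₄ (p 4))) ⟩
    d₀ * 1024 + d₂ * S 2 + d₄ * S 4
      ≤⟨ +-mono-≤ (+-monoʳ-≤ (d₀ * 1024) (*-monoʳ-≤ d₂ (upper 2 64 two))) (*-monoʳ-≤ d₄ (upper 4 4 four)) ⟩
    d₀ * 1024 + d₂ * 6720 + d₄ * 5460 ∎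
    where
    open ≤-Reasoning
    p : ℕ → F₂^ n → ℕ
    p k a = pascal (zeros (evs ls a)) k
    S : ℕ → ℕ
    S k = sumOver (p k)
    S-moment : ∀ k → moment [] k ls ≡ S k
    S-moment k = sumOver-cong _ _ λ a → trans (+-identityʳ _) (esym-pascal k (evs ls a))
    lower : ∀ k m → 4 ^ k * m ≡ pascal 15 k * 1024 → m ≤ S k
    lower k m e = *-cancelˡ-≤ (4 ^ k) ⦃ m^n≢0 4 k ⦄ (subst₂ _≤_
      (trans (cong₂ (λ c d → pascal c k * d) 15-lines 2^n) (sym e))
      (cong₂ (λ e s → 4 ^ e * s) (+-identityʳ k) (S-moment k)) (moment-lower ls k []))
    upper : ∀ k M → (∀ ks rest → length ks ≡ k → ls ↭ ks ++ rest → count (kills ks) ≤ M) → S k ≤ pascal 15 k * M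
    upper k M b = subst₂ _≤_ (S-moment k) (cong (λ c → pascal c k * M) 15-lines)
      (moment-upper ls k M b ls k [] [] (+-identityʳ k) ↭-refl)
    -- Two further lines cut a kernel down at most sixteenfold, so the bound 4 for quadruples gives
    -- 64 for pairs.
    two : ∀ ks rest → length ks ≡ 2 → ls ↭ ks ++ rest → count (kills ks) ≤ 64
    two (k₁ ∷ k₂ ∷ []) (l₃ ∷ l₄ ∷ rest) e q = ≤-trans (quarter l₄ ks) (*-monoʳ-≤ 4 (≤-trans (quarter l₃ (l₄ ∷ ks))
      (*-monoʳ-≤ 4 (four (l₃ ∷ l₄ ∷ ks) rest refl (↭-trans q (↭-trans (↭-shift l₃ ks (l₄ ∷ rest)) (prep l₃ (↭-shift l₄ ks rest))))))))
      where ks = k₁ ∷ k₂ ∷ []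
    two (_ ∷ _ ∷ []) [] e q with () ← trans (sym 15-lines) (↭-length q)
    two (_ ∷ _ ∷ []) (_ ∷ []) e q with () ← trans (sym 15-lines) (↭-length q)
    pointwise : ∀ a → c₁ * p 1 a + c₃ * p 3 a + c₀ * # (eqV 0v a) ≤ d₀ + d₂ * p 2 a + d₄ * p 4 a
    pointwise a with eqV 0v a in eq
    ... | true rewrite sym (eqV-sound 0v a eq) | zeros-evs-0 ls | 15-lines | *-identityʳ c₀ = at-zero
    ... | false rewrite *-zeroʳ c₀ = ≤-trans (≤-reflexive (+-identityʳ _)) (elsewhere _ (cov a λ { refl → nonzero eq }))
      where
      nonzero : eqV {n} 0v 0v ≢ false
      nonzero e with () ← trans (sym e) (eqV-refl {n} 0v)

moments-contradict : ∀ {n} (ls : List (Pair n)) → 2 ^ n ≡ 1024 → length ls ≡ 15 → (∀ a → a ≢ 0v → zeros (evs ls a) ≤ 6) →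
                     ¬ (∀ ks rest → length ks ≡ 4 → ls ↭ ks ++ rest → count (kills ks) ≤ 4)
-- The coefficients are those of a quarter of the quartic in the basis of binomials. Its value at c
-- = 15 is 3510 = 13 · 12 · 10 · 9 / 4, whence the equality 10860 = 10860 at the zero vector.
moments-contradict ls 2^n 15-lines cov four = <⇒≱ {246840} {247110} (<ᵇ⇒< 246840 247110 tt)
  (moment-inequality ls 2^n 15-lines cov 3510 35 15 45 25 6 (≤ᵇ⇒≤ 10860 10860 tt) quartic four)

spare : ∀ {n} → 2 ^ n ≡ 1024 → ∀ (ls : List (Pair n)) xs → 4 ^ length ls * length xs < 1024 → ∃[ a ] kills ls a ≡ true × ¬ a ∈ᴸ xs
spare 2^n ls xs h = escape (kills ls) xs (≰⇒> λ few → <⇒≱ h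
  (subst (_≤ 4 ^ length ls * length xs) 2^n (≤-trans (count-kills ls) (*-monoʳ-≤ (4 ^ length ls) few))))

-- From vectors to cliques of rows

addV : ∀ {n} → Bool → F₂^ n → F₂^ n → F₂^ n
addV false e x = x
addV true e x = e ⊕ x

addF : Bool → F → F → F
addF false y x = x
addF true y x = y ⊹ x

addF-0 : ∀ α x → addF α e₀ x ≡ x
addF-0 false x = refl
addF-0 true x = refl

ev-addV : ∀ {n} (l : Pair n) α e x → ev l (addV α e x) ≡ addF α (ev l e) (ev l x)
ev-addV l false e x = refl
ev-addV l true e x = ev-⊕ l e x

doubleIf : ∀ {n} → Bool → F₂^ n → List (F₂^ n) → List (F₂^ n)
doubleIf false e xs = xs
doubleIf true e xs = xs ++ map (e ⊕_) xs

length-doubleIf : ∀ {n} s (e : F₂^ n) xs → length (doubleIf s e xs) ≡ 2 ^ # s * length xs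
length-doubleIf false e xs = sym (+-identityʳ (length xs))
length-doubleIf true e xs = trans (length-++ xs) (cong (length xs +_) (trans (length-map (e ⊕_) xs) (sym (+-identityʳ _))))

∈-doubleIf : ∀ {n} s α (e : F₂^ n) xs x → (s ≡ false → ¬ α ≡ true) → addV α e x ∈ᴸ xs → x ∈ᴸ doubleIf s e xs
∈-doubleIf false false e xs x h i = i
∈-doubleIf false true e xs x h i = ⊥-elim (h refl refl)
∈-doubleIf true false e xs x h i = ∈-++⁺ˡ i
∈-doubleIf true true e xs x h i = ∈-++⁺ʳ xs (subst (_∈ᴸ map (e ⊕_) xs) (⊕-cancel e x) (∈-map⁺ (e ⊕_) i))

consIf : {A : Set} → Bool → A → List A → List A
consIf false x xs = xs
consIf true x xs = x ∷ xs

length-consIf : {A : Set} (b : Bool) (x : A) (xs : List A) → length (consIf b x xs) ≡ # b + length xs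
length-consIf false x xs = refl
length-consIf true x xs = refl

kills-consIf : ∀ {n} s (l : Pair n) ls a → kills (consIf (not s) l ls) a ≡ true → (s ≡ false → ev l a ≡ e₀) × kills ls a ≡ true
kills-consIf false l ls a h = (λ _ → isZ-sound _ (∧-splitˡ h)) , ∧-splitʳ {isZ (ev l a)} h
kills-consIf true l ls a h = (λ ()) , h

drop-not : ∀ s {z k} → # (not s) + z ≤ suc k → z ≤ k + # s
drop-not false {z} {k} (s≤s h) = subst (z ≤_) (sym (+-identityʳ k)) h
drop-not true {z} {k} h = subst (z ≤_) (+-comm 1 k) h

∨-falseˡ : ∀ s {α} → s ∨ α ≡ false → s ≡ false
∨-falseˡ false h = refl

∨-falseʳ : ∀ s {α} → s ∨ α ≡ false → α ≡ false
∨-falseʳ false h = h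

-- Two lines have at least 1024 / 4² = 64 common killers, whereas `U` and two more vectors span at
-- most 32 vectors.
room : ∀ s t u v → # s + (# t + (# u + # v)) ≡ 2 →
       4 ^ (# (not s) + (# (not t) + (# (not u) + (# (not v) + 0)))) * (2 ^ # v * (2 ^ # u * (2 ^ # t * (2 ^ # s * 8)))) < 1024
room true true false false _ = ≤ᵇ⇒≤ _ _ tt
room true false true false _ = ≤ᵇ⇒≤ _ _ tt
room true false false true _ = ≤ᵇ⇒≤ _ _ tt
room false true true false _ = ≤ᵇ⇒≤ _ _ tt
room false true false true _ = ≤ᵇ⇒≤ _ _ tt
room false false true true _ = ≤ᵇ⇒≤ _ _ tt
room false false false false ()
room false false false true ()
room false false true false ()
room false true false false ()
room true false false false ()
room true true true false ()
room true true false true ()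
room true false true true ()
room false true true true ()
room true true true true ()

-- `ρ` stands for the restrictions to the other eleven lines after a change of basis in each column;
-- `ws` lists the vectors of the space whose rows are `U C`.
module Chart {n} (2^n : 2 ^ n ≡ 1024) (C : Ctx) (V : Valid C 11) (l₁ l₂ l₃ l₄ : Pair n)
  (ρ : F₂^ n → Row) (ρ-length : ∀ a → length (ρ a) ≡ 11) (ρ-⊕ : ∀ a b → ρ (a ⊕ b) ≡ ρ a ⊞ ρ b)
  (cov : ∀ a → a ≢ 0v → vanish (ev l₁ a) + (vanish (ev l₂ a) + (vanish (ev l₃ a) + (vanish (ev l₄ a) + zeros (ρ a)))) ≤ 6)
  (ws : List (F₂^ n)) (ws-length : length ws ≡ 8) (ws-kill : ∀ {w} → w ∈ᴸ ws → kills (l₁ ∷ l₂ ∷ l₃ ∷ l₄ ∷ []) w ≡ true)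
  (ws-rows : U C ≡ map ρ ws) where

  open Search C 11 V using (us; 𝟎; Clique)
  open Kill C 11 V using (adds; comb-⊞; thin-sound)

  -- A flag `true` exempts its line, so the number of such flags is the allowance added to the bound
  -- two.
  record Vanishes (s t u v : Bool) (a : F₂^ n) : Set where
    constructor vanishes
    field
      at₁ : s ≡ false → ev l₁ a ≡ e₀
      at₂ : t ≡ false → ev l₂ a ≡ e₀
      at₃ : u ≡ false → ev l₃ a ≡ e₀
      at₄ : v ≡ false → ev l₄ a ≡ e₀
  open Vanishes

  others : (s t u v : Bool) → List (Pair n)
  others s t u v = consIf (not s) l₁ (consIf (not t) l₂ (consIf (not u) l₃ (consIf (not v) l₄ [])))

  killed : ∀ s t u v a → kills (others s t u v) a ≡ true → Vanishes s t u v a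
  killed s t u v a h =
    let h₁ , k₁ = kills-consIf s l₁ _ a h
        h₂ , k₂ = kills-consIf t l₂ _ a k₁
        h₃ , k₃ = kills-consIf u l₃ _ a k₂
        h₄ , _ = kills-consIf v l₄ [] a k₃
    in vanishes h₁ h₂ h₃ h₄

  ws-vanishes : ∀ {w} → w ∈ᴸ ws → Vanishes false false false false w
  ws-vanishes {w} i = killed false false false false w (ws-kill i)

  vanish-≥ : ∀ s (l : Pair n) (w a : F₂^ n) → ev l w ≡ e₀ → (s ≡ false → ev l a ≡ e₀) → # (not s) ≤ vanish (ev l (w ⊕ a))
  vanish-≥ true l w a hw ha = z≤n
  vanish-≥ false l w a hw ha = ≤-reflexive (sym (cong vanish (trans (ev-⊕ l w a) (cong₂ _⊹_ hw (ha refl)))))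

  -- For `w` in `ws` the vector `w ⊕ a` is nonzero, because `a` lies outside `ws`, and it kills
  -- every line with flag `false`. These lines use up their share of the six in `cov`.
  cap-ρ : ∀ s t u v a → ¬ a ∈ᴸ ws → Vanishes s t u v a → Cap us (2 + (# s + (# t + (# u + # v)))) (ρ a)
  cap-ρ s t u v a a∉ (vanishes h₁ h₂ h₃ h₄) = subst (λ us → Cap us _ (ρ a)) (sym ws-rows) (map⁺ (All.tabulate bounded))
    where
    bounded : ∀ {w} → w ∈ᴸ ws → zeros (ρ w ⊞ ρ a) ≤ 2 + (# s + (# t + (# u + # v)))
    bounded {w} i = subst₂ _≤_ (cong zeros (ρ-⊕ w a))
      (trans (+-assoc (2 + # s + # t) (# u) (# v)) (+-assoc (2 + # s) (# t) _))
      (drop-not v (drop-not u (drop-not t (drop-not s (≤-trans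
        (+-mono-≤ (vanish-≥ s l₁ w a (at₁ W refl) h₁) (+-mono-≤ (vanish-≥ t l₂ w a (at₂ W refl) h₂)
          (+-mono-≤ (vanish-≥ u l₃ w a (at₃ W refl) h₃) (+-monoˡ-≤ (zeros (ρ (w ⊕ a))) (vanish-≥ v l₄ w a (at₄ W refl) h₄)))))
        (cov (w ⊕ a) λ z → a∉ (subst (_∈ᴸ ws) (sym (⊕-solve w a z)) i)))))))
      where W = ws-vanishes i

  thick : ∀ {a} → ¬ a ∈ᴸ ws → ¬ Vanishes false false false false a
  thick {a} a∉ h = thin-sound (ρ-length a) (cap-ρ false false false false a a∉ h)

  spareFor : ∀ s t u v xs → 4 ^ length (others s t u v) * length xs < 1024 → ∃[ a ] Vanishes s t u v a × ¬ a ∈ᴸ xs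
  spareFor s t u v xs h = let a , k , a∉ = spare 2^n (others s t u v) xs h in a , killed s t u v a k , a∉

  vertex : ∀ s t u v → 4 ^ length (others s t u v) * 8 < 1024 → ∃[ a ] Vanishes s t u v a × ¬ a ∈ᴸ ws
  vertex s t u v h = spareFor s t u v ws (subst (λ m → 4 ^ length (others s t u v) * m < 1024) (sym ws-length) h)

  module _ {x₁ x₂ x₃ x₄ : F₂^ n}
    (V₁ : Vanishes true false false false x₁) (x₁∉ : ¬ x₁ ∈ᴸ ws)
    (V₂ : Vanishes false true false false x₂) (x₂∉ : ¬ x₂ ∈ᴸ ws)
    (V₃ : Vanishes false false true false x₃) (x₃∉ : ¬ x₃ ∈ᴸ ws)
    (V₄ : Vanishes false false false true x₄) (x₄∉ : ¬ x₄ ∈ᴸ ws) where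

    addsV : (α β γ δ : Bool) → F₂^ n → F₂^ n
    addsV α β γ δ g = addV α x₁ (addV β x₂ (addV γ x₃ (addV δ x₄ g)))

    ev-addsV : ∀ (l : Pair n) α β γ δ g → ev l (addsV α β γ δ g) ≡ addF α (ev l x₁) (addF β (ev l x₂) (addF γ (ev l x₃) (addF δ (ev l x₄) (ev l g))))
    ev-addsV l α β γ δ g = trans (ev-addV l α x₁ _) (cong (addF α _) (trans (ev-addV l β x₂ _) (cong (addF β _)
      (trans (ev-addV l γ x₃ _) (cong (addF γ _) (ev-addV l δ x₄ g))))))

    ev₁ : ∀ α β γ δ g → ev l₁ (addsV α β γ δ g) ≡ addF α (ev l₁ x₁) (ev l₁ g)
    ev₁ α β γ δ g rewrite ev-addsV l₁ α β γ δ g | at₁ V₂ refl | at₁ V₃ refl | at₁ V₄ refl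
      | addF-0 δ (ev l₁ g) | addF-0 γ (ev l₁ g) | addF-0 β (ev l₁ g) = refl

    ev₂ : ∀ α β γ δ g → ev l₂ (addsV α β γ δ g) ≡ addF β (ev l₂ x₂) (ev l₂ g)
    ev₂ α β γ δ g rewrite ev-addsV l₂ α β γ δ g | at₂ V₁ refl | at₂ V₃ refl | at₂ V₄ refl
      | addF-0 δ (ev l₂ g) | addF-0 γ (ev l₂ g) | addF-0 α (addF β (ev l₂ x₂) (ev l₂ g)) = refl

    ev₃ : ∀ α β γ δ g → ev l₃ (addsV α β γ δ g) ≡ addF γ (ev l₃ x₃) (ev l₃ g)
    ev₃ α β γ δ g rewrite ev-addsV l₃ α β γ δ g | at₃ V₁ refl | at₃ V₂ refl | at₃ V₄ refl
      | addF-0 δ (ev l₃ g) | addF-0 β (addF γ (ev l₃ x₃) (ev l₃ g)) | addF-0 α (addF γ (ev l₃ x₃) (ev l₃ g)) = refl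

    ev₄ : ∀ α β γ δ g → ev l₄ (addsV α β γ δ g) ≡ addF δ (ev l₄ x₄) (ev l₄ g)
    ev₄ α β γ δ g rewrite ev-addsV l₄ α β γ δ g | at₄ V₁ refl | at₄ V₂ refl | at₄ V₃ refl
      | addF-0 γ (addF δ (ev l₄ x₄) (ev l₄ g)) | addF-0 β (addF δ (ev l₄ x₄) (ev l₄ g)) | addF-0 α (addF δ (ev l₄ x₄) (ev l₄ g)) = refl

    addsV-vanishes : ∀ {s t u v g} → Vanishes s t u v g → ∀ α β γ δ → Vanishes (s ∨ α) (t ∨ β) (u ∨ γ) (v ∨ δ) (addsV α β γ δ g)
    addsV-vanishes {s} {t} {u} {v} {g} (vanishes h₁ h₂ h₃ h₄) α β γ δ = vanishes
      (λ e → trans (ev₁ α β γ δ g) (off α (∨-falseʳ s e) (h₁ (∨-falseˡ s e))))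
      (λ e → trans (ev₂ α β γ δ g) (off β (∨-falseʳ t e) (h₂ (∨-falseˡ t e))))
      (λ e → trans (ev₃ α β γ δ g) (off γ (∨-falseʳ u e) (h₃ (∨-falseˡ u e))))
      (λ e → trans (ev₄ α β γ δ g) (off δ (∨-falseʳ v e) (h₄ (∨-falseˡ v e))))
      where
      off : ∀ α → α ≡ false → ∀ {y x} → x ≡ e₀ → addF α y x ≡ e₀
      off false _ h = h

    survives : ∀ α {y x} → α ≡ true → y ≢ e₀ → x ≡ e₀ → addF α y x ≢ e₀
    survives true _ y≢0 refl e = y≢0 (trans (sym (⊹-identityʳ _)) e)

    module _ {g α β γ δ} (i : addsV α β γ δ g ∈ᴸ ws) where
      -- Among the four vectors only `x₁` is nonzero on `l₁`: if it vanished there too, it would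
      -- kill all four lines, against `thick`. So a combination lying in `ws` cannot involve it when
      -- `g` vanishes on `l₁`.
      off₁ : ev l₁ g ≡ e₀ → ¬ α ≡ true
      off₁ hg e = survives α e (λ z → thick x₁∉ (vanishes (λ _ → z) (at₂ V₁) (at₃ V₁) (at₄ V₁))) hg
        (trans (sym (ev₁ α β γ δ g)) (at₁ (ws-vanishes i) refl))

      off₂ : ev l₂ g ≡ e₀ → ¬ β ≡ true
      off₂ hg e = survives β e (λ z → thick x₂∉ (vanishes (at₁ V₂) (λ _ → z) (at₃ V₂) (at₄ V₂))) hg
        (trans (sym (ev₂ α β γ δ g)) (at₂ (ws-vanishes i) refl))

      off₃ : ev l₃ g ≡ e₀ → ¬ γ ≡ true
      off₃ hg e = survives γ e (λ z → thick x₃∉ (vanishes (at₁ V₃) (at₂ V₃) (λ _ → z) (at₄ V₃))) hg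
        (trans (sym (ev₃ α β γ δ g)) (at₃ (ws-vanishes i) refl))

      off₄ : ev l₄ g ≡ e₀ → ¬ δ ≡ true
      off₄ hg e = survives δ e (λ z → thick x₄∉ (vanishes (at₁ V₄) (at₂ V₄) (at₃ V₄) (λ _ → z))) hg
        (trans (sym (ev₄ α β γ δ g)) (at₄ (ws-vanishes i) refl))

    span : (s t u v : Bool) → List (F₂^ n)
    span s t u v = doubleIf v x₄ (doubleIf u x₃ (doubleIf t x₂ (doubleIf s x₁ ws)))

    length-span : ∀ s t u v → length (span s t u v) ≡ 2 ^ # v * (2 ^ # u * (2 ^ # t * (2 ^ # s * 8)))
    length-span s t u v = trans (length-doubleIf v x₄ _) (cong (2 ^ # v *_) (trans (length-doubleIf u x₃ _) (cong (2 ^ # u *_)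
      (trans (length-doubleIf t x₂ _) (cong (2 ^ # t *_) (trans (length-doubleIf s x₁ ws) (cong (2 ^ # s *_) ws-length)))))))

    length-others : ∀ s t u v → length (others s t u v) ≡ # (not s) + (# (not t) + (# (not u) + (# (not v) + 0)))
    length-others s t u v = trans (length-consIf (not s) l₁ _) (cong (# (not s) +_) (trans (length-consIf (not t) l₂ _) (cong (# (not t) +_)
      (trans (length-consIf (not u) l₃ _) (cong (# (not u) +_) (length-consIf (not v) l₄ []))))))

    -- By `off₁` to `off₄`, a combination lying in `ws` involves only vectors whose flag is `true`;
    -- but then `g` itself would be in the span.
    addsV-∉ : ∀ {s t u v g} → Vanishes s t u v g → ¬ g ∈ᴸ span s t u v → ∀ α β γ δ → ¬ addsV α β γ δ g ∈ᴸ ws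
    addsV-∉ {s} {t} {u} {v} {g} (vanishes h₁ h₂ h₃ h₄) g∉ α β γ δ i = g∉
      (∈-doubleIf v δ x₄ _ g (λ e → off₄ {g} {α} {β} {γ} {δ} i (h₄ e))
      (∈-doubleIf u γ x₃ _ _ (λ e → off₃ {g} {α} {β} {γ} {δ} i (h₃ e))
      (∈-doubleIf t β x₂ _ _ (λ e → off₂ {g} {α} {β} {γ} {δ} i (h₂ e))
      (∈-doubleIf s α x₁ ws _ (λ e → off₁ {g} {α} {β} {γ} {δ} i (h₁ e)) i))))

    ρ-addV : ∀ α e x → ρ (addV α e x) ≡ addIf α (ρ e) (ρ x)
    ρ-addV false e x = refl
    ρ-addV true e x = ρ-⊕ e x

    ρ-addsV : ∀ α β γ δ g → ρ (addsV α β γ δ g) ≡ adds α β γ δ (ρ x₁) (ρ x₂) (ρ x₃) (ρ x₄) (ρ g)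
    ρ-addsV α β γ δ g = trans (ρ-addV α x₁ _) (cong (addIf α _) (trans (ρ-addV β x₂ _) (cong (addIf β _)
      (trans (ρ-addV γ x₃ _) (cong (addIf γ _) (ρ-addV δ x₄ g))))))

    ρ-0 : ρ 0v ≡ 𝟎
    ρ-0 = trans (cong ρ (sym (⊕-self 0v))) (trans (ρ-⊕ 0v 0v) (trans (⊞-self (ρ 0v)) (zeroRow-replicate (ρ 0v) (ρ-length 0v))))

    0-vanishes : Vanishes false false false false 0v
    0-vanishes = vanishes (λ _ → ev-0 l₁) (λ _ → ev-0 l₂) (λ _ → ev-0 l₃) (λ _ → ev-0 l₄)

    clique : Clique (ρ x₁) (ρ x₂) (ρ x₃) (ρ x₄)
    clique = record
      { la = ρ-length x₁ ; lb = ρ-length x₂ ; lc = ρ-length x₃ ; ld = ρ-length x₄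
      ; cap = λ α β γ δ h → subst (Cap us _) (trans (ρ-addsV α β γ δ 0v) (cong (adds α β γ δ (ρ x₁) (ρ x₂) (ρ x₃) (ρ x₄)) ρ-0))
          (cap-ρ α β γ δ (addsV α β γ δ 0v)
            (λ i → nonempty h (off₁ {0v} {α} {β} {γ} {δ} i (ev-0 l₁)) (off₂ {0v} {α} {β} {γ} {δ} i (ev-0 l₂))
                     (off₃ {0v} {α} {β} {γ} {δ} i (ev-0 l₃)) (off₄ {0v} {α} {β} {γ} {δ} i (ev-0 l₄)))
            (addsV-vanishes 0-vanishes α β γ δ))
      ; ext = λ s t u v h → let g , vg , g∉ = spareFor s t u v (span s t u v)
                                  (subst₂ (λ i j → 4 ^ i * j < 1024) (sym (length-others s t u v)) (sym (length-span s t u v)) (room s t u v h)) in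
          ρ g , ρ-length g , λ α β γ δ → subst (Cap us _)
            (trans (ρ-addsV α β γ δ g) (sym (comb-⊞ α β γ δ (ρ x₁) (ρ x₂) (ρ x₃) (ρ x₄) (ρ g) (ρ-length g))))
            (cap-ρ (s ∨ α) (t ∨ β) (u ∨ γ) (v ∨ δ) (addsV α β γ δ g) (addsV-∉ vg g∉ α β γ δ) (addsV-vanishes vg α β γ δ))
      }
      where
      nonempty : ∀ {α β γ δ} → 1 ≤ # α + (# β + (# γ + # δ)) → ¬ α ≡ true → ¬ β ≡ true → ¬ γ ≡ true → ¬ δ ≡ true → ⊥
      nonempty {true} h a b c d = a refl
      nonempty {false} {true} h a b c d = b refl
      nonempty {false} {false} {true} h a b c d = c refl
      nonempty {false} {false} {false} {true} h a b c d = d refl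

  clique-exists : ∃[ a ] ∃[ b ] ∃[ c ] ∃[ d ] Clique a b c d
  clique-exists =
    -- Three lines have at least 1024 / 4³ = 16 common killers, more than the eight vectors of `ws`.
    let _ , V₁ , ∉₁ = vertex true false false false (≤ᵇ⇒≤ _ _ tt)
        _ , V₂ , ∉₂ = vertex false true false false (≤ᵇ⇒≤ _ _ tt)
        _ , V₃ , ∉₃ = vertex false false true false (≤ᵇ⇒≤ _ _ tt)
        _ , V₄ , ∉₄ = vertex false false false true (≤ᵇ⇒≤ _ _ tt)
    in _ , _ , _ , _ , clique V₁ ∉₁ V₂ ∉₂ V₃ ∉₃ V₄ ∉₄

-- Normal forms

infixr 5 _⇒_
_⇒_ : Bool → Bool → Bool
true ⇒ b = b
false ⇒ b = true

⇒-sound : ∀ {a b} → a ⇒ b ≡ true → a ≡ true → b ≡ true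
⇒-sound h refl = h

allF³ : (F → F → F → Bool) → Bool
allF³ p = allF λ x → allF λ y → allF λ z → p x y z

allF³-sound : ∀ p → allF³ p ≡ true → ∀ x y z → p x y z ≡ true
allF³-sound p h x y z = allF-sound (p x y) (allF-sound (λ y → allF (p x y)) (allF-sound (λ x → allF λ y → allF (p x y)) h x) y) z

≡ᵇ-sound : ∀ m n → (m ≡ᵇ n) ≡ true → m ≡ n
≡ᵇ-sound m n h = ≡ᵇ⇒≡ m n (subst T (sym h) tt)

≡ᵇ-complete : ∀ m n → m ≡ n → (m ≡ᵇ n) ≡ true
≡ᵇ-complete zero _ refl = refl
≡ᵇ-complete (suc m) _ refl = ≡ᵇ-complete m m refl

≤ᵇ-sound : ∀ m n → (m ≤ᵇ n) ≡ true → m ≤ n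
≤ᵇ-sound m n h = ≤ᵇ⇒≤ m n (subst T (sym h) tt)

≤ᵇ-complete : ∀ {m n} → m ≤ n → (m ≤ᵇ n) ≡ true
≤ᵇ-complete z≤n = refl
≤ᵇ-complete (s≤s z≤n) = refl
≤ᵇ-complete (s≤s (s≤s h)) = ≤ᵇ-complete (s≤s h)

anyᴸ : {A : Set} → (A → Bool) → List A → Bool
anyᴸ f [] = false
anyᴸ f (x ∷ xs) = f x ∨ anyᴸ f xs

anyᴸ-sound : {A : Set} (f : A → Bool) (xs : List A) → anyᴸ f xs ≡ true → ∃[ x ] x ∈ᴸ xs × f x ≡ true
anyᴸ-sound f (x ∷ xs) h with ∨-split (f x) h
... | inj₁ e = x , here refl , e
... | inj₂ e = let y , i , e′ = anyᴸ-sound f xs e in y , there i , e′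

everyᴸ-complete : {A : Set} (f : A → Bool) (xs : List A) → All (λ x → f x ≡ true) xs → everyᴸ f xs ≡ true
everyᴸ-complete f [] [] = refl
everyᴸ-complete f (x ∷ xs) (h ∷ hs) = cong₂ _∧_ h (everyᴸ-complete f xs hs)

allTuples : ℕ → (List ℕ → Bool) → Bool
allTuples zero f = f []
allTuples (suc k) f = allTuples k (f ∘ (0 ∷_)) ∧ allTuples k (f ∘ (1 ∷_)) ∧ allTuples k (f ∘ (2 ∷_))

allTuples-sound : ∀ k f → allTuples k f ≡ true → ∀ c → length c ≡ k → All (_≤ 2) c → f c ≡ true
allTuples-sound zero f h [] l cs = h
allTuples-sound (suc k) f h (0 ∷ c) l (_ ∷ cs) = allTuples-sound k _ (∧-splitˡ h) c (suc-injective l) cs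
allTuples-sound (suc k) f h (1 ∷ c) l (_ ∷ cs) =
  allTuples-sound k _ (∧-splitˡ (∧-splitʳ {allTuples k (f ∘ (0 ∷_))} h)) c (suc-injective l) cs
allTuples-sound (suc k) f h (2 ∷ c) l (_ ∷ cs) =
  allTuples-sound k _ (∧-splitʳ {allTuples k (f ∘ (1 ∷_))} (∧-splitʳ {allTuples k (f ∘ (0 ∷_))} h)) c (suc-injective l) cs
allTuples-sound (suc k) f h (suc (suc (suc _)) ∷ c) l (s≤s (s≤s ()) ∷ cs)

-- The nonzero combinations of x, y, z, numbered by binary masks; any other number stands for 0.
combo : {A : Set} → (A → A → A) → A → A → A → ℕ → A
combo _·_ x y z 1 = x
combo _·_ x y z 2 = y
combo _·_ x y z 3 = x · y
combo _·_ x y z 4 = z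
combo _·_ x y z 5 = x · z
combo _·_ x y z 6 = y · z
combo _·_ x y z 7 = x · (y · z)
combo _·_ x y z _ = x · x

combo-closed : {A : Set} (P : A → Set) (_·_ : A → A → A) → (∀ x y → P x → P y → P (x · y)) →
               ∀ x y z → P x → P y → P z → ∀ p → P (combo _·_ x y z p)
combo-closed P _·_ c x y z px py pz 0 = c x x px px
combo-closed P _·_ c x y z px py pz 1 = px
combo-closed P _·_ c x y z px py pz 2 = py
combo-closed P _·_ c x y z px py pz 3 = c x y px py
combo-closed P _·_ c x y z px py pz 4 = pz
combo-closed P _·_ c x y z px py pz 5 = c x z px pz
combo-closed P _·_ c x y z px py pz 6 = c y z py pz
combo-closed P _·_ c x y z px py pz 7 = c x (y · z) px (c y z py pz)
combo-closed P _·_ c x y z px py pz (suc (suc (suc (suc (suc (suc (suc (suc _)))))))) = c x x px px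

points : List ℕ
points = 1 ∷ 2 ∷ 3 ∷ 4 ∷ 5 ∷ 6 ∷ 7 ∷ []

-- The number of nonzero zeros of the linear map from F₂³ to F₂² with values `x`, `y`, `z` on a
-- basis: 1, 3 or 7.
weigh : F → F → F → ℕ
weigh x y z = sum (map (λ p → vanish (combo _⊹_ x y z p)) points)

special : F → F → F → Bool
special x y z = isZ x ∧ isZ y ∧ not (isZ z)

-- For a map of weight 1, the mask of its only nonzero zero; 8 for a map whose kernel is the plane
-- of the first two basis vectors.
kind : F → F → F → ℕ
kind x y z = if special x y z then 8 else first points
  where
  first : List ℕ → ℕ
  first [] = 0
  first (p ∷ ps) = if isZ (combo _⊹_ x y z p) then p else first ps

-- The values on the three basis vectors of one chosen map of each kind. Maps to F₂² with the same
-- kernel differ by an element of GL(2,2), so a change of basis in its column brings each line of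
-- that kind to this form.
col₁ col₂ col₃ : ℕ → F
col₁ 1 = e₀
col₁ 5 = e₂
col₁ 7 = e₃
col₁ 8 = e₀
col₁ _ = e₁
col₂ 2 = e₀
col₂ 4 = e₂
col₂ 6 = e₂
col₂ 8 = e₀
col₂ _ = e₁
col₃ 4 = e₀
col₃ 8 = e₁
col₃ _ = e₂

straightens : ℕ → F → F → F → GL → Bool
straightens k x y z m = invertible m ∧ act m x == col₁ k ∧ act m y == col₂ k ∧ act m z == col₃ k

straighten : F → F → F → GL
straighten x y z = first-straight (gl e₁ e₂ ∷ gl e₁ e₃ ∷ gl e₂ e₁ ∷ gl e₂ e₃ ∷ gl e₃ e₁ ∷ gl e₃ e₂ ∷ [])
  where
  first-straight : List GL → GL
  first-straight [] = gl e₁ e₂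
  first-straight (m ∷ ms) = if straightens (kind x y z) x y z m then m else first-straight ms

straightenable : F → F → F → Bool
straightenable x y z = (weigh x y z ≡ᵇ 1) ∨ special x y z

straighten-sound : ∀ x y z → straightenable x y z ≡ true → straightens (kind x y z) x y z (straighten x y z) ≡ true
straighten-sound x y z = ⇒-sound
  (allF³-sound (λ x y z → straightenable x y z ⇒ straightens (kind x y z) x y z (straighten x y z)) refl x y z)

kind-cover : ∀ x y z → (weigh x y z ≡ᵇ 1) ≡ true → All (λ p → # (p ≡ᵇ kind x y z) ≡ vanish (combo _⊹_ x y z p)) points
kind-cover x y z h = everyᴸ-sound (λ p → # (p ≡ᵇ kind x y z) ≡ᵇ vanish (combo _⊹_ x y z p)) (λ p → ≡ᵇ-sound _ _) points
  (⇒-sound (allF³-sound (λ x y z → (weigh x y z ≡ᵇ 1) ⇒ everyᴸ (λ p → # (p ≡ᵇ kind x y z) ≡ᵇ vanish (combo _⊹_ x y z p)) points) refl x y z) h)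

weigh-values : ∀ x y z → 1 ≤ weigh x y z × ((weigh x y z ≡ᵇ 1) ≡ false → 3 ≤ weigh x y z)
weigh-values x y z with ∨-split (weigh x y z ≡ᵇ 1) (allF³-sound (λ x y z → (weigh x y z ≡ᵇ 1) ∨ (3 ≤ᵇ weigh x y z)) refl x y z)
... | inj₁ e = ≤-reflexive (sym (≡ᵇ-sound _ 1 e)) , λ e′ → case-⊥ (trans (sym e) e′)
  where
  case-⊥ : true ≡ false → 3 ≤ weigh x y z
  case-⊥ ()
... | inj₂ e = ≤-trans (s≤s z≤n) (≤ᵇ-sound 3 _ e) , λ _ → ≤ᵇ-sound 3 _ e

occ : ℕ → List ℕ → ℕ
occ q [] = 0
occ q (k ∷ ks) = # (q ≡ᵇ k) + occ q ks

occ-↭ : {A : Set} (f : A → ℕ) (q : ℕ) {xs ys : List A} → xs ↭ ys → occ q (map f xs) ≡ occ q (map f ys)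
occ-↭ f q Perm.refl = refl
occ-↭ f q (Perm.prep x p) = cong (# (q ≡ᵇ f x) +_) (occ-↭ f q p)
occ-↭ f q (Perm.swap x y p) = trans (+-swap (# (q ≡ᵇ f x)) (# (q ≡ᵇ f y)) _)
  (cong (λ m → # (q ≡ᵇ f y) + (# (q ≡ᵇ f x) + m)) (occ-↭ f q p))
occ-↭ f q (Perm.trans p r) = trans (occ-↭ f q p) (occ-↭ f q r)

pull : {A : Set} (f : A → ℕ) (q : ℕ) (xs : List A) → 1 ≤ occ q (map f xs) → ∃[ x ] ∃[ ys ] xs ↭ x ∷ ys × f x ≡ q
pull f q (x ∷ xs) h with q ≡ᵇ f x in e
... | true = x , xs , ↭-refl , sym (≡ᵇ-sound q (f x) e)
... | false = let y , ys , p , r = pull f q xs h in y , x ∷ ys , ↭-trans (prep x p) (Perm.swap x y ↭-refl) , r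

arrange : {A : Set} (f : A → ℕ) (ks : List ℕ) (xs : List A) → length xs ≡ length ks →
          (∀ q → occ q ks ≤ occ q (map f xs)) → ∃[ ys ] xs ↭ ys × map f ys ≡ ks
arrange f [] [] l h = [] , ↭-refl , refl
arrange f (k ∷ ks) xs l h with pull f k xs (≤-trans (≤-trans (≤-reflexive (cong # (sym (≡ᵇ-complete k k refl)))) (m≤m+n _ _)) (h k))
... | x , ys , p , refl =
  let zs , r , e = arrange f ks ys (suc-injective (trans (sym (↭-length p)) l))
                     (λ q → +-cancelˡ-≤ (# (q ≡ᵇ f x)) _ _ (subst (# (q ≡ᵇ f x) + occ q ks ≤_) (occ-↭ f q p) (h q)))
  in x ∷ zs , ↭-trans p (prep x r) , cong (f x ∷_) e

zeros-↭ : ∀ {n} (a : F₂^ n) {ls ls′ : List (Pair n)} → ls ↭ ls′ → zeros (evs ls a) ≡ zeros (evs ls′ a)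
zeros-↭ a Perm.refl = refl
zeros-↭ a (Perm.prep l p) = cong (vanish (ev l a) +_) (zeros-↭ a p)
zeros-↭ a (Perm.swap l m p) = trans (+-swap (vanish (ev l a)) (vanish (ev m a)) _)
  (cong (λ k → vanish (ev m a) + (vanish (ev l a) + k)) (zeros-↭ a p))
zeros-↭ a (Perm.trans p q) = trans (zeros-↭ a p) (zeros-↭ a q)

sum-+ : (f g : ℕ → ℕ) (ps : List ℕ) → sum (map (λ p → f p + g p) ps) ≡ sum (map f ps) + sum (map g ps)
sum-+ f g [] = refl
sum-+ f g (p ∷ ps) = trans (cong (f p + g p +_) (sum-+ f g ps)) (+-interchange (f p) (g p) _ _)

sumsV : ∀ {n} → F₂^ n → List (F₂^ n) → List (F₂^ n)
sumsV z [] = z ∷ []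
sumsV z (e ∷ es) = sumsV z es ++ map (e ⊕_) (sumsV z es)

sumsV-rows : ∀ {n} (ρ : F₂^ n → Row) → (∀ a b → ρ (a ⊕ b) ≡ ρ a ⊞ ρ b) → ∀ z es → map ρ (sumsV z es) ≡ sums (ρ z) (map ρ es)
sumsV-rows ρ ρ-⊕ z [] = refl
sumsV-rows ρ ρ-⊕ z (e ∷ es) = trans (map-++ ρ (sumsV z es) _) (cong₂ _++_ (sumsV-rows ρ ρ-⊕ z es)
  (trans (sym (map-∘ (sumsV z es))) (trans (map-cong (ρ-⊕ e) (sumsV z es))
    (trans (map-∘ (sumsV z es)) (cong (map (ρ e ⊞_)) (sumsV-rows ρ ρ-⊕ z es))))))

sumsV-closed : ∀ {n} (P : F₂^ n → Set) → (∀ a b → P a → P b → P (a ⊕ b)) → ∀ z es → P z → All P es → All P (sumsV z es)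
sumsV-closed P c z [] pz [] = pz ∷ []
sumsV-closed P c z (e ∷ es) pz (pe ∷ pes) =
  let ps = sumsV-closed P c z es pz pes in ++⁺ ps (map⁺ (All.map (λ {a} pa → c e a pe pa) ps))

record Refuted (ks : List ℕ) : Set where
  field
    C : Ctx
    V : Valid C 11
    eleven : length ks ≡ 11
    rows-U : U C ≡ sums (zeroRow (map col₁ ks)) (map col₁ ks ∷ map col₂ ks ∷ map col₃ ks ∷ [])
    refuted : ∀ a b c d → ¬ Search.Clique C 11 V a b c d

-- All entries are masks from 1 to 7, so the seven counts determine the list up to order.
record Regular (ks : List ℕ) : Set where
  field
    none-0 : occ 0 ks ≡ 0
    none-8 : ∀ q → occ (8 + q) ks ≡ 0
    total : sum (map (λ p → occ p ks) points) ≡ length ks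

module Config {n} (2^n : 2 ^ n ≡ 1024) (l₁ l₂ l₃ l₄ : Pair n) where

  four : List (Pair n)
  four = l₁ ∷ l₂ ∷ l₃ ∷ l₄ ∷ []

  kills-⊕ : ∀ a b → kills four a ≡ true → kills four b ≡ true → kills four (a ⊕ b) ≡ true
  kills-⊕ a b ha hb = trans (kills-saturated four a b ha) hb

  kills-0 : kills four 0v ≡ true
  kills-0 rewrite ev-0 l₁ | ev-0 l₂ | ev-0 l₃ | ev-0 l₄ = refl

  Covered : List (Pair n) → Set
  Covered R = ∀ a → a ≢ 0v → zeros (evs (l₁ ∷ l₂ ∷ l₃ ∷ l₄ ∷ R) a) ≤ 6

  Covered-↭ : ∀ {R R′} → R ↭ R′ → Covered R → Covered R′
  Covered-↭ p cov a a≢0 = subst (_≤ 6) (zeros-↭ a (prep l₁ (prep l₂ (prep l₃ (prep l₄ p))))) (cov a a≢0)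

  module Frame (u₁ u₂ u₃ : F₂^ n) where

    pt : ℕ → F₂^ n
    pt = combo _⊕_ u₁ u₂ u₃

    on : {A : Set} → (F → F → F → A) → Pair n → A
    on f l = f (ev l u₁) (ev l u₂) (ev l u₃)

    ev-pt : ∀ l p → ev l (pt p) ≡ on (combo _⊹_) l p
    ev-pt l 0 = ev-⊕ l u₁ u₁
    ev-pt l 1 = refl
    ev-pt l 2 = refl
    ev-pt l 3 = ev-⊕ l u₁ u₂
    ev-pt l 4 = refl
    ev-pt l 5 = ev-⊕ l u₁ u₃
    ev-pt l 6 = ev-⊕ l u₂ u₃
    ev-pt l 7 = trans (ev-⊕ l u₁ (u₂ ⊕ u₃)) (cong (ev l u₁ ⊹_) (ev-⊕ l u₂ u₃))
    ev-pt l (suc (suc (suc (suc (suc (suc (suc (suc _)))))))) = ev-⊕ l u₁ u₁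

    cover : List (Pair n) → ℕ → ℕ
    cover R p = zeros (evs R (pt p))

    cover-↭ : ∀ {R R′} → R ↭ R′ → ∀ p → cover R p ≡ cover R′ p
    cover-↭ q p = zeros-↭ (pt p) q

    -- Double counting of the pairs of a point of `U` and a line killed by it.
    sum-cover : ∀ R → sum (map (cover R) points) ≡ sum (map (on weigh) R)
    sum-cover [] = refl
    sum-cover (l ∷ R) = trans (sum-+ (λ p → vanish (ev l (pt p))) (cover R) points)
      (cong₂ _+_ (cong sum (map-cong (λ p → cong vanish (ev-pt l p)) points)) (sum-cover R))

    ρ : List (Pair n) → F₂^ n → Row
    ρ R a = map (λ l → act (on straighten l) (ev l a)) R

    ρ-⊕ : ∀ R a b → ρ R (a ⊕ b) ≡ ρ R a ⊞ ρ R b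
    ρ-⊕ [] a b = refl
    ρ-⊕ (l ∷ R) a b = cong₂ _∷_ (trans (cong (act (on straighten l)) (ev-⊕ l a b)) (act-⊹ (on straighten l) (ev l a) (ev l b))) (ρ-⊕ R a b)

    Straight : Pair n → Set
    Straight l = on straightenable l ≡ true

    zeros-ρ : ∀ R → All Straight R → ∀ a → zeros (ρ R a) ≡ zeros (evs R a)
    zeros-ρ [] [] a = refl
    zeros-ρ (l ∷ R) (s ∷ ss) a = cong₂ _+_
      (vanish-act (on straighten l) (∧-splitˡ (straighten-sound (ev l u₁) (ev l u₂) (ev l u₃) s)) (ev l a)) (zeros-ρ R ss a)

    ρ-basis : ∀ R → All Straight R → ρ R u₁ ≡ map col₁ (map (on kind) R) × ρ R u₂ ≡ map col₂ (map (on kind) R) × ρ R u₃ ≡ map col₃ (map (on kind) R)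
    ρ-basis [] [] = refl , refl , refl
    ρ-basis (l ∷ R) (s ∷ ss) =
      let i₁ , i₂ , i₃ = ρ-basis R ss
          h₁ = ∧-splitʳ {invertible m} (straighten-sound x y z s)
          h₂ = ∧-splitʳ {act m x == col₁ k} h₁
      in cong₂ _∷_ (==-sound _ _ (∧-splitˡ h₁)) i₁ , cong₂ _∷_ (==-sound _ _ (∧-splitˡ h₂)) i₂ ,
         cong₂ _∷_ (==-sound _ _ (∧-splitʳ {act m y == col₂ k} h₂)) i₃
      where
      x = ev l u₁
      y = ev l u₂
      z = ev l u₃
      m = straighten x y z
      k = kind x y z

    Killing : Set
    Killing = kills four u₁ ≡ true × kills four u₂ ≡ true × kills four u₃ ≡ true

    pt-kills : Killing → ∀ p → kills four (pt p) ≡ true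
    pt-kills (k₁ , k₂ , k₃) = combo-closed (λ a → kills four a ≡ true) _⊕_ kills-⊕ u₁ u₂ u₃ k₁ k₂ k₃

    refute-arranged : ∀ {ks} → Refuted ks → Killing → ∀ R → Covered R → All Straight R → map (on kind) R ≡ ks → ⊥
    refute-arranged {ks} X (k₁ , k₂ , k₃) R cov ss refl = let a , b , c , d , K = clique-exists in refuted a b c d K
      where
      open Refuted X
      ws = sumsV 0v (u₁ ∷ u₂ ∷ u₃ ∷ [])
      basis-rows = ρ-basis R ss
      open Chart 2^n C V l₁ l₂ l₃ l₄ (ρ R)
        (λ a → trans (length-map _ R) (trans (sym (length-map (on kind) R)) eleven)) (ρ-⊕ R)
        (λ a a≢0 → subst (λ m → vanish (ev l₁ a) + (vanish (ev l₂ a) + (vanish (ev l₃ a) + (vanish (ev l₄ a) + m))) ≤ 6)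
          (sym (zeros-ρ R ss a)) (cov a a≢0))
        ws refl (All.lookup (sumsV-closed (λ a → kills four a ≡ true) kills-⊕ 0v _ kills-0 (k₁ ∷ k₂ ∷ k₃ ∷ [])))
        (trans rows-U (sym (trans (sumsV-rows (ρ R) (ρ-⊕ R) 0v (u₁ ∷ u₂ ∷ u₃ ∷ []))
          (cong₂ sums
            (trans (trans (cong (ρ R) (sym (⊕-self u₁))) (trans (ρ-⊕ R u₁ u₁) (⊞-self (ρ R u₁)))) (cong zeroRow (proj₁ basis-rows)))
            (cong₂ _∷_ (proj₁ basis-rows) (cong₂ _∷_ (proj₁ (proj₂ basis-rows)) (cong₂ _∷_ (proj₂ (proj₂ basis-rows)) (refl {x = []}))))))))

    refute-kinds : ∀ {ks} → Refuted ks → Killing → ∀ R → Covered R → length R ≡ length ks → All Straight R →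
                   (∀ q → occ q ks ≤ occ q (map (on kind) R)) → ⊥
    refute-kinds {ks} X K R cov l ss h =
      let R′ , p , e = arrange (on kind) ks R l h in refute-arranged X K R′ (Covered-↭ p cov) (All-resp-↭ p ss) e

    Ordinary : Pair n → Set
    Ordinary l = (on weigh l ≡ᵇ 1) ≡ true

    Ordinary⇒Straight : ∀ {l} → Ordinary l → Straight l
    Ordinary⇒Straight {l} h rewrite h = refl

    length≤weight : ∀ R → length R ≤ sum (map (on weigh) R)
    length≤weight [] = z≤n
    length≤weight (l ∷ R) = +-mono-≤ (proj₁ (weigh-values (ev l u₁) (ev l u₂) (ev l u₃))) (length≤weight R)

    ordinary : ∀ R → sum (map (on weigh) R) ≤ length R → All Ordinary R
    ordinary [] h = []
    ordinary (l ∷ R) h =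
      ≡ᵇ-complete _ 1 (≤-antisym (+-cancelʳ-≤ (length R) _ 1 (≤-trans (+-monoʳ-≤ (on weigh l) (length≤weight R)) h)) 1≤) ∷
      ordinary R (+-cancelˡ-≤ 1 _ _ (≤-trans (+-monoˡ-≤ _ 1≤) h))
      where 1≤ = proj₁ (weigh-values (ev l u₁) (ev l u₂) (ev l u₃))

    weight≡length : ∀ R → All Ordinary R → sum (map (on weigh) R) ≡ length R
    weight≡length [] [] = refl
    weight≡length (l ∷ R) (o ∷ os) = cong₂ _+_ (≡ᵇ-sound _ 1 o) (weight≡length R os)

    occ-cover : ∀ R → All Ordinary R → All (λ p → occ p (map (on kind) R) ≡ cover R p) points
    occ-cover [] [] = refl ∷ refl ∷ refl ∷ refl ∷ refl ∷ refl ∷ refl ∷ []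
    occ-cover (l ∷ R) (o ∷ os) = All.zipWith
      (λ {p} (e , i) → cong₂ _+_ (trans e (cong vanish (sym (ev-pt l p)))) i) (kind-cover _ _ _ o , occ-cover R os)

    pick-special : ∀ R → All Ordinary R ⊎ ∃[ l ] ∃[ R′ ] R ↭ l ∷ R′ × 3 ≤ on weigh l
    pick-special [] = inj₁ []
    pick-special (l ∷ R) with on weigh l ≡ᵇ 1 in e
    ... | false = inj₂ (l , R , ↭-refl , proj₂ (weigh-values (ev l u₁) (ev l u₂) (ev l u₃)) e)
    ... | true with pick-special R
    ... | inj₁ os = inj₁ (e ∷ os)
    ... | inj₂ (l′ , R′ , p , h) = inj₂ (l′ , l ∷ R′ , ↭-trans (prep l p) (Perm.swap l l′ ↭-refl) , h)

    -- The counts add up to the number of lines, so every line has weight exactly 1; the count at a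
    -- point is then the number of lines of that kind.
    arranged : ∀ {ks} → Regular ks → ∀ R → length R ≡ length ks → All (λ p → cover R p ≡ occ p ks) points →
               All Ordinary R × (∀ q → occ q ks ≤ occ q (map (on kind) R))
    arranged {ks} reg R l cs = os , below
      where
      open Regular reg
      os = ordinary R (≤-reflexive (trans (sym (sum-cover R)) (trans (cong sum (map-cong-local cs)) (trans total (sym l)))))
      hs = All.zipWith (λ (e , c) → ≤-reflexive (sym (trans e c))) (occ-cover R os , cs)
      below : ∀ q → occ q ks ≤ occ q (map (on kind) R)
      below 0 = subst (_≤ _) (sym none-0) z≤n
      below 1 = All.lookup hs (here refl)
      below 2 = All.lookup hs (there (here refl))
      below 3 = All.lookup hs (there (there (here refl)))
      below 4 = All.lookup hs (there (there (there (here refl))))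
      below 5 = All.lookup hs (there (there (there (there (here refl)))))
      below 6 = All.lookup hs (there (there (there (there (there (here refl))))))
      below 7 = All.lookup hs (there (there (there (there (there (there (here refl)))))))
      below (suc (suc (suc (suc (suc (suc (suc (suc q)))))))) = subst (_≤ _) (sym (none-8 q)) z≤n

    refute-generic : ∀ {ks} → Refuted ks → Regular ks → Killing → ∀ R → Covered R → length R ≡ length ks →
                     All (λ p → cover R p ≡ occ p ks) points → ⊥
    refute-generic X reg K R cov l cs =
      let os , h = arranged reg R l cs in refute-kinds X K R cov l (All.map (λ {l} → Ordinary⇒Straight {l}) os) h

    refute-special : ∀ {ks} → Refuted (8 ∷ ks) → Regular ks → Killing → ∀ s R → Covered (s ∷ R) → length R ≡ length ks →
                     All (λ p → cover R p ≡ occ p ks) points → on special s ≡ true → ⊥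
    refute-special {ks} X reg K s R cov l cs sp =
      let os , h = arranged reg R l cs in
      refute-kinds X K (s ∷ R) cov (cong suc l) (straight ∷ All.map (λ {l} → Ordinary⇒Straight {l}) os)
        λ q → subst (λ k → # (q ≡ᵇ 8) + occ q ks ≤ # (q ≡ᵇ k) + occ q (map (on kind) R)) (sym kind-8) (+-monoʳ-≤ (# (q ≡ᵇ 8)) (h q))
      where
      straight : Straight s
      straight rewrite sp = ∨-zeroʳ _
      kind-8 : on kind s ≡ 8
      kind-8 rewrite sp = refl

-- Bitwise exclusive or of three-bit masks, which is the addition of points in the numbering of
-- `combo`.
_⊻_ : ℕ → ℕ → ℕ
m ⊻ n = (m + n) % 2 + (2 * ((m / 2 + n / 2) % 2) + 4 * ((m / 4 + n / 4) % 2))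

masks : List ℕ
masks = 0 ∷ points

nth : List ℕ → ℕ → ℕ
nth [] p = 0
nth (x ∷ xs) zero = x
nth (x ∷ xs) (suc p) = nth xs p

nth-masks : ∀ f p → (p <ᵇ 8) ≡ true → nth (map f masks) p ≡ f p
nth-masks f 0 h = refl
nth-masks f 1 h = refl
nth-masks f 2 h = refl
nth-masks f 3 h = refl
nth-masks f 4 h = refl
nth-masks f 5 h = refl
nth-masks f 6 h = refl
nth-masks f 7 h = refl

identity : ℕ → ℕ → ℕ → ℕ → F → F → F → Bool
identity m₁ m₂ m₃ p x y z =
  combo _⊹_ (combo _⊹_ x y z m₁) (combo _⊹_ x y z m₂) (combo _⊹_ x y z m₃) p == combo _⊹_ x y z (combo _⊻_ m₁ m₂ m₃ p)

agrees : List ℕ → ℕ → ℕ → ℕ → List ℕ → ℕ → Bool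
agrees cs m₁ m₂ m₃ ks p = (nth cs (combo _⊻_ m₁ m₂ m₃ p) ≡ᵇ occ p ks) ∧ (combo _⊻_ m₁ m₂ m₃ p <ᵇ 8) ∧ allF³ (identity m₁ m₂ m₃ p)

matches : List ℕ → ℕ → ℕ → ℕ → List ℕ → Bool
matches cs m₁ m₂ m₃ ks = everyᴸ (agrees cs m₁ m₂ m₃ ks) points

record Agrees (cs : List ℕ) (m₁ m₂ m₃ : ℕ) (ks : List ℕ) (p : ℕ) : Set where
  constructor agreed
  field
    value : nth cs (combo _⊻_ m₁ m₂ m₃ p) ≡ occ p ks
    in-range : (combo _⊻_ m₁ m₂ m₃ p <ᵇ 8) ≡ true
    linear : ∀ x y z → combo _⊹_ (combo _⊹_ x y z m₁) (combo _⊹_ x y z m₂) (combo _⊹_ x y z m₃) p ≡ combo _⊹_ x y z (combo _⊻_ m₁ m₂ m₃ p)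

agrees-sound : ∀ cs m₁ m₂ m₃ ks p → agrees cs m₁ m₂ m₃ ks p ≡ true → Agrees cs m₁ m₂ m₃ ks p
agrees-sound cs m₁ m₂ m₃ ks p h = agreed (≡ᵇ-sound _ _ (∧-splitˡ h)) (∧-splitˡ {q <ᵇ 8} h′)
  λ x y z → ==-sound _ _ (allF³-sound (identity m₁ m₂ m₃ p) (∧-splitʳ {q <ᵇ 8} h′) x y z)
  where
  q = combo _⊻_ m₁ m₂ m₃ p
  h′ : (q <ᵇ 8) ∧ allF³ (identity m₁ m₂ m₃ p) ≡ true
  h′ = ∧-splitʳ {nth cs q ≡ᵇ occ p ks} h

-- The masks `m₁`, `m₂`, `m₃` describe a new basis in which the counts become those of `ks`. Entry 0
-- of `cs` is the number of all lines, as the zero vector kills them all; no count of `ks` is that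
-- large, so dependent masks never match. Testing `m₁` and `m₂` early prunes the search.
findBasis : (List ℕ → ℕ → ℕ → ℕ → Bool) → List (List ℕ) → List ℕ → Bool
findBasis f kss cs = anyᴸ (λ ks → anyᴸ (λ m₁ → (nth cs m₁ ≡ᵇ occ 1 ks) ∧ anyᴸ (λ m₂ → (nth cs m₂ ≡ᵇ occ 2 ks) ∧
  anyᴸ (λ m₃ → f ks m₁ m₂ m₃ ∧ matches cs m₁ m₂ m₃ ks) points) points) points) kss

findBasis-sound : ∀ f kss cs → findBasis f kss cs ≡ true →
                  ∃[ ks ] ks ∈ᴸ kss × ∃[ m₁ ] ∃[ m₂ ] ∃[ m₃ ] f ks m₁ m₂ m₃ ≡ true × All (Agrees cs m₁ m₂ m₃ ks) points
findBasis-sound f kss cs h =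
  let ks , i , h₀ = anyᴸ-sound (λ ks → anyᴸ (λ m₁ → (nth cs m₁ ≡ᵇ occ 1 ks) ∧ anyᴸ (λ m₂ → (nth cs m₂ ≡ᵇ occ 2 ks) ∧
                      anyᴸ (λ m₃ → f ks m₁ m₂ m₃ ∧ matches cs m₁ m₂ m₃ ks) points) points) points) kss h
      m₁ , _ , h₁ = anyᴸ-sound (λ m₁ → (nth cs m₁ ≡ᵇ occ 1 ks) ∧ anyᴸ (λ m₂ → (nth cs m₂ ≡ᵇ occ 2 ks) ∧
                      anyᴸ (λ m₃ → f ks m₁ m₂ m₃ ∧ matches cs m₁ m₂ m₃ ks) points) points) points h₀
      m₂ , _ , h₂ = anyᴸ-sound (λ m₂ → (nth cs m₂ ≡ᵇ occ 2 ks) ∧ anyᴸ (λ m₃ → f ks m₁ m₂ m₃ ∧ matches cs m₁ m₂ m₃ ks) points) points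
                      (∧-splitʳ {nth cs m₁ ≡ᵇ occ 1 ks} h₁)
      m₃ , _ , h₃ = anyᴸ-sound (λ m₃ → f ks m₁ m₂ m₃ ∧ matches cs m₁ m₂ m₃ ks) points (∧-splitʳ {nth cs m₂ ≡ᵇ occ 2 ks} h₂)
  in ks , i , m₁ , m₂ , m₃ , ∧-splitˡ {f ks m₁ m₂ m₃} h₃ ,
     everyᴸ-sound (agrees cs m₁ m₂ m₃ ks) (agrees-sound cs m₁ m₂ m₃ ks) points (∧-splitʳ {f ks m₁ m₂ m₃} h₃)

-- The numbers of lines vanishing exactly at each of the seven points of U, up to the choice of a basis
-- of U: three points are deficient by one (collinear or not), or one by two and another by one.
ks-coll ks-tri ks-mixed ks-in ks-out : List ℕ
ks-coll = 1 ∷ 2 ∷ 3 ∷ 4 ∷ 4 ∷ 5 ∷ 5 ∷ 6 ∷ 6 ∷ 7 ∷ 7 ∷ []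
ks-tri = 1 ∷ 2 ∷ 3 ∷ 3 ∷ 4 ∷ 5 ∷ 5 ∷ 6 ∷ 6 ∷ 7 ∷ 7 ∷ []
ks-mixed = 2 ∷ 3 ∷ 3 ∷ 4 ∷ 4 ∷ 5 ∷ 5 ∷ 6 ∷ 6 ∷ 7 ∷ 7 ∷ []
-- Beside one line vanishing on the plane {1, 2, 3}, one further point is deficient, inside or outside it.
ks-in = 2 ∷ 3 ∷ 4 ∷ 4 ∷ 5 ∷ 5 ∷ 6 ∷ 6 ∷ 7 ∷ 7 ∷ []
ks-out = 1 ∷ 2 ∷ 3 ∷ 4 ∷ 5 ∷ 5 ∷ 6 ∷ 6 ∷ 7 ∷ 7 ∷ []

kss kss′ : List (List ℕ)
kss = ks-coll ∷ ks-tri ∷ ks-mixed ∷ []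
kss′ = ks-in ∷ ks-out ∷ []

settles : List (List ℕ) → List ℕ → Bool
settles kss c = (sum c ≡ᵇ 11) ⇒ findBasis (λ _ _ _ _ → true) kss (11 ∷ c)

settles-sound : ∀ kss → allTuples 7 (settles kss) ≡ true → ∀ c → length c ≡ 7 → All (_≤ 2) c → sum c ≡ 11 →
                ∃[ ks ] ks ∈ᴸ kss × ∃[ m₁ ] ∃[ m₂ ] ∃[ m₃ ] All (Agrees (11 ∷ c) m₁ m₂ m₃ ks) points
settles-sound kss h c l cs s =
  let ks , i , m₁ , m₂ , m₃ , _ , e = findBasis-sound (λ _ _ _ _ → true) kss (11 ∷ c)
        (⇒-sound {sum c ≡ᵇ 11} (allTuples-sound 7 (settles kss) h c l cs) (≡ᵇ-complete (sum c) 11 s))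
  in ks , i , m₁ , m₂ , m₃ , e

-- The exceptional line, with values `x`, `y`, `z`, and the ten others share the bound two at each
-- point.
fitsPlane : F → F → F → List ℕ → Bool
fitsPlane x y z c = everyᴸ (λ p → vanish (combo _⊹_ x y z p) + nth (10 ∷ c) p ≤ᵇ 2) points

fitsPlane-complete : ∀ x y z f → All (λ p → vanish (combo _⊹_ x y z p) + f p ≤ 2) points → fitsPlane x y z (map f points) ≡ true
fitsPlane-complete x y z f (h₁ ∷ h₂ ∷ h₃ ∷ h₄ ∷ h₅ ∷ h₆ ∷ h₇ ∷ []) =
  everyᴸ-complete (λ p → vanish (combo _⊹_ x y z p) + nth (10 ∷ map f points) p ≤ᵇ 2) points
    (≤ᵇ-complete h₁ ∷ ≤ᵇ-complete h₂ ∷ ≤ᵇ-complete h₃ ∷ ≤ᵇ-complete h₄ ∷ ≤ᵇ-complete h₅ ∷ ≤ᵇ-complete h₆ ∷ ≤ᵇ-complete h₇ ∷ [])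

specialIn : F → F → F → ℕ → ℕ → ℕ → Bool
specialIn x y z m₁ m₂ m₃ = special (combo _⊹_ x y z m₁) (combo _⊹_ x y z m₂) (combo _⊹_ x y z m₃)

settles′ : List (List ℕ) → F → F → F → List ℕ → Bool
settles′ kss x y z c = (sum c ≡ᵇ 10) ⇒ fitsPlane x y z c ⇒ findBasis (λ _ → specialIn x y z) kss (10 ∷ c)

settles-all′ : List (List ℕ) → F → F → F → Bool
settles-all′ kss x y z = (3 ≤ᵇ weigh x y z) ⇒ allTuples 7 (settles′ kss x y z)

settles′-sound : ∀ kss → allF³ (settles-all′ kss) ≡ true → ∀ x y z → 3 ≤ weigh x y z → ∀ c → length c ≡ 7 → All (_≤ 2) c →
                 sum c ≡ 10 → fitsPlane x y z c ≡ true →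
                 ∃[ ks ] ks ∈ᴸ kss × ∃[ m₁ ] ∃[ m₂ ] ∃[ m₃ ] specialIn x y z m₁ m₂ m₃ ≡ true × All (Agrees (10 ∷ c) m₁ m₂ m₃ ks) points
settles′-sound kss h x y z w c l cs s p = findBasis-sound (λ _ → specialIn x y z) kss (10 ∷ c)
  (⇒-sound {fitsPlane x y z c} (⇒-sound {sum c ≡ᵇ 10} (allTuples-sound 7 (settles′ kss x y z)
    (⇒-sound {3 ≤ᵇ weigh x y z} (allF³-sound (settles-all′ kss) h x y z) (≤ᵇ-complete w)) c l cs) (≡ᵇ-complete (sum c) 10 s)) p)

settled : allTuples 7 (settles kss) ≡ true
settled = refl

settled′ : allF³ (settles-all′ kss′) ≡ true
settled′ = refl

zeros-kills : ∀ {n} (ls R : List (Pair n)) a → kills ls a ≡ true → zeros (evs (ls ++ R) a) ≡ length ls + zeros (evs R a)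
zeros-kills [] R a h = refl
zeros-kills (l ∷ ls) R a h =
  cong₂ _+_ (cong vanish (isZ-sound _ (∧-splitˡ h))) (zeros-kills ls R a (∧-splitʳ {isZ (ev l a)} h))

sum-bounded : ∀ k (f : ℕ → ℕ) ps → All (λ p → f p ≤ k) ps → sum (map f ps) ≤ length ps * k
sum-bounded k f [] [] = z≤n
sum-bounded k f (p ∷ ps) (h ∷ hs) = +-mono-≤ h (sum-bounded k f ps hs)

special-cong : ∀ {x y z x′ y′ z′} → x ≡ x′ → y ≡ y′ → z ≡ z′ → special x′ y′ z′ ≡ true → special x y z ≡ true
special-cong refl refl refl h = h

module Normalise {n} (2^n : 2 ^ n ≡ 1024) (l₁ l₂ l₃ l₄ : Pair n)
  (generic : ∀ {ks} → ks ∈ᴸ kss → Refuted ks × Regular ks × length ks ≡ 11)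
  (exceptional : ∀ {ks} → ks ∈ᴸ kss′ → Refuted (8 ∷ ks) × Regular ks × length ks ≡ 10) where

  open Config 2^n l₁ l₂ l₃ l₄

  module _ (u₁ u₂ u₃ : F₂^ n) where
    open Frame u₁ u₂ u₃

    module _ (R : List (Pair n)) (m₁ m₂ m₃ : ℕ) where
      private module G = Frame (pt m₁) (pt m₂) (pt m₃)

      covers-match : ∀ {k ks} → cover R 0 ≡ k → All (Agrees (k ∷ map (cover R) points) m₁ m₂ m₃ ks) points →
                     All (λ p → G.cover R p ≡ occ p ks) points
      covers-match refl = All.map λ {p} (agreed value in-range linear) →
        trans (cong zeros (map-cong (λ l → trans (G.ev-pt l p) (trans
            (trans (cong₂ (λ x y → combo _⊹_ x y (ev l (pt m₃)) p) (ev-pt l m₁) (ev-pt l m₂))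
              (cong (λ z → combo _⊹_ (on (combo _⊹_) l m₁) (on (combo _⊹_) l m₂) z p) (ev-pt l m₃)))
            (trans (linear (ev l u₁) (ev l u₂) (ev l u₃)) (sym (ev-pt l (combo _⊻_ m₁ m₂ m₃ p)))))) R))
          (trans (sym (nth-masks (cover R) (combo _⊻_ m₁ m₂ m₃ p) in-range)) value)

      special-match : ∀ s → specialIn (ev s u₁) (ev s u₂) (ev s u₃) m₁ m₂ m₃ ≡ true → G.on special s ≡ true
      special-match s = special-cong {ev s (pt m₁)} {ev s (pt m₂)} {ev s (pt m₃)} {on (combo _⊹_) s m₁} {on (combo _⊹_) s m₂} {on (combo _⊹_) s m₃} (ev-pt s m₁) (ev-pt s m₂) (ev-pt s m₃)

    cover-0 : ∀ R → cover R 0 ≡ length R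
    cover-0 R = trans (cong (λ a → zeros (evs R a)) (⊕-self u₁)) (zeros-evs-0 R)

    module _ (K : Killing) (R : List (Pair n)) (cov : Covered R) (11-lines : length R ≡ 11) (nonzero : All (λ p → pt p ≢ 0v) points) where

      cover≤2 : All (λ p → cover R p ≤ 2) points
      cover≤2 = All.map (λ {p} p≢0 → +-cancelˡ-≤ 4 _ _ (subst (_≤ 6) (zeros-kills four R (pt p) (pt-kills K p)) (cov (pt p) p≢0))) nonzero

      refute-all-ordinary : All Ordinary R → ⊥
      refute-all-ordinary os =
        let ks , i , m₁ , m₂ , m₃ , e = settles-sound kss settled c refl (map⁺ cover≤2)
              (trans (sum-cover R) (trans (weight≡length R os) 11-lines))
            X , reg , l = generic i
        in Frame.refute-generic (pt m₁) (pt m₂) (pt m₃) X reg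
             (pt-kills K m₁ , pt-kills K m₂ , pt-kills K m₃) R cov (trans 11-lines (sym l))
             (covers-match R m₁ m₂ m₃ (trans (cover-0 R) 11-lines) e)
        where c = map (cover R) points

      module _ {s : Pair n} {R′ : List (Pair n)} (p : R ↭ s ∷ R′) (heavy : 3 ≤ on weigh s) where

        10-lines : length R′ ≡ 10
        10-lines = suc-injective (trans (sym (↭-length p)) 11-lines)

        weight≤14 : on weigh s + sum (map (on weigh) R′) ≤ 14
        weight≤14 = subst (_≤ 14) (trans (cong sum (map-cong (cover-↭ p) points)) (sum-cover (s ∷ R′))) (sum-bounded 2 (cover R) points cover≤2)

        refute-one-special : All Ordinary R′ → ⊥
        refute-one-special os =
          let ks , i , m₁ , m₂ , m₃ , h , e = settles′-sound kss′ settled′ x y z heavy c refl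
                (map⁺ (All.map (λ {q} h → ≤-trans (m≤n+m (cover R′ q) (vanish (ev s (pt q)))) (subst (_≤ 2) (cover-↭ p q) h)) cover≤2))
                (trans (sum-cover R′) (trans (weight≡length R′ os) 10-lines)) together
              X , reg , l = exceptional i
          in Frame.refute-special (pt m₁) (pt m₂) (pt m₃) X reg
               (pt-kills K m₁ , pt-kills K m₂ , pt-kills K m₃) s R′ (Covered-↭ p cov) (trans 10-lines (sym l))
               (covers-match R′ m₁ m₂ m₃ (trans (cover-0 R′) 10-lines) e)
               (special-match R′ m₁ m₂ m₃ s h)
          where
          c = map (cover R′) points
          x = ev s u₁
          y = ev s u₂
          z = ev s u₃
          together : fitsPlane x y z c ≡ true
          together = fitsPlane-complete x y z (cover R′) (All.map (λ {q} h → ≤-trans (≤-reflexive (trans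
            (cong (λ w → vanish w + cover R′ q) (sym (ev-pt s q))) (sym (cover-↭ p q)))) h) cover≤2)

        refute-special-line : ⊥
        refute-special-line with pick-special R′
        ... | inj₁ os = refute-one-special os
        -- Two heavy lines and nine others would weigh at least 3 + 3 + 9 = 15, more than 7 · 2.
        ... | inj₂ (s′ , R″ , q , heavy′) = <⇒≱ {14} {15} ≤-refl (≤-trans
          (+-mono-≤ heavy (≤-trans (+-mono-≤ heavy′ (≤-trans (≤-reflexive (sym 9-lines)) (length≤weight R″)))
            (≤-reflexive (trans (sym (sum-cover (s′ ∷ R″))) (trans (cong sum (map-cong (λ p → sym (cover-↭ q p)) points)) (sum-cover R′))))))
          weight≤14)
          where
          9-lines : length R″ ≡ 9
          9-lines = suc-injective (trans (sym (↭-length q)) 10-lines)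

      refute : ⊥
      refute with pick-special R
      ... | inj₁ os = refute-all-ordinary os
      ... | inj₂ (s , R′ , p , heavy) = refute-special-line p heavy

  -- Among five common killers and more, three independent ones can be chosen, each outside the span
  -- of the previous ones, of size 1, 2 and 4. If one of the seven combinations were zero, the last
  -- vector in it would lie in that span.
  small-kernel : ∀ R → Covered R → length R ≡ 11 → count (kills four) ≤ 4
  small-kernel R cov l = ≮⇒≥ λ big →
    let u₁ , k₁ , ∉₁ = escape (kills four) (0v ∷ []) (≤-trans (≤ᵇ⇒≤ 2 5 tt) big)
        u₂ , k₂ , ∉₂ = escape (kills four) (0v ∷ u₁ ∷ []) (≤-trans (≤ᵇ⇒≤ 3 5 tt) big)
        u₃ , k₃ , ∉₃ = escape (kills four) (0v ∷ u₁ ∷ u₂ ∷ u₁ ⊕ u₂ ∷ []) big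
    in refute u₁ u₂ u₃ (k₁ , k₂ , k₃) R cov l
         ( (λ e → ∉₁ (here e)) ∷ (λ e → ∉₂ (here e)) ∷ (λ e → ∉₂ (there (here (⊕-solve u₁ u₂ e)))) ∷ (λ e → ∉₃ (here e))
         ∷ (λ e → ∉₃ (there (here (⊕-solve u₁ u₃ e)))) ∷ (λ e → ∉₃ (there (there (here (⊕-solve u₂ u₃ e)))))
         ∷ (λ e → ∉₃ (there (there (there (here (⊕-solve (u₁ ⊕ u₂) u₃ (trans (⊕-assoc u₁ u₂ u₃) e)))))))
         ∷ [] )

refuted-by : ∀ {C ks} → Valid C 11 → length ks ≡ 11 →
             U C ≡ sums (zeroRow (map col₁ ks)) (map col₁ ks ∷ map col₂ ks ∷ map col₃ ks ∷ []) →
             ∀ codes → search C (decodes codes) ≡ true → Refuted ks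
refuted-by {C} V l r codes h = record
  { C = C ; V = V ; eleven = l ; rows-U = r
  ; refuted = Kill.no-clique C 11 V (decodes codes) h (lengths codes) }
  where
  lengths : ∀ codes → All (λ r → length r ≡ 11) (decodes codes)
  lengths [] = []
  lengths (c ∷ cs) = length-decode 11 c ∷ lengths cs

generic : ∀ {ks} → ks ∈ᴸ kss → Refuted ks × Regular ks × length ks ≡ 11
generic (here refl) = refuted-by valid-coll refl refl reps-coll search-coll , record { none-0 = refl ; none-8 = λ _ → refl ; total = refl } , refl
generic (there (here refl)) = refuted-by valid-tri refl refl reps-tri search-tri , record { none-0 = refl ; none-8 = λ _ → refl ; total = refl } , refl
generic (there (there (here refl))) = refuted-by valid-mixed refl refl reps-mixed search-mixed , record { none-0 = refl ; none-8 = λ _ → refl ; total = refl } , refl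

exceptional : ∀ {ks} → ks ∈ᴸ kss′ → Refuted (8 ∷ ks) × Regular ks × length ks ≡ 10
exceptional (here refl) = refuted-by valid-in refl refl reps-in search-in , record { none-0 = refl ; none-8 = λ _ → refl ; total = refl } , refl
exceptional (there (here refl)) = refuted-by valid-out refl refl reps-out search-out , record { none-0 = refl ; none-8 = λ _ → refl ; total = refl } , refl

-- The dimension is a variable with `2 ^ n ≡ 1024`, so that sums over the space cannot unfold into
-- 1024 terms.
no-fifteen : ∀ {n} → 2 ^ n ≡ 1024 → (ls : List (Pair n)) → length ls ≡ 15 → ¬ (∀ a → a ≢ 0v → zeros (evs ls a) ≤ 6)
no-fifteen {n} 2^n ls l cov = moments-contradict ls 2^n l cov small
  where
  small : ∀ ks rest → length ks ≡ 4 → ls ↭ ks ++ rest → count (kills ks) ≤ 4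
  small (l₁ ∷ l₂ ∷ l₃ ∷ l₄ ∷ []) rest _ p = Normalise.small-kernel 2^n l₁ l₂ l₃ l₄ generic exceptional rest
    (λ a a≢0 → subst (_≤ 6) (zeros-↭ a p) (cov a a≢0))
    (+-cancelˡ-≡ 4 _ _ (trans (sym (↭-length p)) l))

-- Back to lines and hyperplanes

pair : Line → Pair N
pair L = Line.u L , Line.v L

vanishing : ∀ {m} → Vec Line m → F₂^ N → Subset m
vanishing Ls a = Vec.map (λ L → isZ (ev (pair L) a)) Ls

size-vanishing : ∀ {m} (Ls : Vec Line m) a → ∣ vanishing Ls a ∣ ≡ zeros (evs (map pair (toList Ls)) a)
size-vanishing [] a = refl
size-vanishing (L ∷ Ls) a with ev (pair L) a
... | e₀ = cong suc (size-vanishing Ls a)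
... | e₁ = size-vanishing Ls a
... | e₂ = size-vanishing Ls a
... | e₃ = size-vanishing Ls a

vanishing-⊆ : ∀ L a (a≢0 : a ≢ 0v) → isZ (ev (pair L) a) ≡ true → L ⊆Hyp mkHyperplane a a≢0
vanishing-⊆ L a a≢0 h = λ
  { x (inj₁ refl) → dot-0ʳ a
  ; x (inj₂ (inj₁ refl)) → au
  ; x (inj₂ (inj₂ (inj₁ refl))) → av
  ; x (inj₂ (inj₂ (inj₂ refl))) → trans (dot-⊕ʳ a (Line.u L) (Line.v L)) (cong₂ _xor_ au av) }
  where
  h′ = trans (sym (isZ-fromBits (dot a (Line.u L)) (dot a (Line.v L)))) h
  au : dot a (Line.u L) ≡ false
  au = not-false _ (∧-splitˡ h′)
  av : dot a (Line.v L) ≡ false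
  av = not-false _ (∧-splitʳ {not (dot a (Line.u L))} h′)

theorem1p3 : ¬ ∃ (λ (Ls : Vec Line 15) → AtMostInEveryHyperplane 6 Ls)
theorem1p3 (Ls , atMost) = no-fifteen {N} refl (map pair (toList Ls)) (trans (length-map pair (toList Ls)) (length-toList Ls))
  λ a a≢0 → subst (_≤ 6) (size-vanishing Ls a) (atMost (mkHyperplane a a≢0) (vanishing Ls a) λ i i∈ →
    vanishing-⊆ (Vec.lookup Ls i) a a≢0 (trans (sym (lookup-map i (λ L → isZ (ev (pair L) a)) Ls)) ([]=⇒lookup i∈)))
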